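{- The $\mathbf{cd}$-indexes $\check\Phi(n,k,i)$ of the simplicial shelling components satisfy, for all $0\le i\le k\le n$, the recursion $$G(\check\Phi(n,k,i))=\check\Phi(n+1,k+1,i+1)$$ with the boundary conditions $$\check\Phi(n,k,0)=\Psi(B_k)\cdot\Psi(\Omega_{n-k+1})\qquad\text{for }1\le k\le n,$$ and $$\check\Phi(n,0,0)=\begin{cases}(\mathbf c^2-2\mathbf d)^{n/2}&\text{if } n\text{ is even},\\(\mathbf c^2-2\mathbf d)^{(n-1)/2}\cdot\mathbf c&\text{if } n\text{ is odd}.\end{cases}$$
   Context: A quasi-graded poset $(P,\rho,\bar\zeta)$ consists of a finite poset $P$, a function $\rho:P\to\mathbb N$ with $x<y\Rightarrow\rho(x)<\rho(y)$, and a function $\bar\zeta$ in the incidence algebra of $P$ with $\bar\zeta(x,x)=1$. Write $\rho(x,y)=\rho(y)-\rho(x)$. If $P$ has minimal element $\hat0$ and maximal element $\hat1$, $\hat0<\hat1$, its $\mathbf{ab}$-index is the polynomial in non-commuting variables $\mathbf a,\mathbf b$ $$\Psi(P)=\sum\bar\zeta(x_0,x_1)\cdots\bar\zeta(x_{k-1},x_k)\cdot(\mathbf a-\mathbf b)^{\rho(x_0,x_1)-1}\,\mathbf b\,(\mathbf a-\mathbf b)^{\rho(x_1,x_2)-1}\,\mathbf b\cdots\mathbf b\,(\mathbf a-\mathbf b)^{\rho(x_{k-1},x_k)-1},$$ summed over all chains $\hat0=x_0<x_1<\cdots<x_k=\hat1$. Put $\mathbf c=\mathbf a+\mathbf b$,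 $\mathbf d=\mathbf a\mathbf b+\mathbf b\mathbf a$. $G$ is the linear derivation on non-commutative polynomials in $\mathbf a,\mathbf b$ with $G(\mathbf a)=\mathbf b\mathbf a$, $G(\mathbf b)=\mathbf a\mathbf b$; it satisfies $G(\mathbf c)=\mathbf d$, $G(\mathbf d)=\mathbf c\mathbf d$. Semisuspension. For a finite simplicial complex $\Delta$ (containing $\emptyset$) with $\dim\Delta<n$, $\mathrm{Semi}(\Delta,n)$ is obtained by embedding $\Delta$ in the boundary of an $n$-ball; its face poset $\mathcal F(\mathrm{Semi}(\Delta,n))$ is the following quasi-graded poset, independent of the embedding: the elements are the faces of $\Delta$ (with $\hat0=\emptyset$) and two further elements $*$ and $\hat1$; $\rho(F)=\dim F+1$, $\rho(*)=n$, $\rho(\hat1)=n+1$; faces are ordered by inclusion, every other element is $<\hat1$, and $F<*$ for every face $F$ with $\rho(F)<n$ (faces of dimension $n-1$ are incomparable to $*$); $$\bar\zeta(F,*)=1+(-1)^{n-\rho(F)}\,\widetilde\chi(\mathrm{link}_\Delta(F)),\qquad\widetilde\chi(\mathrm{link}_\Delta(F))=\sum_{H\in\Delta,\,H\supseteq F}(-1)^{\dim H-\dim F-1},$$ and $\bar\zeta=1$ on all other intervals. (For $n=0$, where $\Delta=\{\emptyset\}$, the element $*$ is omitted.) For $0\le i\le k$, $\Delta_{k,i}$ is the simplicial complex generated by $i+1$ of the facets of the $k$-dimensional simplex (so $\dim\Delta_{k,i}=k-1$, and $\Delta_{0,0}=\{\emptyset\}$). For $0\le i\le k\le n$ let $P_{n,k,i}=\mathcal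 F(\mathrm{Semi}(\Delta_{k,i},n))$, and define $\check\Phi(n,k,0)=\Psi(P_{n,k,0})$ and $\check\Phi(n,k,i)=\Psi(P_{n,k,i})-\Psi(P_{n,k,i-1})$ for $1\le i\le k\le n$. $B_k$ is the Boolean algebra of rank $k$ with its usual rank function and $\bar\zeta\equiv1$. For $m\ge1$, $\Psi(\Omega_m)$ is the $\mathbf{ab}$-index of the quasi-graded poset $\{\hat0,p,c,\hat1\}$ with ranks $0,1,m,m+1$, ordered as the chain $\hat0<p<c<\hat1$ if $m\ge2$ and with $p,c$ incomparable if $m=1$, with $\bar\zeta(p,c)=1+(-1)^m$ (if $m\ge2$) and $\bar\zeta=1$ on all other intervals. -}

module Defs where

open import Data.Empty using (⊥-elim; ⊥-elim-irr)
open import Data.Fin.Base using (Fin; inject≤)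
import Data.Fin.Properties as Fin
open import Data.Fin.Subset
  using (Subset; inside; outside; _⊆_; ⁅_⁆; ∁; ∣_∣)
  renaming (⊥ to ∅; ⊤ to full)
open import Data.Fin.Subset.Properties
  using (_⊆?_; ⊆-refl; ⊆-trans; ⊆-antisym; ⊆-min; ⊆-max; ⊆-isPartialOrder;
         drop-∷-⊆; p⊆q⇒∣p∣≤∣q∣; ∣⊥∣≡0; ∣∁p∣≡n∸∣p∣; ∣⁅x⁆∣≡1)
open import Data.Integer.Base as ℤ using (ℤ; 0ℤ; 1ℤ; -1ℤ)
open import Data.List.Base
  using (List; []; _∷_; [_]; _++_; map; concat; concatMap; filter; foldr;
         cartesianProductWith; upTo)
import Data.List.Properties as List
open import Data.List.Membership.Propositional using (_∈_)
open import Data.List.Membership.Propositional.Properties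
  using (∈-map⁺; ∈-map⁻; ∈-++⁺ˡ; ∈-++⁺ʳ)
open import Data.List.Relation.Unary.All as All using (All; []; _∷_)
open import Data.List.Relation.Unary.AllPairs using ([]; _∷_)
open import Data.List.Relation.Unary.Any using (here; there)
open import Data.List.Relation.Unary.Unique.Propositional using (Unique)
import Data.List.Relation.Unary.Unique.Propositional.Properties as Unique
open import Data.Nat.Base
  using (ℕ; zero; suc; _∸_; _≤_; _<_; z≤n; s≤s; z<s; NonZero; >-nonZero⁻¹)
import Data.Nat.Properties as ℕ
open import Data.Product.Base using (_×_; _,_; ∃)
open import Data.Vec.Base using ([]; _∷_)
import Data.Vec.Base as Vec
import Data.Vec.Properties as Vec
import Data.Bool.Properties as Bool
open import Function.Base using (_∘_)
open import Level using (0ℓ)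
open import Relation.Binary.Core using (Rel)
open import Relation.Binary.Definitions using (DecidableEquality; Minimum; Maximum)
import Relation.Binary.Definitions as B
open import Relation.Binary.PropositionalEquality
  using (_≡_; _≢_; refl; sym; trans; cong; subst; isEquivalence)
open import Relation.Binary.Structures using (IsDecPartialOrder)
import Relation.Binary.Construct.NonStrictToStrict as ToStrict
open import Relation.Nullary using (yes; no; ¬_)
open import Relation.Nullary.Decidable using (recompute; map′)
open import Relation.Unary using (Decidable)

data Letter : Set where
  a b : Letter

_≟ₗ_ : DecidableEquality Letter
a ≟ₗ a = yes refl
a ≟ₗ b = no λ ()
b ≟ₗ a = no λ ()
b ≟ₗ b = yes refl

Word : Set
Word = List Letter

_≟ʷ_ : DecidableEquality Word
_≟ʷ_ = List.≡-dec _≟ₗ_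

-- A polynomial is a formal sum of terms (coefficient , word); a word may
-- occur several times, so equality is `_≈ₚ_`, not `_≡_`.
Poly : Set
Poly = List (ℤ × Word)

coeff : Poly → Word → ℤ
coeff []            w = 0ℤ
coeff ((c , u) ∷ p) w with u ≟ʷ w
... | yes _ = c ℤ.+ coeff p w
... | no  _ = coeff p w

infix  4 _≈ₚ_
infixl 6 _+ₚ_ _-ₚ_
infixl 7 _*ₚ_
infixr 7 _·ₚ_
infixr 8 _^ₚ_

_≈ₚ_ : Rel Poly 0ℓ
p ≈ₚ q = ∀ w → coeff p w ≡ coeff q w

1ₚ : Poly
1ₚ = [ 1ℤ , [] ]

_+ₚ_ : Poly → Poly → Poly
_+ₚ_ = _++_

sumₚ : List Poly → Poly
sumₚ = concat

_·ₚ_ : ℤ → Poly → Poly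
k ·ₚ p = map (λ (c , u) → k ℤ.* c , u) p

_-ₚ_ : Poly → Poly → Poly
p -ₚ q = p +ₚ -1ℤ ·ₚ q

_*ₚ_ : Poly → Poly → Poly
_*ₚ_ = cartesianProductWith (λ (c , u) (d , v) → c ℤ.* d , u ++ v)

_^ₚ_ : Poly → ℕ → Poly
p ^ₚ zero  = 1ₚ
p ^ₚ suc n = p *ₚ p ^ₚ n

letter : Letter → Poly
letter x = [ 1ℤ , [ x ] ]

𝐚 𝐛 𝐜 𝐝 : Poly
𝐚 = letter a
𝐛 = letter b
𝐜 = 𝐚 +ₚ 𝐛
𝐝 = 𝐚 *ₚ 𝐛 +ₚ 𝐛 *ₚ 𝐚

Gₗ : Letter → Poly
Gₗ a = 𝐛 *ₚ 𝐚
Gₗ b = 𝐚 *ₚ 𝐛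

-- Leibniz rule along a word: G(x·w) = G(x)·w + x·G(w).
Gʷ : Word → Poly
Gʷ []      = []
Gʷ (x ∷ w) = Gₗ x *ₚ [ 1ℤ , w ] +ₚ letter x *ₚ Gʷ w

G : Poly → Poly
G p = sumₚ (map (λ (c , w) → c ·ₚ Gʷ w) p)

record QuasiGradedPoset : Set₁ where
  infix 4 _⊑_ _⊏_ _⊏?_
  field
    Carrier           : Set
    _⊑_               : Rel Carrier 0ℓ
    isDecPartialOrder : IsDecPartialOrder _≡_ _⊑_
    elements          : List Carrier
    complete          : ∀ x → x ∈ elements
    unique            : Unique elements

  open IsDecPartialOrder isDecPartialOrder public
    using (isPartialOrder) renaming (_≟_ to _≟ᶜ_; _≤?_ to _⊑?_)

  _⊏_ : Rel Carrier 0ℓ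
  _⊏_ = ToStrict._<_ _≡_ _⊑_

  _⊏?_ : B.Decidable _⊏_
  _⊏?_ = ToStrict.<-decidable _≡_ _⊑_ _≟ᶜ_ _⊑?_

  -- ζ̄ is an element of the incidence algebra: only its values ζ̄ x y with
  -- x ⊑ y are meaningful, its values off the order are junk.
  field
    ρ      : Carrier → ℕ
    ρ-mono : ∀ {x y} → x ⊏ y → ρ x < ρ y
    ζ̄      : Carrier → Carrier → ℤ
    ζ̄-refl : ∀ x → ζ̄ x x ≡ 1ℤ

  ρ⟨_,_⟩ : Carrier → Carrier → ℕ
  ρ⟨ x , y ⟩ = ρ y ∸ ρ x

record BoundedQuasiGradedPoset : Set₁ where
  field
    quasiGradedPoset : QuasiGradedPoset

  open QuasiGradedPoset quasiGradedPoset public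

  field
    0̂ 1̂     : Carrier
    minimum : Minimum _⊑_ 0̂
    maximum : Maximum _⊑_ 1̂
    0̂≢1̂     : 0̂ ≢ 1̂

  -- chains k x lists the interiors x₁ , … , x_k of all chains
  -- x < x₁ < ⋯ < x_k < 1̂.
  chains : ℕ → Carrier → List (List Carrier)
  chains zero    x with x ⊏? 1̂
  ... | yes _ = [ [] ]
  ... | no  _ = []
  chains (suc k) x =
    concatMap (λ y → map (y ∷_) (chains k y)) (filter (x ⊏?_) elements)

  step : Carrier → Carrier → Poly
  step x y = ζ̄ x y ·ₚ (𝐚 -ₚ 𝐛) ^ₚ (ρ⟨ x , y ⟩ ∸ 1)

  weight : Carrier → List Carrier → Poly
  weight x []       = step x 1̂
  weight x (y ∷ ys) = step x y *ₚ 𝐛 *ₚ weight y ys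

  -- A chain from 0̂ to 1̂ with k interior elements has k < ρ⟨ 0̂ , 1̂ ⟩,
  -- since ρ increases strictly along it; so this is the sum over all chains.
  abIndex : Poly
  abIndex =
    sumₚ (map (weight 0̂) (concatMap (λ k → chains k 0̂) (upTo ρ⟨ 0̂ , 1̂ ⟩)))

Ψ : BoundedQuasiGradedPoset → Poly
Ψ = BoundedQuasiGradedPoset.abIndex

_≟ˢ_ : ∀ {v} → DecidableEquality (Subset v)
_≟ˢ_ = Vec.≡-dec Bool._≟_

subsets : ∀ v → List (Subset v)
subsets zero    = [ [] ]
subsets (suc v) = map (outside ∷_) (subsets v) ++ map (inside ∷_) (subsets v)

∈-subsets : ∀ {v} (F : Subset v) → F ∈ subsets v
∈-subsets []            = here refl
∈-subsets (outside ∷ F) = ∈-++⁺ˡ (∈-map⁺ (outside ∷_) (∈-subsets F))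
∈-subsets (inside  ∷ F) =
  ∈-++⁺ʳ (map (outside ∷_) (subsets _)) (∈-map⁺ (inside ∷_) (∈-subsets F))

subsets-unique : ∀ v → Unique (subsets v)
subsets-unique zero    = [] ∷ []
subsets-unique (suc v) = Unique.++⁺
  (Unique.map⁺ Vec.∷-injectiveʳ (subsets-unique v))
  (Unique.map⁺ Vec.∷-injectiveʳ (subsets-unique v))
  disjoint
  where
  disjoint : ∀ {F} → ¬ (F ∈ map (outside ∷_) (subsets v) ×
                        F ∈ map (inside ∷_) (subsets v))
  disjoint (p , q) with ∈-map⁻ (outside ∷_) p | ∈-map⁻ (inside ∷_) q
  ... | _ , _ , refl | _ , _ , ()

∣∣-strictMono : ∀ {v} {F H : Subset v} → F ⊆ H → F ≢ H → ∣ F ∣ < ∣ H ∣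
∣∣-strictMono {F = []}          {[]}          F⊆H F≢H = ⊥-elim (F≢H refl)
∣∣-strictMono {F = outside ∷ F} {outside ∷ H} F⊆H F≢H =
  ∣∣-strictMono (drop-∷-⊆ F⊆H) (F≢H ∘ cong (outside ∷_))
∣∣-strictMono {F = outside ∷ F} {inside ∷ H}  F⊆H F≢H =
  s≤s (p⊆q⇒∣p∣≤∣q∣ (drop-∷-⊆ F⊆H))
∣∣-strictMono {F = inside ∷ F}  {outside ∷ H} F⊆H F≢H with F⊆H Vec.here
... | ()
∣∣-strictMono {F = inside ∷ F}  {inside ∷ H}  F⊆H F≢H =
  s≤s (∣∣-strictMono (drop-∷-⊆ F⊆H) (F≢H ∘ cong (inside ∷_)))

-- The vertices lie in Fin v; not every element of Fin v need be a vertex.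
record SimplicialComplex (v : ℕ) : Set₁ where
  field
    Face   : Subset v → Set
    face?  : Decidable Face
    ∅-face : Face ∅
    down   : ∀ {F H} → F ⊆ H → Face H → Face F

  faces : List (Subset v)
  faces = filter face? (subsets v)

  -- The sum of (-1)^(dim H - dim F - 1) over H ⊇ F; as dim F = ∣F∣ - 1, the
  -- exponent is ∣H∣ - ∣F∣ - 1, which may be -1, and has the parity of
  -- ∣H∣ - ∣F∣ + 1.
  χ̃-link : Subset v → ℤ
  χ̃-link F = foldr ℤ._+_ 0ℤ
    (map (λ H → -1ℤ ℤ.^ suc (∣ H ∣ ∸ ∣ F ∣)) (filter (F ⊆?_) faces))

  infix 4 dim<_
  dim<_ : ℕ → Set
  dim< n = ∀ {F} → Face F → ∣ F ∣ ≤ n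

module Semisuspension {v} (Δ : SimplicialComplex v) (n : ℕ) where
  open SimplicialComplex Δ

  -- Membership in Δ is irrelevant, so each face gives exactly one element;
  -- for n = 0 there is no star.
  data SemiElement : Set where
    face : (F : Subset v) → .(Face F) → SemiElement
    star : .(NonZero n) → SemiElement
    top  : SemiElement

  infix 4 _≤ˢ_
  data _≤ˢ_ : Rel SemiElement 0ℓ where
    face≤face : ∀ {F H} .{f : Face F} .{h : Face H} → F ⊆ H → face F f ≤ˢ face H h
    face≤star : ∀ {F} .{f : Face F} .{n≢0 : NonZero n} → ∣ F ∣ < n → face F f ≤ˢ star n≢0
    star≤star : .{n≢0 : NonZero n} → star n≢0 ≤ˢ star n≢0
    ≤top      : ∀ {x} → x ≤ˢ top

  face-cong : ∀ {F H} .{f : Face F} .{h : Face H} → F ≡ H → face F f ≡ face H h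
  face-cong refl = refl

  face-injective : ∀ {F H} .{f : Face F} .{h : Face H} → face F f ≡ face H h → F ≡ H
  face-injective refl = refl

  _≟_ : DecidableEquality SemiElement
  face F _ ≟ face H _ = map′ face-cong face-injective (F ≟ˢ H)
  face _ _ ≟ star _   = no λ ()
  face _ _ ≟ top      = no λ ()
  star _   ≟ face _ _ = no λ ()
  star _   ≟ star _   = yes refl
  star _   ≟ top      = no λ ()
  top      ≟ face _ _ = no λ ()
  top      ≟ star _   = no λ ()
  top      ≟ top      = yes refl

  _≤?_ : B.Decidable _≤ˢ_
  face F _ ≤? face H _ = map′ face≤face (λ { (face≤face p) → p }) (F ⊆? H)
  face F _ ≤? star _   = map′ face≤star (λ { (face≤star p) → p }) (∣ F ∣ ℕ.<? n)
  star _   ≤? face _ _ = no λ ()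
  star _   ≤? star _   = yes star≤star
  top      ≤? face _ _ = no λ ()
  top      ≤? star _   = no λ ()
  _        ≤? top      = yes ≤top

  ≤-refl : ∀ {x} → x ≤ˢ x
  ≤-refl {face F _} = face≤face ⊆-refl
  ≤-refl {star _}   = star≤star
  ≤-refl {top}      = ≤top

  ≤-trans : ∀ {x y z} → x ≤ˢ y → y ≤ˢ z → x ≤ˢ z
  ≤-trans (face≤face p) (face≤face q) = face≤face (⊆-trans p q)
  ≤-trans (face≤face p) (face≤star q) = face≤star (ℕ.≤-<-trans (p⊆q⇒∣p∣≤∣q∣ p) q)
  ≤-trans (face≤star p) star≤star     = face≤star p
  ≤-trans star≤star     star≤star     = star≤star
  ≤-trans _             ≤top          = ≤top

  ≤-antisym : ∀ {x y} → x ≤ˢ y → y ≤ˢ x → x ≡ y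
  ≤-antisym (face≤face p) (face≤face q) = face-cong (⊆-antisym p q)
  ≤-antisym star≤star     _             = refl
  ≤-antisym ≤top          ≤top          = refl

  ≤-isDecPartialOrder : IsDecPartialOrder _≡_ _≤ˢ_
  ≤-isDecPartialOrder = record
    { isPartialOrder = record
      { isPreorder = record
        { isEquivalence = isEquivalence
        ; reflexive     = λ { refl → ≤-refl }
        ; trans         = ≤-trans
        }
      ; antisym = ≤-antisym
      }
    ; _≟_  = _≟_
    ; _≤?_ = _≤?_
    }

  faceElements : List (Subset v) → List SemiElement
  faceElements []       = []
  faceElements (F ∷ Fs) with face? F
  ... | yes f = face F f ∷ faceElements Fs
  ... | no  _ = faceElements Fs

  starElements : List SemiElement
  starElements with ℕ.nonZero? n
  ... | yes n≢0 = [ star n≢0 ]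
  ... | no  _   = []

  semiElements : List SemiElement
  semiElements = faceElements (subsets v) ++ starElements ++ [ top ]

  ∈-faceElements : ∀ {F Fs} .(f : Face F) → F ∈ Fs → face F f ∈ faceElements Fs
  ∈-faceElements {F} f (here refl) with face? F
  ... | yes _  = here refl
  ... | no  ¬f = ⊥-elim-irr (¬f f)
  ∈-faceElements {Fs = H ∷ _} f (there F∈Fs) with face? H
  ... | yes _ = there (∈-faceElements f F∈Fs)
  ... | no  _ = ∈-faceElements f F∈Fs

  faceElements-face : ∀ {P : SemiElement → Set} Fs →
                      All (λ F → (f : Face F) → P (face F f)) Fs →
                      All P (faceElements Fs)
  faceElements-face []       []       = []
  faceElements-face (F ∷ Fs) (p ∷ ps) with face? F
  ... | yes f = p f ∷ faceElements-face Fs ps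
  ... | no  _ = faceElements-face Fs ps

  faceElements-unique : ∀ {Fs} → Unique Fs → Unique (faceElements Fs)
  faceElements-unique []                     = []
  faceElements-unique {F ∷ Fs} (F∉Fs ∷ uniq) with face? F
  ... | yes f = faceElements-face Fs (All.map (λ F≢H _ → F≢H ∘ face-injective) F∉Fs)
                ∷ faceElements-unique uniq
  ... | no  _ = faceElements-unique uniq

  complete : ∀ x → x ∈ semiElements
  complete (face F f) = ∈-++⁺ˡ (∈-faceElements f (∈-subsets F))
  complete (star n≢0) = ∈-++⁺ʳ (faceElements (subsets v)) (∈-++⁺ˡ star∈)
    where
    star∈ : star n≢0 ∈ starElements
    star∈ with ℕ.nonZero? n
    ... | yes _   = here refl
    ... | no  n≡0 = ⊥-elim-irr (n≡0 n≢0)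
  complete top        = ∈-++⁺ʳ (faceElements (subsets v)) (∈-++⁺ʳ starElements (here refl))

  unique : Unique semiElements
  unique = Unique.++⁺ (faceElements-unique (subsets-unique v)) tail-unique disjoint
    where
    tail-unique : Unique (starElements ++ [ top ])
    tail-unique with ℕ.nonZero? n
    ... | yes _ = ((λ ()) ∷ []) ∷ [] ∷ []
    ... | no  _ = [] ∷ []

    IsFace : SemiElement → Set
    IsFace x = ∃ λ F → ∃ λ (f : Face F) → x ≡ face F f

    heads : All IsFace (faceElements (subsets v))
    heads = faceElements-face (subsets v)
      (All.tabulate λ {F} _ f → F , f , refl)

    tails : All (¬_ ∘ IsFace) (starElements ++ [ top ])
    tails with ℕ.nonZero? n
    ... | yes _ = (λ ()) ∷ (λ ()) ∷ []
    ... | no  _ = (λ ()) ∷ []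

    disjoint : ∀ {x} → ¬ (x ∈ faceElements (subsets v) × x ∈ starElements ++ [ top ])
    disjoint (p , q) = All.lookup tails q (All.lookup heads p)

  rank : SemiElement → ℕ
  rank (face F _) = ∣ F ∣
  rank (star _)   = n
  rank top        = suc n

  rank-mono : dim< n → ∀ {x y} → ToStrict._<_ _≡_ _≤ˢ_ x y → rank x < rank y
  rank-mono dimΔ (face≤face p , F≢H)       = ∣∣-strictMono p (F≢H ∘ face-cong)
  rank-mono dimΔ (face≤star p , _)         = p
  rank-mono dimΔ (star≤star , ≢)           = ⊥-elim (≢ refl)
  rank-mono dimΔ {face F f} (≤top , _)     = s≤s (dimΔ (recompute (face? F) f))
  rank-mono dimΔ {star _}   (≤top , _)     = ℕ.n<1+n n
  rank-mono dimΔ {top}      (≤top , ≢)     = ⊥-elim (≢ refl)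

  ζ : SemiElement → SemiElement → ℤ
  ζ (face F _) (star _) = 1ℤ ℤ.+ -1ℤ ℤ.^ (n ∸ ∣ F ∣) ℤ.* χ̃-link F
  ζ _          _        = 1ℤ

  ζ-refl : ∀ x → ζ x x ≡ 1ℤ
  ζ-refl (face _ _) = refl
  ζ-refl (star _)   = refl
  ζ-refl top        = refl

  ∅-min : Minimum _≤ˢ_ (face ∅ ∅-face)
  ∅-min (face F _)   = face≤face (⊆-min F)
  ∅-min (star n≢0)   =
    face≤star (subst (_< n) (sym (∣⊥∣≡0 v)) (>-nonZero⁻¹ n {{recompute (ℕ.nonZero? n) n≢0}}))
  ∅-min top          = ≤top

𝓕Semi : ∀ {v} (Δ : SimplicialComplex v) n → SimplicialComplex.dim<_ Δ n →
        BoundedQuasiGradedPoset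
𝓕Semi Δ n dimΔ = record
  { quasiGradedPoset = record
    { Carrier           = SemiElement
    ; _⊑_               = _≤ˢ_
    ; isDecPartialOrder = ≤-isDecPartialOrder
    ; elements          = semiElements
    ; complete          = complete
    ; unique            = unique
    ; ρ                 = rank
    ; ρ-mono            = rank-mono dimΔ
    ; ζ̄                 = ζ
    ; ζ̄-refl            = ζ-refl
    }
  ; 0̂       = face ∅ ∅-face
  ; 1̂       = top
  ; minimum = ∅-min
  ; maximum = λ _ → ≤top
  ; 0̂≢1̂     = λ ()
  }
  where
  open SimplicialComplex Δ
  open Semisuspension Δ n

generatedBy : ∀ {v i} → (Fin (suc i) → Subset v) → SimplicialComplex v
generatedBy facet = record
  { Face   = λ F → ∃ λ j → F ⊆ facet j
  ; face?  = λ F → Fin.any? λ j → F ⊆? facet j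
  ; ∅-face = Fin.zero , ⊆-min _
  ; down   = λ F⊆H (j , H⊆) → j , ⊆-trans F⊆H H⊆
  }

-- The k-simplex has vertex set Fin (suc k), its facets being the complements
-- of single vertices.  By symmetry the choice of i + 1 of them is immaterial;
-- we take those omitting one of the first i + 1 vertices.
Δ⟨_,_⟩ : ∀ k i → .(i ≤ k) → SimplicialComplex (suc k)
Δ⟨ k , i ⟩ i≤k = generatedBy {i = i} λ j → ∁ ⁅ inject≤ j (s≤s i≤k) ⁆

Δ-dim : ∀ {n k i} .(i≤k : i ≤ k) → k ≤ n → SimplicialComplex.dim<_ (Δ⟨ k , i ⟩ i≤k) n
Δ-dim {k = k} i≤k k≤n {F} (j , F⊆) = ℕ.≤-trans (p⊆q⇒∣p∣≤∣q∣ F⊆)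
  (subst (_≤ _) (sym (trans (∣∁p∣≡n∸∣p∣ ⁅ x ⁆) (cong (suc k ∸_) (∣⁅x⁆∣≡1 x)))) k≤n)
  where x = inject≤ j (s≤s i≤k)

P : ∀ n k i → i ≤ k → k ≤ n → BoundedQuasiGradedPoset
P n k i i≤k k≤n = 𝓕Semi (Δ⟨ k , i ⟩ i≤k) n (Δ-dim i≤k k≤n)

Φ̌ : ∀ n k i → i ≤ k → k ≤ n → Poly
Φ̌ n k zero    0≤k   k≤n = Ψ (P n k 0 0≤k k≤n)
Φ̌ n k (suc i) 1+i≤k k≤n =
  Ψ (P n k (suc i) 1+i≤k k≤n) -ₚ Ψ (P n k i (ℕ.<⇒≤ 1+i≤k) k≤n)

⊆-isDecPartialOrder : ∀ {k} → IsDecPartialOrder _≡_ (_⊆_ {k})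
⊆-isDecPartialOrder = record
  { isPartialOrder = ⊆-isPartialOrder _
  ; _≟_            = _≟ˢ_
  ; _≤?_           = _⊆?_
  }

∅≢full : ∀ {k} .{{_ : NonZero k}} → ∅ {k} ≢ full
∅≢full {suc _} ()

Boolean : ∀ k .{{_ : NonZero k}} → BoundedQuasiGradedPoset
Boolean k = record
  { quasiGradedPoset = record
    { Carrier           = Subset k
    ; _⊑_               = _⊆_
    ; isDecPartialOrder = ⊆-isDecPartialOrder
    ; elements          = subsets k
    ; complete          = ∈-subsets
    ; unique            = subsets-unique k
    ; ρ                 = ∣_∣
    ; ρ-mono            = λ (F⊆H , F≢H) → ∣∣-strictMono F⊆H F≢H
    ; ζ̄                 = λ _ _ → 1ℤ
    ; ζ̄-refl            = λ _ → refl
    }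
  ; 0̂       = ∅
  ; 1̂       = full
  ; minimum = ⊆-min
  ; maximum = ⊆-max
  ; 0̂≢1̂     = ∅≢full
  }

module Omega (m : ℕ) where

  data ΩElement : Set where
    bot p c top : ΩElement

  infix 4 _≤Ω_
  data _≤Ω_ : Rel ΩElement 0ℓ where
    bot≤ : ∀ {x} → bot ≤Ω x
    ≤top : ∀ {x} → x ≤Ω top
    p≤p  : p ≤Ω p
    c≤c  : c ≤Ω c
    p≤c  : 2 ≤ m → p ≤Ω c

  _≟_ : DecidableEquality ΩElement
  bot ≟ bot = yes refl
  bot ≟ p   = no λ ()
  bot ≟ c   = no λ ()
  bot ≟ top = no λ ()
  p   ≟ bot = no λ ()
  p   ≟ p   = yes refl
  p   ≟ c   = no λ ()
  p   ≟ top = no λ ()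
  c   ≟ bot = no λ ()
  c   ≟ p   = no λ ()
  c   ≟ c   = yes refl
  c   ≟ top = no λ ()
  top ≟ bot = no λ ()
  top ≟ p   = no λ ()
  top ≟ c   = no λ ()
  top ≟ top = yes refl

  _≤?_ : B.Decidable _≤Ω_
  bot ≤? _   = yes bot≤
  p   ≤? bot = no λ ()
  p   ≤? p   = yes p≤p
  p   ≤? c   = map′ p≤c (λ { (p≤c 2≤m) → 2≤m }) (2 ℕ.≤? m)
  p   ≤? top = yes ≤top
  c   ≤? bot = no λ ()
  c   ≤? p   = no λ ()
  c   ≤? c   = yes c≤c
  c   ≤? top = yes ≤top
  top ≤? bot = no λ ()
  top ≤? p   = no λ ()
  top ≤? c   = no λ ()
  top ≤? top = yes ≤top

  ≤-refl : ∀ {x} → x ≤Ω x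
  ≤-refl {bot} = bot≤
  ≤-refl {p}   = p≤p
  ≤-refl {c}   = c≤c
  ≤-refl {top} = ≤top

  ≤-trans : ∀ {x y z} → x ≤Ω y → y ≤Ω z → x ≤Ω z
  ≤-trans bot≤    _       = bot≤
  ≤-trans _       ≤top    = ≤top
  ≤-trans p≤p     q       = q
  ≤-trans c≤c     q       = q
  ≤-trans (p≤c r) c≤c     = p≤c r

  ≤-antisym : ∀ {x y} → x ≤Ω y → y ≤Ω x → x ≡ y
  ≤-antisym bot≤ bot≤ = refl
  ≤-antisym ≤top ≤top = refl
  ≤-antisym p≤p  _    = refl
  ≤-antisym c≤c  _    = refl

  ≤-isDecPartialOrder : IsDecPartialOrder _≡_ _≤Ω_
  ≤-isDecPartialOrder = record
    { isPartialOrder = record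
      { isPreorder = record
        { isEquivalence = isEquivalence
        ; reflexive     = λ { refl → ≤-refl }
        ; trans         = ≤-trans
        }
      ; antisym = ≤-antisym
      }
    ; _≟_  = _≟_
    ; _≤?_ = _≤?_
    }

  rank : ΩElement → ℕ
  rank bot = 0
  rank p   = 1
  rank c   = m
  rank top = suc m

  rank-mono : .{{_ : NonZero m}} → ∀ {x y} → ToStrict._<_ _≡_ _≤Ω_ x y → rank x < rank y
  rank-mono {bot} {bot} (_ , ≢)       = ⊥-elim (≢ refl)
  rank-mono {bot} {p}   _             = z<s
  rank-mono {bot} {c}   _             = >-nonZero⁻¹ m
  rank-mono {bot} {top} _             = z<s
  rank-mono {p}   {top} _             = s≤s (>-nonZero⁻¹ m)
  rank-mono {c}   {top} _             = ℕ.n<1+n m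
  rank-mono {top} {top} (_ , ≢)       = ⊥-elim (≢ refl)
  rank-mono             (p≤p , ≢)     = ⊥-elim (≢ refl)
  rank-mono             (c≤c , ≢)     = ⊥-elim (≢ refl)
  rank-mono             (p≤c 2≤m , _) = 2≤m

  ζ : ΩElement → ΩElement → ℤ
  ζ p c = 1ℤ ℤ.+ -1ℤ ℤ.^ m
  ζ _ _ = 1ℤ

  ζ-refl : ∀ x → ζ x x ≡ 1ℤ
  ζ-refl bot = refl
  ζ-refl p   = refl
  ζ-refl c   = refl
  ζ-refl top = refl

Ω : ∀ m .{{_ : NonZero m}} → BoundedQuasiGradedPoset
Ω m = record
  { quasiGradedPoset = record
    { Carrier           = ΩElement
    ; _⊑_               = _≤Ω_
    ; isDecPartialOrder = ≤-isDecPartialOrder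
    ; elements          = bot ∷ p ∷ c ∷ top ∷ []
    ; complete          = λ where
        bot → here refl
        p   → there (here refl)
        c   → there (there (here refl))
        top → there (there (there (here refl)))
    ; unique            =
        ((λ ()) ∷ (λ ()) ∷ (λ ()) ∷ []) ∷ ((λ ()) ∷ (λ ()) ∷ []) ∷ ((λ ()) ∷ []) ∷ [] ∷ []
    ; ρ                 = rank
    ; ρ-mono            = rank-mono
    ; ζ̄                 = ζ
    ; ζ̄-refl            = ζ-refl
    }
  ; 0̂       = bot
  ; 1̂       = top
  ; minimum = λ _ → bot≤
  ; maximum = λ _ → ≤top
  ; 0̂≢1̂     = λ ()
  }
  where open Omega m

{-# OPTIONS --safe #-}
-- Let F be a face of the complex defining P n k i.  If F misses p of the first
-- i + 1 vertices and q of the others, its link is again such a complex, with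
-- parameters (p + q - 1 , p - 1); so summing over the first nonempty face of a chain
-- expresses the ab-index by the ab-indices of smaller semisuspensions, with weights
-- 𝐮 ∣F∣, where 𝐮 j = (𝐚 - 𝐛)^(j-1) 𝐛.  In the difference Φ̌ n k i the faces containing
-- vertex i have the same link in both complexes and cancel, which leaves a sum over
-- all sets of the remaining k vertices.  Since G (𝐮 j) = 𝐮 1 𝐮 j + 𝐮 (j+1), applying G
-- to this sum amounts to adjoining one vertex: the sets avoiding it arise from G
-- acting on the second factor, by induction, those containing it from the terms
-- 𝐮 (j+1).
module Submission where

open import Defs
open import Data.Bool.Base using (true; false; if_then_else_)
open import Data.Empty using (⊥-elim)
open import Data.Fin.Base using (zero; suc; toℕ; inject≤; fromℕ<)
open import Data.Fin.Properties using (toℕ-inject≤; toℕ-fromℕ<; toℕ-injective; toℕ<n)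
import Data.Fin.Subset as Subset
open import Data.Fin.Subset using (Subset; inside; outside; _⊆_; ∣_∣; ⊥; ⊤)
open import Data.Fin.Subset.Properties
  using (_⊆?_; p⊆q⇒∣p∣≤∣q∣; ⊆-max; x∈⁅x⁆; x∈⁅y⁆⇒x≡y; x∈∁p⇒x∉p; x∉p⇒x∈∁p; drop-there; ∣⊥∣≡0; ∣⊤∣≡n)
open import Data.Integer.Base as ℤ using (ℤ; 0ℤ; 1ℤ; -1ℤ; +_)
import Data.Integer.Properties as ℤ
open import Data.Integer.Tactic.RingSolver using (solve-∀)
open import Data.List.Base
  using (List; []; _∷_; [_]; _++_; map; concatMap; foldr; filter; upTo; applyUpTo)
import Data.List.Properties as List
open import Data.List.Membership.Propositional using (_∈_)
open import Data.List.Membership.Propositional.Properties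
  using (∈-map⁻; ∈-++⁻; ∈-filter⁻)
open import Data.List.Relation.Unary.All as All using ()
import Data.List.Relation.Unary.All.Properties as All
open import Data.List.Relation.Unary.Any using (here; there)
open import Data.Nat.Base
  using (ℕ; zero; suc; _+_; _*_; _∸_; _≤_; _<_; z≤n; s≤s; z<s; NonZero; >-nonZero)
open import Data.Nat.DivMod using (_/_; _%_; m≡m%n+[m/n]*n; m%n<n; m*n/n≡m)
open import Data.Nat.Divisibility using (_∣_; divides)
import Data.Nat.Properties as ℕ
open import Data.Product.Base using (_×_; _,_; proj₁; proj₂; ∃)
open import Data.Sum.Base using (inj₁; inj₂)
open import Data.Vec.Base using ([]; _∷_; here; there)
open import Function.Base using (_∘_; id)
open import Level using (0ℓ)
open import Relation.Binary.Bundles using (Setoid)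
open import Relation.Binary.PropositionalEquality
  using (_≡_; _≢_; refl; sym; trans; cong; cong₂; subst; module ≡-Reasoning)
import Relation.Binary.Reasoning.Setoid as SetoidReasoning
open import Relation.Binary.Structures using (IsPartialOrder)
open import Relation.Nullary using (Dec; yes; no; does; ¬_)
open import Relation.Nullary.Decidable using (recompute)
open import Relation.Unary using (Pred; Decidable)

-- The products `𝐮 1 *ₚ 𝐮 j` in `G (𝐮 j)` are not surplus. Adjoining a vertex also creates the set
-- consisting of that vertex alone, whose term `𝐮 1 *ₚ φ n p q` no `𝐮 (suc j)` with j ≥ 1 supplies.
-- By the recursion for `φ` this term is `𝐮 1` times the initial term `φ₀` plus `𝐮 1` times the sum
-- over sets; `G` of the initial term yields the first part, the products yield the second.
--
-- The boundary condition for k ≥ 1 follows from the same recursion. Sorting chains by their first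
-- element shows that Ψ(B_k) Ψ(Ω_{r+1}) satisfies the recursion of `φ (r + k) 0 k`. Boolean chains
-- stop at the full set; its term is supplied by Ω_{r+1}, where the interval above p has the
-- ab-index of the semisuspension of {∅} with n = r.
--
-- Sums may run over all vertex sets because the degenerate terms vanish: `𝐮 0` is zero, which
-- removes the empty set and the missing star when n = 0, and the void complex (p = 0) has `ψ` zero,
-- which removes the non-faces.

private variable
  A B : Set

-- Finite sums of integers

∑ℤ : List A → (A → ℤ) → ℤ
∑ℤ xs f = foldr ℤ._+_ 0ℤ (map f xs)

∑ℤ-cong-∈ : ∀ (xs : List A) {f g} → (∀ {x} → x ∈ xs → f x ≡ g x) → ∑ℤ xs f ≡ ∑ℤ xs g
∑ℤ-cong-∈ []       eq = refl
∑ℤ-cong-∈ (x ∷ xs) eq = cong₂ ℤ._+_ (eq (here refl)) (∑ℤ-cong-∈ xs (eq ∘ there))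

∑ℤ-cong : ∀ (xs : List A) {f g} → (∀ x → f x ≡ g x) → ∑ℤ xs f ≡ ∑ℤ xs g
∑ℤ-cong xs eq = ∑ℤ-cong-∈ xs λ {x} _ → eq x

∑ℤ-zero : ∀ (xs : List A) {f} → (∀ {x} → x ∈ xs → f x ≡ 0ℤ) → ∑ℤ xs f ≡ 0ℤ
∑ℤ-zero []       eq = refl
∑ℤ-zero (x ∷ xs) eq = cong₂ ℤ._+_ (eq (here refl)) (∑ℤ-zero xs (eq ∘ there))

∑ℤ-++ : ∀ (xs ys : List A) (f : A → ℤ) → ∑ℤ (xs ++ ys) f ≡ ∑ℤ xs f ℤ.+ ∑ℤ ys f
∑ℤ-++ []       ys f = sym (ℤ.+-identityˡ _)
∑ℤ-++ (x ∷ xs) ys f = trans (cong (ℤ._+_ (f x)) (∑ℤ-++ xs ys f)) (sym (ℤ.+-assoc (f x) _ _))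

∑ℤ-map : ∀ (h : A → B) xs f → ∑ℤ (map h xs) f ≡ ∑ℤ xs (f ∘ h)
∑ℤ-map h []       f = refl
∑ℤ-map h (x ∷ xs) f = cong (ℤ._+_ (f (h x))) (∑ℤ-map h xs f)

∑ℤ-concatMap : ∀ (h : A → List B) xs f → ∑ℤ (concatMap h xs) f ≡ ∑ℤ xs λ x → ∑ℤ (h x) f
∑ℤ-concatMap h []       f = refl
∑ℤ-concatMap h (x ∷ xs) f =
  trans (∑ℤ-++ (h x) _ f) (cong (ℤ._+_ (∑ℤ (h x) f)) (∑ℤ-concatMap h xs f))

∑ℤ-distrib-+ : ∀ (xs : List A) f g → ∑ℤ xs (λ x → f x ℤ.+ g x) ≡ ∑ℤ xs f ℤ.+ ∑ℤ xs g
∑ℤ-distrib-+ []       f g = refl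
∑ℤ-distrib-+ (x ∷ xs) f g =
  trans (cong (ℤ._+_ (f x ℤ.+ g x)) (∑ℤ-distrib-+ xs f g)) (swap (f x) (g x) _ _)
  where
  swap : ∀ i j k l → i ℤ.+ j ℤ.+ (k ℤ.+ l) ≡ i ℤ.+ k ℤ.+ (j ℤ.+ l)
  swap = solve-∀

∑ℤ-distribˡ-* : ∀ (xs : List A) k f → k ℤ.* ∑ℤ xs f ≡ ∑ℤ xs λ x → k ℤ.* f x
∑ℤ-distribˡ-* []       k f = ℤ.*-zeroʳ k
∑ℤ-distribˡ-* (x ∷ xs) k f =
  trans (ℤ.*-distribˡ-+ k (f x) _) (cong (ℤ._+_ (k ℤ.* f x)) (∑ℤ-distribˡ-* xs k f))

∑ℤ-swap : ∀ (xs : List A) (ys : List B) (f : A → B → ℤ) →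
          ∑ℤ xs (λ x → ∑ℤ ys λ y → f x y) ≡ ∑ℤ ys λ y → ∑ℤ xs λ x → f x y
∑ℤ-swap []       ys f = sym (∑ℤ-zero ys λ _ → refl)
∑ℤ-swap (x ∷ xs) ys f =
  trans (cong (ℤ._+_ (∑ℤ ys (f x))) (∑ℤ-swap xs ys f)) (sym (∑ℤ-distrib-+ ys (f x) _))

-- Polynomials as linear functionals

-- A polynomial acts on functions on words by linear extension.  Polynomials with
-- the same action have the same coefficients, and all laws are read off from the
-- action; _≋_ is a record so that Agda can infer the polynomials it relates.

lin : Poly → (Word → ℤ) → ℤ
lin p f = ∑ℤ p λ (c , u) → c ℤ.* f u

infix 4 _≋_
record _≋_ (p q : Poly) : Set where
  constructor ≋-intro
  field lin-≡ : ∀ f → lin p f ≡ lin q f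
open _≋_

δ : Word → Word → ℤ
δ w u with u ≟ʷ w
... | yes _ = 1ℤ
... | no  _ = 0ℤ

coeff-lin : ∀ p w → coeff p w ≡ lin p (δ w)
coeff-lin []            w = refl
coeff-lin ((c , u) ∷ p) w with u ≟ʷ w
... | yes _ = cong₂ ℤ._+_ (sym (ℤ.*-identityʳ c)) (coeff-lin p w)
... | no  _ = begin
  coeff p w                    ≡⟨ coeff-lin p w ⟩
  lin p (δ w)                  ≡⟨ ℤ.+-identityˡ _ ⟨
  0ℤ ℤ.+ lin p (δ w)           ≡⟨ cong (ℤ._+ lin p (δ w)) (ℤ.*-zeroʳ c) ⟨
  c ℤ.* 0ℤ ℤ.+ lin p (δ w)     ∎
  where open ≡-Reasoning

≋⇒≈ₚ : ∀ {p q} → p ≋ q → p ≈ₚ q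
≋⇒≈ₚ {p} {q} p≋q w = trans (coeff-lin p w) (trans (lin-≡ p≋q (δ w)) (sym (coeff-lin q w)))

lin-cong : ∀ p {f g} → (∀ u → f u ≡ g u) → lin p f ≡ lin p g
lin-cong p eq = ∑ℤ-cong p λ (c , u) → cong (c ℤ.*_) (eq u)

lin-+ₚ : ∀ p q f → lin (p +ₚ q) f ≡ lin p f ℤ.+ lin q f
lin-+ₚ p q f = ∑ℤ-++ p q _

lin-·ₚ : ∀ k p f → lin (k ·ₚ p) f ≡ k ℤ.* lin p f
lin-·ₚ k p f = begin
  lin (k ·ₚ p) f                        ≡⟨ ∑ℤ-map _ p _ ⟩
  ∑ℤ p (λ (c , u) → k ℤ.* c ℤ.* f u)    ≡⟨ ∑ℤ-cong p (λ (c , u) → ℤ.*-assoc k c (f u)) ⟩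
  ∑ℤ p (λ (c , u) → k ℤ.* (c ℤ.* f u))  ≡⟨ ∑ℤ-distribˡ-* p k _ ⟨
  k ℤ.* lin p f                         ∎
  where open ≡-Reasoning

lin-sub : ∀ p q f → lin (p -ₚ q) f ≡ lin p f ℤ.- lin q f
lin-sub p q f = begin
  lin (p -ₚ q) f                    ≡⟨ lin-+ₚ p (-1ℤ ·ₚ q) f ⟩
  lin p f ℤ.+ lin (-1ℤ ·ₚ q) f      ≡⟨ cong (ℤ._+_ (lin p f)) (lin-·ₚ -1ℤ q f) ⟩
  lin p f ℤ.+ -1ℤ ℤ.* lin q f       ≡⟨ cong (ℤ._+_ (lin p f)) (ℤ.-1*i≡-i (lin q f)) ⟩
  lin p f ℤ.- lin q f               ∎
  where open ≡-Reasoning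

lin-monomial : ∀ u f → lin [ 1ℤ , u ] f ≡ f u
lin-monomial u f = trans (ℤ.+-identityʳ _) (ℤ.*-identityˡ (f u))

-- This turns ring laws into rearrangements of iterated sums: associativity becomes that of `_++_`,
-- distributivity becomes linearity, and the Leibniz rule becomes a rule for concatenated words.
lin-*ₚ : ∀ p q f → lin (p *ₚ q) f ≡ lin p λ u → lin q λ v → f (u ++ v)
lin-*ₚ []            q f = refl
lin-*ₚ ((c , u) ∷ p) q f = begin
  lin (map (λ (d , v) → c ℤ.* d , u ++ v) q ++ p *ₚ q) f
    ≡⟨ ∑ℤ-++ (map (λ (d , v) → c ℤ.* d , u ++ v) q) (p *ₚ q) _ ⟩
  lin (map (λ (d , v) → c ℤ.* d , u ++ v) q) f ℤ.+ lin (p *ₚ q) f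
    ≡⟨ cong₂ ℤ._+_ scale (lin-*ₚ p q f) ⟩
  lin ((c , u) ∷ p) (λ u → lin q λ v → f (u ++ v)) ∎
  where
  open ≡-Reasoning
  scale : lin (map (λ (d , v) → c ℤ.* d , u ++ v) q) f ≡ c ℤ.* lin q λ v → f (u ++ v)
  scale = begin
    lin (map (λ (d , v) → c ℤ.* d , u ++ v) q) f
      ≡⟨ ∑ℤ-map (λ (d , v) → c ℤ.* d , u ++ v) q _ ⟩
    ∑ℤ q (λ (d , v) → c ℤ.* d ℤ.* f (u ++ v))
      ≡⟨ ∑ℤ-cong q (λ (d , v) → ℤ.*-assoc c d (f (u ++ v))) ⟩
    ∑ℤ q (λ (d , v) → c ℤ.* (d ℤ.* f (u ++ v)))
      ≡⟨ ∑ℤ-distribˡ-* q c _ ⟨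
    c ℤ.* lin q (λ v → f (u ++ v)) ∎

lin-distrib-+ : ∀ p (f g : Word → ℤ) → lin p (λ u → f u ℤ.+ g u) ≡ lin p f ℤ.+ lin p g
lin-distrib-+ p f g =
  trans (∑ℤ-cong p λ (c , u) → ℤ.*-distribˡ-+ c (f u) (g u)) (∑ℤ-distrib-+ p _ _)

lin-distribˡ-* : ∀ p k (f : Word → ℤ) → lin p (λ u → k ℤ.* f u) ≡ k ℤ.* lin p f
lin-distribˡ-* p k f =
  trans (∑ℤ-cong p λ (c , u) → swap c k (f u)) (sym (∑ℤ-distribˡ-* p k _))
  where
  swap : ∀ i j l → i ℤ.* (j ℤ.* l) ≡ j ℤ.* (i ℤ.* l)
  swap = solve-∀

lin-swap : ∀ p q (f : Word → Word → ℤ) →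
           lin p (λ u → lin q λ v → f u v) ≡ lin q λ v → lin p λ u → f u v
lin-swap p q f = begin
  lin p (λ u → lin q λ v → f u v)
    ≡⟨ ∑ℤ-cong p (λ (c , u) → ∑ℤ-distribˡ-* q c λ (d , v) → d ℤ.* f u v) ⟩
  ∑ℤ p (λ (c , u) → ∑ℤ q λ (d , v) → c ℤ.* (d ℤ.* f u v))
    ≡⟨ ∑ℤ-swap p q (λ (c , u) (d , v) → c ℤ.* (d ℤ.* f u v)) ⟩
  ∑ℤ q (λ (d , v) → ∑ℤ p λ (c , u) → c ℤ.* (d ℤ.* f u v))
    ≡⟨ ∑ℤ-cong q (λ (d , v) → lin-distribˡ-* p d (λ u → f u v)) ⟩
  lin q (λ v → lin p λ u → f u v) ∎
  where open ≡-Reasoning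

lin-concatMap : ∀ (xs : List A) h f → lin (concatMap h xs) f ≡ ∑ℤ xs λ x → lin (h x) f
lin-concatMap xs h f = ∑ℤ-concatMap h xs _

lin-G : ∀ p f → lin (G p) f ≡ lin p λ u → lin (Gʷ u) f
lin-G p f = trans (lin-concatMap p (λ (c , u) → c ·ₚ Gʷ u) f)
                  (∑ℤ-cong p λ (c , u) → lin-·ₚ c (Gʷ u) f)

-- The ring of polynomials and its derivation G

≋-setoid : Setoid 0ℓ 0ℓ
≋-setoid = record
  { Carrier       = Poly
  ; _≈_           = _≋_
  ; isEquivalence = record
    { refl  = ≋-intro λ f → refl
    ; sym   = λ p≋q → ≋-intro λ f → sym (lin-≡ p≋q f)
    ; trans = λ p≋q q≋r → ≋-intro λ f → trans (lin-≡ p≋q f) (lin-≡ q≋r f)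
    }
  }

open Setoid ≋-setoid using () renaming
  (refl to ≋-refl; sym to ≋-sym; trans to ≋-trans; reflexive to ≋-reflexive)
module ≋-Reasoning = SetoidReasoning ≋-setoid

+ₚ-cong : ∀ {p p′ q q′} → p ≋ p′ → q ≋ q′ → p +ₚ q ≋ p′ +ₚ q′
+ₚ-cong {p} {p′} {q} {q′} p≋ q≋ = ≋-intro λ f →
  trans (lin-+ₚ p q f) (trans (cong₂ ℤ._+_ (lin-≡ p≋ f) (lin-≡ q≋ f)) (sym (lin-+ₚ p′ q′ f)))

+ₚ-congˡ : ∀ p {q q′} → q ≋ q′ → p +ₚ q ≋ p +ₚ q′
+ₚ-congˡ p = +ₚ-cong {p} ≋-refl

+ₚ-congʳ : ∀ {p p′} q → p ≋ p′ → p +ₚ q ≋ p′ +ₚ q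
+ₚ-congʳ q p≋ = +ₚ-cong p≋ (≋-refl {q})

+ₚ-comm : ∀ p q → p +ₚ q ≋ q +ₚ p
+ₚ-comm p q = ≋-intro λ f →
  trans (lin-+ₚ p q f) (trans (ℤ.+-comm (lin p f) (lin q f)) (sym (lin-+ₚ q p f)))

·ₚ-congˡ : ∀ k {p q} → p ≋ q → k ·ₚ p ≋ k ·ₚ q
·ₚ-congˡ k {p} {q} p≋q = ≋-intro λ f →
  trans (lin-·ₚ k p f) (trans (cong (k ℤ.*_) (lin-≡ p≋q f)) (sym (lin-·ₚ k q f)))

-ₚ-cong : ∀ {p p′ q q′} → p ≋ p′ → q ≋ q′ → p -ₚ q ≋ p′ -ₚ q′
-ₚ-cong p≋ q≋ = +ₚ-cong p≋ (·ₚ-congˡ -1ℤ q≋)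

*ₚ-cong : ∀ {p p′ q q′} → p ≋ p′ → q ≋ q′ → p *ₚ q ≋ p′ *ₚ q′
*ₚ-cong {p} {p′} {q} {q′} p≋ q≋ = ≋-intro λ f → begin
  lin (p *ₚ q) f                       ≡⟨ lin-*ₚ p q f ⟩
  lin p (λ u → lin q (f ∘ (u ++_)))    ≡⟨ lin-cong p (λ u → lin-≡ q≋ _) ⟩
  lin p (λ u → lin q′ (f ∘ (u ++_)))   ≡⟨ lin-≡ p≋ _ ⟩
  lin p′ (λ u → lin q′ (f ∘ (u ++_)))  ≡⟨ lin-*ₚ p′ q′ f ⟨
  lin (p′ *ₚ q′) f                     ∎
  where open ≡-Reasoning

*ₚ-congˡ : ∀ p {q q′} → q ≋ q′ → p *ₚ q ≋ p *ₚ q′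
*ₚ-congˡ p = *ₚ-cong {p} ≋-refl

*ₚ-congʳ : ∀ {p p′} q → p ≋ p′ → p *ₚ q ≋ p′ *ₚ q
*ₚ-congʳ q p≋ = *ₚ-cong p≋ (≋-refl {q})

*ₚ-assoc : ∀ p q r → (p *ₚ q) *ₚ r ≋ p *ₚ (q *ₚ r)
*ₚ-assoc p q r = ≋-intro λ f → begin
  lin (p *ₚ q *ₚ r) f                                       ≡⟨ lin-*ₚ (p *ₚ q) r f ⟩
  lin (p *ₚ q) (λ u → lin r λ w → f (u ++ w))               ≡⟨ lin-*ₚ p q _ ⟩
  lin p (λ u → lin q λ v → lin r λ w → f ((u ++ v) ++ w))
    ≡⟨ lin-cong p (λ u → trans
         (lin-cong q λ v → lin-cong r λ w → cong f (List.++-assoc u v w))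
         (sym (lin-*ₚ q r (f ∘ (u ++_))))) ⟩
  lin p (λ u → lin (q *ₚ r) (λ v → f (u ++ v)))             ≡⟨ lin-*ₚ p (q *ₚ r) f ⟨
  lin (p *ₚ (q *ₚ r)) f                                     ∎
  where open ≡-Reasoning

*ₚ-identityˡ : ∀ p → 1ₚ *ₚ p ≋ p
*ₚ-identityˡ p = ≋-intro λ f →
  trans (lin-*ₚ 1ₚ p f) (lin-monomial [] λ u → lin p λ v → f (u ++ v))

*ₚ-identityʳ : ∀ p → p *ₚ 1ₚ ≋ p
*ₚ-identityʳ p = ≋-intro λ f →
  trans (lin-*ₚ p 1ₚ f)
        (lin-cong p λ u → trans (lin-monomial [] (f ∘ (u ++_))) (cong f (List.++-identityʳ u)))

*ₚ-zeroʳ : ∀ p → p *ₚ [] ≋ []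
*ₚ-zeroʳ []      = ≋-refl
*ₚ-zeroʳ (_ ∷ p) = *ₚ-zeroʳ p

*ₚ-distribˡ-+ₚ : ∀ p q r → p *ₚ (q +ₚ r) ≋ p *ₚ q +ₚ p *ₚ r
*ₚ-distribˡ-+ₚ p q r = ≋-intro λ f → begin
  lin (p *ₚ (q +ₚ r)) f                                      ≡⟨ lin-*ₚ p (q +ₚ r) f ⟩
  lin p (λ u → lin (q +ₚ r) (f ∘ (u ++_)))                   ≡⟨ lin-cong p (λ u → lin-+ₚ q r _) ⟩
  lin p (λ u → lin q (f ∘ (u ++_)) ℤ.+ lin r (f ∘ (u ++_)))  ≡⟨ lin-distrib-+ p _ _ ⟩
  lin p (λ u → lin q (f ∘ (u ++_))) ℤ.+ lin p (λ u → lin r (f ∘ (u ++_)))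
    ≡⟨ cong₂ ℤ._+_ (lin-*ₚ p q f) (lin-*ₚ p r f) ⟨
  lin (p *ₚ q) f ℤ.+ lin (p *ₚ r) f                          ≡⟨ lin-+ₚ (p *ₚ q) (p *ₚ r) f ⟨
  lin (p *ₚ q +ₚ p *ₚ r) f                                   ∎
  where open ≡-Reasoning

*ₚ-distribʳ-+ₚ : ∀ r p q → (p +ₚ q) *ₚ r ≋ p *ₚ r +ₚ q *ₚ r
*ₚ-distribʳ-+ₚ r p q = ≋-intro λ f → begin
  lin ((p +ₚ q) *ₚ r) f              ≡⟨ lin-*ₚ (p +ₚ q) r f ⟩
  lin (p +ₚ q) _                     ≡⟨ lin-+ₚ p q _ ⟩
  lin p _ ℤ.+ lin q _                ≡⟨ cong₂ ℤ._+_ (lin-*ₚ p r f) (lin-*ₚ q r f) ⟨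
  lin (p *ₚ r) f ℤ.+ lin (q *ₚ r) f  ≡⟨ lin-+ₚ (p *ₚ r) (q *ₚ r) f ⟨
  lin (p *ₚ r +ₚ q *ₚ r) f           ∎
  where open ≡-Reasoning

·ₚ-*ₚ-assoc : ∀ k p q → (k ·ₚ p) *ₚ q ≋ k ·ₚ (p *ₚ q)
·ₚ-*ₚ-assoc k p q = ≋-intro λ f → begin
  lin ((k ·ₚ p) *ₚ q) f  ≡⟨ lin-*ₚ (k ·ₚ p) q f ⟩
  lin (k ·ₚ p) _         ≡⟨ lin-·ₚ k p _ ⟩
  k ℤ.* lin p _          ≡⟨ cong (k ℤ.*_) (lin-*ₚ p q f) ⟨
  k ℤ.* lin (p *ₚ q) f   ≡⟨ lin-·ₚ k (p *ₚ q) f ⟨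
  lin (k ·ₚ (p *ₚ q)) f  ∎
  where open ≡-Reasoning

*ₚ-·ₚ-comm : ∀ k p q → p *ₚ (k ·ₚ q) ≋ k ·ₚ (p *ₚ q)
*ₚ-·ₚ-comm k p q = ≋-intro λ f → begin
  lin (p *ₚ (k ·ₚ q)) f                           ≡⟨ lin-*ₚ p (k ·ₚ q) f ⟩
  lin p (λ u → lin (k ·ₚ q) (f ∘ (u ++_)))        ≡⟨ lin-cong p (λ u → lin-·ₚ k q _) ⟩
  lin p (λ u → k ℤ.* lin q (f ∘ (u ++_)))         ≡⟨ lin-distribˡ-* p k _ ⟩
  k ℤ.* lin p (λ u → lin q (f ∘ (u ++_)))         ≡⟨ cong (k ℤ.*_) (lin-*ₚ p q f) ⟨
  k ℤ.* lin (p *ₚ q) f                            ≡⟨ lin-·ₚ k (p *ₚ q) f ⟨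
  lin (k ·ₚ (p *ₚ q)) f                           ∎
  where open ≡-Reasoning

*ₚ-distribˡ-sub : ∀ p q r → p *ₚ (q -ₚ r) ≋ p *ₚ q -ₚ p *ₚ r
*ₚ-distribˡ-sub p q r =
  ≋-trans (*ₚ-distribˡ-+ₚ p q (-1ℤ ·ₚ r)) (+ₚ-congˡ (p *ₚ q) (*ₚ-·ₚ-comm -1ℤ p r))

*ₚ-distribʳ-sub : ∀ r p q → (p -ₚ q) *ₚ r ≋ p *ₚ r -ₚ q *ₚ r
*ₚ-distribʳ-sub r p q =
  ≋-trans (*ₚ-distribʳ-+ₚ r p (-1ℤ ·ₚ q)) (+ₚ-congˡ (p *ₚ r) (·ₚ-*ₚ-assoc -1ℤ q r))

G-cong : ∀ {p q} → p ≋ q → G p ≋ G q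
G-cong {p} {q} p≋q = ≋-intro λ f →
  trans (lin-G p f) (trans (lin-≡ p≋q _) (sym (lin-G q f)))

G-+ₚ : ∀ p q → G (p +ₚ q) ≋ G p +ₚ G q
G-+ₚ p q = ≋-intro λ f → begin
  lin (G (p +ₚ q)) f           ≡⟨ lin-G (p +ₚ q) f ⟩
  lin (p +ₚ q) _               ≡⟨ lin-+ₚ p q _ ⟩
  lin p _ ℤ.+ lin q _          ≡⟨ cong₂ ℤ._+_ (lin-G p f) (lin-G q f) ⟨
  lin (G p) f ℤ.+ lin (G q) f  ≡⟨ lin-+ₚ (G p) (G q) f ⟨
  lin (G p +ₚ G q) f           ∎
  where open ≡-Reasoning

G-·ₚ : ∀ k p → G (k ·ₚ p) ≋ k ·ₚ G p
G-·ₚ k p = ≋-intro λ f → begin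
  lin (G (k ·ₚ p)) f   ≡⟨ lin-G (k ·ₚ p) f ⟩
  lin (k ·ₚ p) _       ≡⟨ lin-·ₚ k p _ ⟩
  k ℤ.* lin p _        ≡⟨ cong (k ℤ.*_) (lin-G p f) ⟨
  k ℤ.* lin (G p) f    ≡⟨ lin-·ₚ k (G p) f ⟨
  lin (k ·ₚ G p) f     ∎
  where open ≡-Reasoning

lin-Gʷ-∷ : ∀ x w f → lin (Gʷ (x ∷ w)) f ≡
           lin (Gₗ x) (λ u → f (u ++ w)) ℤ.+ lin (Gʷ w) (λ u → f (x ∷ u))
lin-Gʷ-∷ x w f = trans (lin-+ₚ (Gₗ x *ₚ [ 1ℤ , w ]) (letter x *ₚ Gʷ w) f) (cong₂ ℤ._+_
  (trans (lin-*ₚ (Gₗ x) [ 1ℤ , w ] f) (lin-cong (Gₗ x) λ u → lin-monomial w (f ∘ (u ++_))))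
  (trans (lin-*ₚ (letter x) (Gʷ w) f) (lin-monomial [ x ] λ u → lin (Gʷ w) (f ∘ (u ++_)))))

-- `Gʷ` obeys the Leibniz rule for a leading letter by definition; induction on `u` extends it to
-- any prefix.
lin-Gʷ-++ : ∀ u v f → lin (Gʷ (u ++ v)) f ≡
            lin (Gʷ u) (λ s → f (s ++ v)) ℤ.+ lin (Gʷ v) (λ s → f (u ++ s))
lin-Gʷ-++ []      v f = sym (ℤ.+-identityˡ _)
lin-Gʷ-++ (x ∷ u) v f = begin
  lin (Gʷ (x ∷ u ++ v)) f
    ≡⟨ lin-Gʷ-∷ x (u ++ v) f ⟩
  lin (Gₗ x) (λ s → f (s ++ (u ++ v))) ℤ.+ lin (Gʷ (u ++ v)) (λ s → f (x ∷ s))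
    ≡⟨ cong₂ ℤ._+_ (lin-cong (Gₗ x) λ s → cong f (sym (List.++-assoc s u v)))
                   (lin-Gʷ-++ u v (λ s → f (x ∷ s))) ⟩
  lin (Gₗ x) (λ s → f ((s ++ u) ++ v)) ℤ.+
    (lin (Gʷ u) (λ s → f (x ∷ s ++ v)) ℤ.+ lin (Gʷ v) (λ s → f (x ∷ u ++ s)))
    ≡⟨ ℤ.+-assoc (lin (Gₗ x) λ s → f ((s ++ u) ++ v)) (lin (Gʷ u) λ s → f (x ∷ s ++ v))
                 (lin (Gʷ v) λ s → f (x ∷ u ++ s)) ⟨
  lin (Gₗ x) (λ s → f ((s ++ u) ++ v)) ℤ.+ lin (Gʷ u) (λ s → f (x ∷ s ++ v)) ℤ.+
    lin (Gʷ v) (λ s → f (x ∷ u ++ s))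
    ≡⟨ cong (ℤ._+ lin (Gʷ v) (λ s → f (x ∷ u ++ s))) (lin-Gʷ-∷ x u (λ s → f (s ++ v))) ⟨
  lin (Gʷ (x ∷ u)) (λ s → f (s ++ v)) ℤ.+ lin (Gʷ v) (λ s → f (x ∷ u ++ s)) ∎
  where open ≡-Reasoning

G-*ₚ : ∀ p q → G (p *ₚ q) ≋ G p *ₚ q +ₚ p *ₚ G q
G-*ₚ p q = ≋-intro λ f → begin
  lin (G (p *ₚ q)) f
    ≡⟨ trans (lin-G (p *ₚ q) f) (lin-*ₚ p q _) ⟩
  lin p (λ u → lin q λ v → lin (Gʷ (u ++ v)) f)
    ≡⟨ lin-cong p (λ u → trans (lin-cong q λ v → lin-Gʷ-++ u v f) (lin-distrib-+ q _ _)) ⟩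
  lin p (λ u → lin q (λ v → lin (Gʷ u) λ s → f (s ++ v)) ℤ.+
               lin q (λ v → lin (Gʷ v) λ s → f (u ++ s)))
    ≡⟨ lin-distrib-+ p _ _ ⟩
  lin p (λ u → lin q λ v → lin (Gʷ u) λ s → f (s ++ v)) ℤ.+
  lin p (λ u → lin q λ v → lin (Gʷ v) λ s → f (u ++ s))
    ≡⟨ cong₂ ℤ._+_
         -- `Gʷ u` does not involve `v`, so the two actions can be exchanged and the derivative
         -- joins the sum over `p`.
         (trans (lin-cong p λ u → lin-swap q (Gʷ u) λ v s → f (s ++ v))
                (sym (trans (lin-*ₚ (G p) q f) (lin-G p _))))
         (trans (lin-cong p λ u → sym (lin-G q (f ∘ (u ++_))))
                (sym (lin-*ₚ p (G q) f))) ⟩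
  lin (G p *ₚ q) f ℤ.+ lin (p *ₚ G q) f
    ≡⟨ lin-+ₚ (G p *ₚ q) (p *ₚ G q) f ⟨
  lin (G p *ₚ q +ₚ p *ₚ G q) f ∎
  where open ≡-Reasoning

-- Finite sums of polynomials

∑ : List A → (A → Poly) → Poly
∑ xs f = concatMap f xs

∑-cong-∈ : ∀ (xs : List A) {f g} → (∀ {x} → x ∈ xs → f x ≋ g x) → ∑ xs f ≋ ∑ xs g
∑-cong-∈ []       eq = ≋-refl
∑-cong-∈ (x ∷ xs) eq = +ₚ-cong (eq (here refl)) (∑-cong-∈ xs (eq ∘ there))

∑-cong : ∀ (xs : List A) {f g} → (∀ x → f x ≋ g x) → ∑ xs f ≋ ∑ xs g
∑-cong xs eq = ∑-cong-∈ xs λ {x} _ → eq x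

∑-zero : ∀ (xs : List A) {f} → (∀ {x} → x ∈ xs → f x ≋ []) → ∑ xs f ≋ []
∑-zero []       eq = ≋-refl
∑-zero (x ∷ xs) eq = +ₚ-cong (eq (here refl)) (∑-zero xs (eq ∘ there))

∑-++ : ∀ (xs ys : List A) f → ∑ (xs ++ ys) f ≡ ∑ xs f +ₚ ∑ ys f
∑-++ xs ys f = List.concatMap-++ f xs ys

∑-map : ∀ (h : A → B) xs f → ∑ (map h xs) f ≡ ∑ xs (f ∘ h)
∑-map h xs f = List.concatMap-map f h xs

∑-concatMap : ∀ (h : A → List B) xs f → ∑ (concatMap h xs) f ≡ ∑ xs λ x → ∑ (h x) f
∑-concatMap h []       f = refl
∑-concatMap h (x ∷ xs) f =
  trans (∑-++ (h x) _ f) (cong (∑ (h x) f ++_) (∑-concatMap h xs f))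

∑-distrib-+ₚ : ∀ (xs : List A) f g → ∑ xs (λ x → f x +ₚ g x) ≋ ∑ xs f +ₚ ∑ xs g
∑-distrib-+ₚ xs f g = ≋-intro λ h → begin
  lin (∑ xs λ x → f x +ₚ g x) h                    ≡⟨ lin-concatMap xs _ h ⟩
  ∑ℤ xs (λ x → lin (f x +ₚ g x) h)                 ≡⟨ ∑ℤ-cong xs (λ x → lin-+ₚ (f x) (g x) h) ⟩
  ∑ℤ xs (λ x → lin (f x) h ℤ.+ lin (g x) h)
    ≡⟨ ∑ℤ-distrib-+ xs (λ x → lin (f x) h) (λ x → lin (g x) h) ⟩
  ∑ℤ xs (λ x → lin (f x) h) ℤ.+ ∑ℤ xs (λ x → lin (g x) h)
    ≡⟨ cong₂ ℤ._+_ (lin-concatMap xs f h) (lin-concatMap xs g h) ⟨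
  lin (∑ xs f) h ℤ.+ lin (∑ xs g) h                ≡⟨ lin-+ₚ (∑ xs f) (∑ xs g) h ⟨
  lin (∑ xs f +ₚ ∑ xs g) h                         ∎
  where open ≡-Reasoning

∑-distribˡ-·ₚ : ∀ (xs : List A) k f → k ·ₚ ∑ xs f ≋ ∑ xs λ x → k ·ₚ f x
∑-distribˡ-·ₚ xs k f = ≋-intro λ h → begin
  lin (k ·ₚ ∑ xs f) h                ≡⟨ lin-·ₚ k (∑ xs f) h ⟩
  k ℤ.* lin (∑ xs f) h               ≡⟨ cong (k ℤ.*_) (lin-concatMap xs f h) ⟩
  k ℤ.* ∑ℤ xs (λ x → lin (f x) h)    ≡⟨ ∑ℤ-distribˡ-* xs k (λ x → lin (f x) h) ⟩
  ∑ℤ xs (λ x → k ℤ.* lin (f x) h)    ≡⟨ ∑ℤ-cong xs (λ x → lin-·ₚ k (f x) h) ⟨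
  ∑ℤ xs (λ x → lin (k ·ₚ f x) h)     ≡⟨ lin-concatMap xs (λ x → k ·ₚ f x) h ⟨
  lin (∑ xs λ x → k ·ₚ f x) h        ∎
  where open ≡-Reasoning

∑-distrib-sub : ∀ (xs : List A) f g → ∑ xs (λ x → f x -ₚ g x) ≋ ∑ xs f -ₚ ∑ xs g
∑-distrib-sub xs f g = ≋-trans (∑-distrib-+ₚ xs f (λ x → -1ℤ ·ₚ g x))
  (+ₚ-congˡ (∑ xs f) (≋-sym (∑-distribˡ-·ₚ xs -1ℤ g)))

∑-distribˡ-*ₚ : ∀ (xs : List A) p f → p *ₚ ∑ xs f ≋ ∑ xs λ x → p *ₚ f x
∑-distribˡ-*ₚ []       p f = *ₚ-zeroʳ p
∑-distribˡ-*ₚ (x ∷ xs) p f =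
  ≋-trans (*ₚ-distribˡ-+ₚ p (f x) (∑ xs f)) (+ₚ-congˡ (p *ₚ f x) (∑-distribˡ-*ₚ xs p f))

∑-distribʳ-*ₚ : ∀ (xs : List A) p f → ∑ xs f *ₚ p ≋ ∑ xs λ x → f x *ₚ p
∑-distribʳ-*ₚ []       p f = ≋-refl
∑-distribʳ-*ₚ (x ∷ xs) p f =
  ≋-trans (*ₚ-distribʳ-+ₚ p (f x) (∑ xs f)) (+ₚ-congˡ (f x *ₚ p) (∑-distribʳ-*ₚ xs p f))

∑-swap : ∀ (xs : List A) (ys : List B) (f : A → B → Poly) →
         ∑ xs (λ x → ∑ ys λ y → f x y) ≋ ∑ ys λ y → ∑ xs λ x → f x y
∑-swap xs ys f = ≋-intro λ h → begin
  lin (∑ xs λ x → ∑ ys λ y → f x y) h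
    ≡⟨ trans (lin-concatMap xs _ h) (∑ℤ-cong xs λ x → lin-concatMap ys (f x) h) ⟩
  ∑ℤ xs (λ x → ∑ℤ ys λ y → lin (f x y) h)
    ≡⟨ ∑ℤ-swap xs ys (λ x y → lin (f x y) h) ⟩
  ∑ℤ ys (λ y → ∑ℤ xs λ x → lin (f x y) h)
    ≡⟨ trans (lin-concatMap ys _ h) (∑ℤ-cong ys λ y → lin-concatMap xs (λ x → f x y) h) ⟨
  lin (∑ ys λ y → ∑ xs λ x → f x y) h ∎
  where open ≡-Reasoning

G-∑ : ∀ (xs : List A) f → G (∑ xs f) ≋ ∑ xs λ x → G (f x)
G-∑ []       f = ≋-refl
G-∑ (x ∷ xs) f = ≋-trans (G-+ₚ (f x) (∑ xs f)) (+ₚ-congˡ (G (f x)) (G-∑ xs f))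

-- The polynomials 𝐞 = 𝐚 - 𝐛 and 𝐮 j = 𝐞 ^ (j - 1) 𝐛

+ₚ-interchange : ∀ p q r s → (p +ₚ q) +ₚ (r +ₚ s) ≋ (p +ₚ r) +ₚ (q +ₚ s)
+ₚ-interchange p q r s = ≋-intro λ f → begin
  lin ((p +ₚ q) +ₚ (r +ₚ s)) f  ≡⟨ expand p q r s f ⟩
  lin p f ℤ.+ lin q f ℤ.+ (lin r f ℤ.+ lin s f)
    ≡⟨ interchange (lin p f) (lin q f) (lin r f) (lin s f) ⟩
  lin p f ℤ.+ lin r f ℤ.+ (lin q f ℤ.+ lin s f)
    ≡⟨ expand p r q s f ⟨
  lin ((p +ₚ r) +ₚ (q +ₚ s)) f  ∎
  where
  open ≡-Reasoning
  expand : ∀ p q r s f → lin ((p +ₚ q) +ₚ (r +ₚ s)) f ≡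
           lin p f ℤ.+ lin q f ℤ.+ (lin r f ℤ.+ lin s f)
  expand p q r s f =
    trans (lin-+ₚ (p +ₚ q) (r +ₚ s) f) (cong₂ ℤ._+_ (lin-+ₚ p q f) (lin-+ₚ r s f))
  interchange : ∀ i j k l → i ℤ.+ j ℤ.+ (k ℤ.+ l) ≡ i ℤ.+ k ℤ.+ (j ℤ.+ l)
  interchange = solve-∀

𝐞 : Poly
𝐞 = 𝐚 -ₚ 𝐛

-- The value at 0 is junk, chosen so that the term with j = 0 of a sum over all
-- subsets vanishes.
𝐮 : ℕ → Poly
𝐮 zero    = []
𝐮 (suc j) = 𝐞 ^ₚ j *ₚ 𝐛

𝐮₁≋𝐛 : 𝐮 1 ≋ 𝐛
𝐮₁≋𝐛 = *ₚ-identityˡ 𝐛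

^ₚ-suc-comm : ∀ p m → p ^ₚ m *ₚ p ≋ p *ₚ p ^ₚ m
^ₚ-suc-comm p zero    = ≋-trans (*ₚ-identityˡ p) (≋-sym (*ₚ-identityʳ p))
^ₚ-suc-comm p (suc m) =
  ≋-trans (*ₚ-assoc p (p ^ₚ m) p) (*ₚ-congˡ p (^ₚ-suc-comm p m))

^ₚ-+ : ∀ p l m → p ^ₚ (l + m) ≋ p ^ₚ l *ₚ p ^ₚ m
^ₚ-+ p zero    m = ≋-sym (*ₚ-identityˡ (p ^ₚ m))
^ₚ-+ p (suc l) m =
  ≋-trans (*ₚ-congˡ p (^ₚ-+ p l m)) (≋-sym (*ₚ-assoc p (p ^ₚ l) (p ^ₚ m)))

𝐞^-*ₚ-𝐮 : ∀ l m → 𝐞 ^ₚ l *ₚ 𝐮 (suc m) ≋ 𝐮 (suc (l + m))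
𝐞^-*ₚ-𝐮 l m = ≋-trans (≋-sym (*ₚ-assoc (𝐞 ^ₚ l) (𝐞 ^ₚ m) 𝐛))
                      (*ₚ-congʳ 𝐛 (≋-sym (^ₚ-+ 𝐞 l m)))

-- The squares of `𝐛` cancel on the right and leave 𝐛𝐚 - 𝐚𝐛. So `G` acts on `𝐞` as the commutator
-- with `𝐛`, which determines it on all powers of `𝐞`.
G-𝐞 : G 𝐞 ≋ 𝐛 *ₚ 𝐞 -ₚ 𝐞 *ₚ 𝐛
G-𝐞 = ≋-intro λ f → eq (f (b ∷ a ∷ [])) (f (a ∷ b ∷ [])) (f (b ∷ b ∷ []))
  where
  eq : ∀ x y z → 1ℤ ℤ.* x ℤ.+ (-1ℤ ℤ.* y ℤ.+ 0ℤ) ≡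
       1ℤ ℤ.* x ℤ.+ (-1ℤ ℤ.* z ℤ.+ (-1ℤ ℤ.* y ℤ.+ (1ℤ ℤ.* z ℤ.+ 0ℤ)))
  eq = solve-∀

G-𝐛 : G 𝐛 ≋ 𝐞 *ₚ 𝐛 +ₚ 𝐛 *ₚ 𝐛
G-𝐛 = ≋-intro λ f → eq (f (a ∷ b ∷ [])) (f (b ∷ b ∷ []))
  where
  eq : ∀ y z → 1ℤ ℤ.* y ℤ.+ 0ℤ ≡ 1ℤ ℤ.* y ℤ.+ (-1ℤ ℤ.* z ℤ.+ (1ℤ ℤ.* z ℤ.+ 0ℤ))
  eq = solve-∀

-- The commutator with `𝐛` is a derivation too, so its agreement with `G` on `𝐞` passes to powers;
-- `telescope` cancels the mixed term `𝐞 *ₚ (𝐛 *ₚ E)`.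
G-𝐞^ : ∀ m → G (𝐞 ^ₚ m) ≋ 𝐛 *ₚ 𝐞 ^ₚ m -ₚ 𝐞 ^ₚ m *ₚ 𝐛
G-𝐞^ zero    = ≋-intro λ f → eq (f [ b ])
  where
  eq : ∀ x → 0ℤ ≡ 1ℤ ℤ.* x ℤ.+ (-1ℤ ℤ.* x ℤ.+ 0ℤ)
  eq = solve-∀
G-𝐞^ (suc m) = begin
  G (𝐞 *ₚ E)
    ≈⟨ G-*ₚ 𝐞 E ⟩
  G 𝐞 *ₚ E +ₚ 𝐞 *ₚ G E
    ≈⟨ +ₚ-cong (*ₚ-congʳ E G-𝐞) (*ₚ-congˡ 𝐞 (G-𝐞^ m)) ⟩
  (𝐛 *ₚ 𝐞 -ₚ 𝐞 *ₚ 𝐛) *ₚ E +ₚ 𝐞 *ₚ (𝐛 *ₚ E -ₚ E *ₚ 𝐛)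
    ≈⟨ +ₚ-cong (*ₚ-distribʳ-sub E (𝐛 *ₚ 𝐞) (𝐞 *ₚ 𝐛)) (*ₚ-distribˡ-sub 𝐞 (𝐛 *ₚ E) (E *ₚ 𝐛)) ⟩
  (𝐛 *ₚ 𝐞 *ₚ E -ₚ 𝐞 *ₚ 𝐛 *ₚ E) +ₚ (𝐞 *ₚ (𝐛 *ₚ E) -ₚ 𝐞 *ₚ (E *ₚ 𝐛))
    ≈⟨ +ₚ-cong (-ₚ-cong (*ₚ-assoc 𝐛 𝐞 E) (*ₚ-assoc 𝐞 𝐛 E))
               (-ₚ-cong (≋-refl {𝐞 *ₚ (𝐛 *ₚ E)}) (≋-sym (*ₚ-assoc 𝐞 E 𝐛))) ⟩
  (𝐛 *ₚ (𝐞 *ₚ E) -ₚ 𝐞 *ₚ (𝐛 *ₚ E)) +ₚ (𝐞 *ₚ (𝐛 *ₚ E) -ₚ 𝐞 *ₚ E *ₚ 𝐛)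
    ≈⟨ telescope (𝐛 *ₚ (𝐞 *ₚ E)) (𝐞 *ₚ (𝐛 *ₚ E)) (𝐞 *ₚ E *ₚ 𝐛) ⟩
  𝐛 *ₚ (𝐞 *ₚ E) -ₚ 𝐞 *ₚ E *ₚ 𝐛 ∎
  where
  open ≋-Reasoning
  E = 𝐞 ^ₚ m
  telescope : ∀ p q r → (p -ₚ q) +ₚ (q -ₚ r) ≋ p -ₚ r
  telescope p q r = ≋-intro λ f →
    trans (lin-+ₚ (p -ₚ q) (q -ₚ r) f)
    (trans (cong₂ ℤ._+_ (lin-sub p q f) (lin-sub q r f))
    (trans (eq (lin p f) (lin q f) (lin r f)) (sym (lin-sub p r f))))
    where
    eq : ∀ i j k → (i ℤ.- j) ℤ.+ (j ℤ.- k) ≡ i ℤ.- k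
    eq = solve-∀

-- The commutator contributes -𝐞^j 𝐛𝐛, and the summand 𝐛𝐛 of `G 𝐛` contributes the same with a plus
-- sign.
G-𝐮 : ∀ j → G (𝐮 (suc j)) ≋ 𝐮 1 *ₚ 𝐮 (suc j) +ₚ 𝐮 (suc (suc j))
G-𝐮 j = begin
  G (E *ₚ 𝐛)
    ≈⟨ G-*ₚ E 𝐛 ⟩
  G E *ₚ 𝐛 +ₚ E *ₚ G 𝐛
    ≈⟨ +ₚ-cong (*ₚ-congʳ 𝐛 (G-𝐞^ j)) (*ₚ-congˡ E G-𝐛) ⟩
  (𝐛 *ₚ E -ₚ E *ₚ 𝐛) *ₚ 𝐛 +ₚ E *ₚ (𝐞 *ₚ 𝐛 +ₚ 𝐛 *ₚ 𝐛)
    ≈⟨ +ₚ-cong (*ₚ-distribʳ-sub 𝐛 (𝐛 *ₚ E) (E *ₚ 𝐛)) (*ₚ-distribˡ-+ₚ E (𝐞 *ₚ 𝐛) (𝐛 *ₚ 𝐛)) ⟩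
  (𝐛 *ₚ E *ₚ 𝐛 -ₚ E *ₚ 𝐛 *ₚ 𝐛) +ₚ (E *ₚ (𝐞 *ₚ 𝐛) +ₚ E *ₚ (𝐛 *ₚ 𝐛))
    ≈⟨ +ₚ-cong (-ₚ-cong (*ₚ-assoc 𝐛 E 𝐛) (*ₚ-assoc E 𝐛 𝐛))
         (+ₚ-congʳ (E *ₚ (𝐛 *ₚ 𝐛))
           (≋-trans (≋-sym (*ₚ-assoc E 𝐞 𝐛)) (*ₚ-congʳ 𝐛 (^ₚ-suc-comm 𝐞 j)))) ⟩
  (𝐛 *ₚ (E *ₚ 𝐛) -ₚ E *ₚ (𝐛 *ₚ 𝐛)) +ₚ (𝐞 *ₚ E *ₚ 𝐛 +ₚ E *ₚ (𝐛 *ₚ 𝐛))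
    ≈⟨ cancel (𝐛 *ₚ (E *ₚ 𝐛)) (E *ₚ (𝐛 *ₚ 𝐛)) (𝐞 *ₚ E *ₚ 𝐛) ⟩
  𝐛 *ₚ (E *ₚ 𝐛) +ₚ 𝐞 *ₚ E *ₚ 𝐛
    ≈⟨ +ₚ-congʳ (𝐞 *ₚ E *ₚ 𝐛) (*ₚ-congʳ (E *ₚ 𝐛) (≋-sym 𝐮₁≋𝐛)) ⟩
  𝐮 1 *ₚ (E *ₚ 𝐛) +ₚ 𝐞 *ₚ E *ₚ 𝐛 ∎
  where
  open ≋-Reasoning
  E = 𝐞 ^ₚ j
  cancel : ∀ p q r → (p -ₚ q) +ₚ (r +ₚ q) ≋ p +ₚ r
  cancel p q r = ≋-intro λ f →
    trans (lin-+ₚ (p -ₚ q) (r +ₚ q) f)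
    (trans (cong₂ ℤ._+_ (lin-sub p q f) (lin-+ₚ r q f))
    (trans (eq (lin p f) (lin q f) (lin r f)) (sym (lin-+ₚ p r f))))
    where
    eq : ∀ i j k → (i ℤ.- j) ℤ.+ (k ℤ.+ j) ≡ i ℤ.+ k
    eq = solve-∀

-- The defect of `G-𝐮` at 0: with `𝐮 0` equal to `[]` the left side vanishes and the right side is
-- `𝐮 1`. In a sum over all sets it singles out the empty set.
𝐮₁-at-0 : ℕ → Poly
𝐮₁-at-0 zero    = 𝐮 1
𝐮₁-at-0 (suc _) = []

G-𝐮′ : ∀ j → G (𝐮 j) +ₚ 𝐮₁-at-0 j ≋ 𝐮 1 *ₚ 𝐮 j +ₚ 𝐮 (suc j)
G-𝐮′ zero    = +ₚ-congʳ (𝐮 1) (≋-sym (*ₚ-zeroʳ (𝐮 1)))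
G-𝐮′ (suc j) = ≋-trans (≋-intro λ f → trans (lin-+ₚ (G (𝐮 (suc j))) [] f) (ℤ.+-identityʳ _)) (G-𝐮 j)

-- 𝐭 k n is the contribution to the ab-index of the chains through no proper
-- face of the complex, k being the value ζ̄(∅,*).
𝐭 : ℤ → ℕ → Poly
𝐭 k n = 𝐞 ^ₚ n +ₚ k ·ₚ 𝐮 n

lin-𝐭 : ∀ k n f → lin (𝐭 k n) f ≡ lin (𝐞 ^ₚ n) f ℤ.+ k ℤ.* lin (𝐮 n) f
lin-𝐭 k n f = trans (lin-+ₚ (𝐞 ^ₚ n) _ f) (cong (ℤ._+_ (lin (𝐞 ^ₚ n) f)) (lin-·ₚ k (𝐮 n) f))

-- At n = 0 the left side is zero while `k ·ₚ 𝐮 1` stays on the right, so k must vanish there. It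
-- does for semisuspensions: n = 0 leaves only the complex {∅}, and `ζ* 0 1 0` is 0.
G-·ₚ-𝐮 : ∀ k n → (n ≡ 0 → k ≡ 0ℤ) → G (k ·ₚ 𝐮 n) ≋ 𝐮 1 *ₚ (k ·ₚ 𝐮 n) +ₚ k ·ₚ 𝐮 (suc n)
G-·ₚ-𝐮 k zero    k≡0 rewrite k≡0 refl = ≋-intro λ f → refl
G-·ₚ-𝐮 k (suc n) _ = begin
  G (k ·ₚ U)                                    ≈⟨ G-·ₚ k U ⟩
  k ·ₚ G U                                      ≈⟨ ·ₚ-congˡ k (G-𝐮 n) ⟩
  k ·ₚ (𝐮 1 *ₚ U +ₚ 𝐮 (2 + n))                  ≈⟨ ·ₚ-distrib (𝐮 1 *ₚ U) (𝐮 (2 + n)) ⟩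
  k ·ₚ (𝐮 1 *ₚ U) +ₚ k ·ₚ 𝐮 (2 + n)             ≈⟨ +ₚ-congʳ _ (≋-sym (*ₚ-·ₚ-comm k (𝐮 1) U)) ⟩
  𝐮 1 *ₚ (k ·ₚ U) +ₚ k ·ₚ 𝐮 (2 + n)             ∎
  where
  open ≋-Reasoning
  U = 𝐮 (suc n)
  ·ₚ-distrib : ∀ p q → k ·ₚ (p +ₚ q) ≋ k ·ₚ p +ₚ k ·ₚ q
  ·ₚ-distrib p q = ≋-intro λ f →
    trans (lin-·ₚ k (p +ₚ q) f) (trans (cong (k ℤ.*_) (lin-+ₚ p q f))
    (trans (ℤ.*-distribˡ-+ k (lin p f) (lin q f))
    (sym (trans (lin-+ₚ (k ·ₚ p) (k ·ₚ q) f) (cong₂ ℤ._+_ (lin-·ₚ k p f) (lin-·ₚ k q f))))))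

-- `G (𝐞 ^ₚ n)` leaves `𝐮 (suc n)` with a minus sign, so the remainder is (k - 1) times `𝐮 (suc n)`.
-- It is written as a difference of two values of `𝐭` to match `φ₀`; the one with coefficient 1 is
-- that of a full simplex.
G-𝐭 : ∀ k n → (n ≡ 0 → k ≡ 0ℤ) → G (𝐭 k n) ≋ 𝐮 1 *ₚ 𝐭 k n +ₚ (𝐭 k (suc n) -ₚ 𝐭 1ℤ (suc n))
G-𝐭 k n k≡0 = begin
  G (E +ₚ k ·ₚ 𝐮 n)
    ≈⟨ G-+ₚ E (k ·ₚ 𝐮 n) ⟩
  G E +ₚ G (k ·ₚ 𝐮 n)
    ≈⟨ +ₚ-cong (≋-trans (G-𝐞^ n) (-ₚ-cong (*ₚ-congʳ E (≋-sym 𝐮₁≋𝐛)) (≋-refl {𝐮 (suc n)})))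
               (G-·ₚ-𝐮 k n k≡0) ⟩
  (𝐮 1 *ₚ E -ₚ 𝐮 (suc n)) +ₚ (𝐮 1 *ₚ (k ·ₚ 𝐮 n) +ₚ k ·ₚ 𝐮 (suc n))
    ≈⟨ regroup (𝐮 1 *ₚ E) (𝐮 1 *ₚ (k ·ₚ 𝐮 n)) ⟩
  (𝐮 1 *ₚ E +ₚ 𝐮 1 *ₚ (k ·ₚ 𝐮 n)) +ₚ (𝐭 k (suc n) -ₚ 𝐭 1ℤ (suc n))
    ≈⟨ +ₚ-congʳ _ (*ₚ-distribˡ-+ₚ (𝐮 1) E (k ·ₚ 𝐮 n)) ⟨
  𝐮 1 *ₚ 𝐭 k n +ₚ (𝐭 k (suc n) -ₚ 𝐭 1ℤ (suc n)) ∎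
  where
  open ≋-Reasoning
  E = 𝐞 ^ₚ n
  regroup : ∀ p q → (p -ₚ 𝐮 (suc n)) +ₚ (q +ₚ k ·ₚ 𝐮 (suc n)) ≋
                    (p +ₚ q) +ₚ (𝐭 k (suc n) -ₚ 𝐭 1ℤ (suc n))
  regroup p q = ≋-intro λ f →
    trans (lin-+ₚ (p -ₚ 𝐮 (suc n)) _ f)
    (trans (cong₂ ℤ._+_ (lin-sub p (𝐮 (suc n)) f)
             (trans (lin-+ₚ q (k ·ₚ 𝐮 (suc n)) f)
                    (cong (ℤ._+_ (lin q f)) (lin-·ₚ k (𝐮 (suc n)) f))))
    (trans (eq (lin p f) (lin q f) k (lin (𝐮 (suc n)) f) (lin (𝐞 ^ₚ suc n) f))
    (sym (trans (lin-+ₚ (p +ₚ q) _ f)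
    (cong₂ ℤ._+_ (lin-+ₚ p q f)
      (trans (lin-sub (𝐭 k (suc n)) (𝐭 1ℤ (suc n)) f)
             (cong₂ ℤ._-_ (lin-𝐭 k (suc n) f) (lin-𝐭 1ℤ (suc n) f))))))))
    where
    eq : ∀ p q k u e → (p ℤ.- u) ℤ.+ (q ℤ.+ k ℤ.* u) ≡
         (p ℤ.+ q) ℤ.+ ((e ℤ.+ k ℤ.* u) ℤ.- (e ℤ.+ 1ℤ ℤ.* u))
    eq = solve-∀

-- Splittings of a set of p + q vertices

-- (j , p′ , q′) stands for a set of j vertices whose complement has p′ of the
-- first p and q′ of the last q vertices; there is one entry for each set.
splits : ℕ → ℕ → List (ℕ × ℕ × ℕ)

keepˡ keepʳ drop : ℕ × ℕ × ℕ → ℕ × ℕ × ℕ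
keepˡ (j , p , q) = j , suc p , q
keepʳ (j , p , q) = j , p , suc q
drop  (j , p , q) = suc j , p , q

splits zero    zero    = [ 0 , 0 , 0 ]
splits zero    (suc q) = map keepʳ (splits zero q) ++ map drop (splits zero q)
splits (suc p) q       = map keepˡ (splits p q) ++ map drop (splits p q)

splits-elim : (Q : ℕ → ℕ → ℕ × ℕ × ℕ → Set) → Q 0 0 (0 , 0 , 0) →
  (∀ {q t} → Q 0 q t → Q 0 (suc q) (keepʳ t)) → (∀ {q t} → Q 0 q t → Q 0 (suc q) (drop t)) →
  (∀ {p q t} → Q p q t → Q (suc p) q (keepˡ t)) → (∀ {p q t} → Q p q t → Q (suc p) q (drop t)) →
  ∀ p q {t} → t ∈ splits p q → Q p q t
splits-elim Q q0 kr dr kl dl zero    zero    (here refl) = q0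
splits-elim Q q0 kr dr kl dl zero    (suc q) t∈ with ∈-++⁻ (map keepʳ (splits zero q)) t∈
... | inj₁ t∈ˡ with ∈-map⁻ keepʳ t∈ˡ
...   | _ , s∈ , refl = kr (splits-elim Q q0 kr dr kl dl zero q s∈)
splits-elim Q q0 kr dr kl dl zero    (suc q) t∈ | inj₂ t∈ʳ with ∈-map⁻ drop t∈ʳ
...   | _ , s∈ , refl = dr (splits-elim Q q0 kr dr kl dl zero q s∈)
splits-elim Q q0 kr dr kl dl (suc p) q t∈ with ∈-++⁻ (map keepˡ (splits p q)) t∈
... | inj₁ t∈ˡ with ∈-map⁻ keepˡ t∈ˡ
...   | _ , s∈ , refl = kl (splits-elim Q q0 kr dr kl dl p q s∈)
splits-elim Q q0 kr dr kl dl (suc p) q t∈ | inj₂ t∈ʳ with ∈-map⁻ drop t∈ʳ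
...   | _ , s∈ , refl = dl (splits-elim Q q0 kr dr kl dl p q s∈)

splits-size : ∀ p q {j p′ q′} → (j , p′ , q′) ∈ splits p q → j + (p′ + q′) ≡ p + q
splits-size p q = splits-elim (λ p q (j , p′ , q′) → j + (p′ + q′) ≡ p + q) refl
  (λ {q} {(j , p′ , q′)} eq → trans (cong (_+_ j) (ℕ.+-suc p′ q′)) (trans (ℕ.+-suc j _) (cong suc eq)))
  (cong suc)
  (λ {p} {q} {(j , p′ , q′)} eq → trans (ℕ.+-suc j _) (cong suc eq))
  (cong suc) p q

splits-zero : ∀ q {j p′ q′} → (j , p′ , q′) ∈ splits 0 q → p′ ≡ 0
splits-zero q t∈ = splits-elim (λ p q (j , p′ , q′) → p ≡ 0 → p′ ≡ 0)
  (λ _ → refl) (λ z → z) (λ z → z) (λ _ ()) (λ _ ()) 0 q t∈ refl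

∑-splits-sucˡ : ∀ p q f → ∑ (splits (suc p) q) f ≡
                ∑ (splits p q) (f ∘ keepˡ) +ₚ ∑ (splits p q) (f ∘ drop)
∑-splits-sucˡ p q f = trans (∑-++ (map keepˡ (splits p q)) _ f)
  (cong₂ _+ₚ_ (∑-map keepˡ (splits p q) f) (∑-map drop (splits p q) f))

-- `splits` exhausts the first group before it touches the second, so the entries come in another
-- order and only `≋` holds. The lemma serves the complex in which the distinguished vertex belongs
-- to the second group.
∑-splits-sucʳ : ∀ p q f → ∑ (splits p (suc q)) f ≋
                ∑ (splits p q) (f ∘ keepʳ) +ₚ ∑ (splits p q) (f ∘ drop)
∑-splits-sucʳ zero    q f = ≋-reflexive (trans (∑-++ (map keepʳ (splits 0 q)) _ f)
  (cong₂ _+ₚ_ (∑-map keepʳ (splits 0 q) f) (∑-map drop (splits 0 q) f)))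
∑-splits-sucʳ (suc p) q f = begin
  ∑ (splits (suc p) (suc q)) f
    ≡⟨ ∑-splits-sucˡ p (suc q) f ⟩
  ∑ (splits p (suc q)) (f ∘ keepˡ) +ₚ ∑ (splits p (suc q)) (f ∘ drop)
    ≈⟨ +ₚ-cong (∑-splits-sucʳ p q (f ∘ keepˡ)) (∑-splits-sucʳ p q (f ∘ drop)) ⟩
  (S (f ∘ keepˡ ∘ keepʳ) +ₚ S (f ∘ keepˡ ∘ drop)) +ₚ (S (f ∘ drop ∘ keepʳ) +ₚ S (f ∘ drop ∘ drop))
    ≈⟨ +ₚ-interchange (S (f ∘ keepˡ ∘ keepʳ)) (S (f ∘ keepˡ ∘ drop)) (S (f ∘ drop ∘ keepʳ)) _ ⟩
  (S (f ∘ keepʳ ∘ keepˡ) +ₚ S (f ∘ keepʳ ∘ drop)) +ₚ (S (f ∘ drop ∘ keepˡ) +ₚ S (f ∘ drop ∘ drop))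
    ≡⟨ cong₂ _+ₚ_ (∑-splits-sucˡ p q (f ∘ keepʳ)) (∑-splits-sucˡ p q (f ∘ drop)) ⟨
  ∑ (splits (suc p) q) (f ∘ keepʳ) +ₚ ∑ (splits (suc p) q) (f ∘ drop) ∎
  where
  open ≋-Reasoning
  S : (ℕ × ℕ × ℕ → Poly) → Poly
  S = ∑ (splits p q)

+ₚ-identityʳ : ∀ p → p +ₚ [] ≋ p
+ₚ-identityʳ p = ≋-intro λ f → trans (lin-+ₚ p [] f) (ℤ.+-identityʳ _)

∑-splits-∅ : ∀ p q {f} → (∀ j p′ q′ → f (suc j , p′ , q′) ≋ []) → ∑ (splits p q) f ≋ f (0 , p , q)
∑-splits-∅ zero    zero    {f} z = +ₚ-identityʳ (f (0 , 0 , 0))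
∑-splits-∅ zero    (suc q) {f} z = begin
  ∑ (splits zero (suc q)) f
    ≈⟨ ∑-splits-sucʳ zero q f ⟩
  ∑ (splits zero q) (f ∘ keepʳ) +ₚ ∑ (splits zero q) (f ∘ drop)
    ≈⟨ +ₚ-cong (∑-splits-∅ zero q λ j p′ q′ → z j p′ (suc q′)) (∑-zero (splits zero q) λ _ → z _ _ _) ⟩
  f (0 , zero , suc q) +ₚ []
    ≈⟨ +ₚ-identityʳ (f (0 , zero , suc q)) ⟩
  f (0 , zero , suc q) ∎
  where open ≋-Reasoning
∑-splits-∅ (suc p) q {f} z = begin
  ∑ (splits (suc p) q) f
    ≡⟨ ∑-splits-sucˡ p q f ⟩
  ∑ (splits p q) (f ∘ keepˡ) +ₚ ∑ (splits p q) (f ∘ drop)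
    ≈⟨ +ₚ-cong (∑-splits-∅ p q λ j p′ q′ → z j (suc p′) q′) (∑-zero (splits p q) λ _ → z _ _ _) ⟩
  f (0 , suc p , q) +ₚ []
    ≈⟨ +ₚ-identityʳ (f (0 , suc p , q)) ⟩
  f (0 , suc p , q) ∎
  where open ≋-Reasoning

∑-splits-full : ∀ q {f} → (∀ j p′ q′ → f (j , p′ , suc q′) ≋ []) → ∑ (splits 0 q) f ≋ f (q , 0 , 0)
∑-splits-full zero    {f} z = +ₚ-identityʳ (f (0 , 0 , 0))
∑-splits-full (suc q) {f} z = begin
  ∑ (splits 0 (suc q)) f
    ≈⟨ ∑-splits-sucʳ 0 q f ⟩
  ∑ (splits 0 q) (f ∘ keepʳ) +ₚ ∑ (splits 0 q) (f ∘ drop)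
    ≈⟨ +ₚ-cong (∑-zero (splits 0 q) {f ∘ keepʳ} λ _ → z _ _ _) (∑-splits-full q λ j p′ q′ → z (suc j) p′ q′) ⟩
  f (suc q , 0 , 0) ∎
  where open ≋-Reasoning

-- The reduced Euler characteristic of a link

-- A zero in the second place marks a non-face: nothing of the first group is missing. The sign of a
-- face is (-1)^(j-1), with the exponent shifted by 2 to stay natural.
χ-term : ℕ × ℕ × ℕ → ℤ
χ-term (j , zero  , q) = 0ℤ
χ-term (j , suc p , q) = -1ℤ ℤ.^ suc j

χ : ℕ → ℕ → ℤ
χ p q = ∑ℤ (splits p q) χ-term

signs : ℕ → ℕ → ℤ
signs p q = ∑ℤ (splits p q) λ (j , _) → -1ℤ ℤ.^ suc j

i+-1*i≡0 : ∀ i → i ℤ.+ -1ℤ ℤ.* i ≡ 0ℤ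
i+-1*i≡0 = solve-∀

-- Inserting or deleting one fixed vertex pairs off sets of opposite sign.
signs-sucˡ : ∀ p q → signs (suc p) q ≡ 0ℤ
signs-sucˡ p q = begin
  signs (suc p) q
    ≡⟨ ∑ℤ-++ (map keepˡ (splits p q)) _ _ ⟩
  ∑ℤ (map keepˡ (splits p q)) _ ℤ.+ ∑ℤ (map drop (splits p q)) _
    ≡⟨ cong₂ ℤ._+_ (∑ℤ-map keepˡ (splits p q) _)
         (trans (∑ℤ-map drop (splits p q) _) (sym (∑ℤ-distribˡ-* (splits p q) -1ℤ _))) ⟩
  signs p q ℤ.+ -1ℤ ℤ.* signs p q
    ≡⟨ i+-1*i≡0 (signs p q) ⟩
  0ℤ ∎
  where open ≡-Reasoning

signs-sucʳ : ∀ q → signs 0 (suc q) ≡ 0ℤ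
signs-sucʳ q = begin
  signs 0 (suc q)
    ≡⟨ ∑ℤ-++ (map keepʳ (splits 0 q)) _ _ ⟩
  ∑ℤ (map keepʳ (splits 0 q)) _ ℤ.+ ∑ℤ (map drop (splits 0 q)) _
    ≡⟨ cong₂ ℤ._+_ (∑ℤ-map keepʳ (splits 0 q) _)
         (trans (∑ℤ-map drop (splits 0 q) _) (sym (∑ℤ-distribˡ-* (splits 0 q) -1ℤ _))) ⟩
  signs 0 q ℤ.+ -1ℤ ℤ.* signs 0 q
    ≡⟨ i+-1*i≡0 (signs 0 q) ⟩
  0ℤ ∎
  where open ≡-Reasoning

-- A set avoiding the new vertex is always a face. A set containing it is a face exactly if the rest
-- is one, and the vertex flips the sign.
χ-suc : ∀ p q → χ (suc p) q ≡ signs p q ℤ.- χ p q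
χ-suc p q = begin
  χ (suc p) q
    ≡⟨ ∑ℤ-++ (map keepˡ (splits p q)) _ _ ⟩
  ∑ℤ (map keepˡ (splits p q)) _ ℤ.+ ∑ℤ (map drop (splits p q)) _
    ≡⟨ cong₂ ℤ._+_ (∑ℤ-map keepˡ (splits p q) _)
         (trans (∑ℤ-map drop (splits p q) _)
         (trans (∑ℤ-cong (splits p q) χ-term-drop) (sym (∑ℤ-distribˡ-* (splits p q) -1ℤ χ-term)))) ⟩
  signs p q ℤ.+ -1ℤ ℤ.* χ p q
    ≡⟨ cong (ℤ._+_ (signs p q)) (ℤ.-1*i≡-i (χ p q)) ⟩
  signs p q ℤ.- χ p q ∎
  where
  open ≡-Reasoning
  χ-term-drop : ∀ t → χ-term (drop t) ≡ -1ℤ ℤ.* χ-term t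
  χ-term-drop (j , zero  , q) = refl
  χ-term-drop (j , suc p , q) = refl

χ-zero : ∀ q → χ 0 q ≡ 0ℤ
χ-zero q = ∑ℤ-zero (splits 0 q) λ {(j , p′ , q′)} t∈ → vanish (splits-zero q t∈)
  where
  vanish : ∀ {j p′ q′} → p′ ≡ 0 → χ-term (j , p′ , q′) ≡ 0ℤ
  vanish refl = refl

ζ* : ℕ → ℕ → ℕ → ℤ
ζ* n p q = 1ℤ ℤ.+ -1ℤ ℤ.^ n ℤ.* χ p q

-- For p = 1 the faces are all sets of the other q + 1 vertices: a full simplex, with reduced Euler
-- characteristic 0.
ζ*-one : ∀ n q → ζ* n 1 (suc q) ≡ 1ℤ
ζ*-one n q rewrite χ-suc 0 (suc q) | signs-sucʳ q | χ-zero (suc q) =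
  cong (ℤ._+_ 1ℤ) (ℤ.*-zeroʳ (-1ℤ ℤ.^ n))

ζ*-point : ∀ n → ζ* n 1 0 ≡ 1ℤ ℤ.- -1ℤ ℤ.^ n
ζ*-point n = eq (-1ℤ ℤ.^ n)
  where
  eq : ∀ i → 1ℤ ℤ.+ i ℤ.* -1ℤ ≡ 1ℤ ℤ.- i
  eq = solve-∀

-- One more vertex in a nonempty first group negates `χ`, since `signs` vanishes; raising n negates
-- its coefficient. The two changes compensate.
ζ*-suc : ∀ n p q → ζ* (suc n) (suc (suc p)) q ≡ ζ* n (suc p) q
ζ*-suc n p q rewrite χ-suc (suc p) q | signs-sucˡ p q = eq (-1ℤ ℤ.^ n) (χ (suc p) q)
  where
  eq : ∀ i j → 1ℤ ℤ.+ -1ℤ ℤ.* i ℤ.* (0ℤ ℤ.- j) ≡ 1ℤ ℤ.+ i ℤ.* j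
  eq = solve-∀

-- The recursion satisfied by the ab-indices

𝐮-sum : (ℕ → ℕ → ℕ → Poly) → ℕ → ℕ → ℕ → Poly
𝐮-sum F n p q = ∑ (splits p q) λ (j , p′ , q′) → 𝐮 j *ₚ F (n ∸ j) p′ q′

-- `𝐮 0` kills the entries with j = 0, so agreement is needed only on strictly fewer vertices. The
-- comparison of fuels rests on this.
𝐮-sum-cong : ∀ F F′ n p q →
  (∀ {j p′ q′} → (suc j , p′ , q′) ∈ splits p q → F (n ∸ suc j) p′ q′ ≋ F′ (n ∸ suc j) p′ q′) →
  𝐮-sum F n p q ≋ 𝐮-sum F′ n p q
𝐮-sum-cong F F′ n p q eq = ∑-cong-∈ (splits p q) term-cong
  where
  term-cong : ∀ {t} → t ∈ splits p q →
    𝐮 (proj₁ t) *ₚ F (n ∸ proj₁ t) (proj₁ (proj₂ t)) (proj₂ (proj₂ t)) ≋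
    𝐮 (proj₁ t) *ₚ F′ (n ∸ proj₁ t) (proj₁ (proj₂ t)) (proj₂ (proj₂ t))
  term-cong {zero  , _ , _} _  = ≋-refl
  term-cong {suc j , _ , _} t∈ = *ₚ-congˡ (𝐮 (suc j)) (eq t∈)

splits-smaller : ∀ p q {j p′ q′} → (suc j , p′ , q′) ∈ splits p q → p′ + q′ < p + q
splits-smaller p q {j} {p′} {q′} t∈ =
  subst (suc (p′ + q′) ≤_) (splits-size p q t∈) (s≤s (ℕ.m≤n+m (p′ + q′) j))

-- ψ₀ collects the chains ∅ < 1̂ and ∅ < * < 1̂.
ψ₀ : ℕ → ℕ → ℕ → Poly
ψ₀ n zero    q = []
ψ₀ n (suc p) q = 𝐭 (ζ* n (suc p) q) n

-- Fuel replaces well-founded recursion on p + q, since the term with j = 0 formally calls the same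
-- complex again. Fuel p + q suffices; if it is 0 the complex is void and the zero polynomial is the
-- right value.
ψ-fuel : ℕ → ℕ → ℕ → ℕ → Poly
ψ-fuel zero    n p q = []
ψ-fuel (suc N) n p q = ψ₀ n p q +ₚ 𝐮-sum (ψ-fuel N) n p q

-- ψ n p q will be the ab-index of Semi(Δ,n) for the complex Δ on p + q vertices
-- whose faces are the sets missing at least one of the first p vertices.
ψ : ℕ → ℕ → ℕ → Poly
ψ n p q = ψ-fuel (p + q) n p q

-- No set misses a vertex of an empty first group, so all links are void as well. This lets sums
-- over faces be extended to all sets.
ψ-fuel-zero : ∀ N n q → ψ-fuel N n 0 q ≋ []
ψ-fuel-zero zero    n q = ≋-refl
ψ-fuel-zero (suc N) n q = ∑-zero (splits 0 q) λ {(j , p′ , q′)} t∈ → vanish j q′ (splits-zero q t∈)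
  where
  vanish : ∀ {p′} j q′ → p′ ≡ 0 → 𝐮 j *ₚ ψ-fuel N (n ∸ j) p′ q′ ≋ []
  vanish j q′ refl = ≋-trans (*ₚ-congˡ (𝐮 j) (ψ-fuel-zero N (n ∸ j) q′)) (*ₚ-zeroʳ (𝐮 j))

ψ-fuel-irrelevant : ∀ N M n p q → p + q ≤ N → p + q ≤ M → ψ-fuel N n p q ≋ ψ-fuel M n p q
ψ-fuel-irrelevant zero    M       n zero q N≥ M≥ = ≋-sym (ψ-fuel-zero M n q)
ψ-fuel-irrelevant (suc N) zero    n zero q N≥ M≥ = ψ-fuel-zero (suc N) n q
ψ-fuel-irrelevant (suc N) (suc M) n p    q N≥ M≥ = +ₚ-congˡ (ψ₀ n p q)
  (𝐮-sum-cong (ψ-fuel N) (ψ-fuel M) n p q λ {j} {p′} {q′} t∈ → ψ-fuel-irrelevant N M _ p′ q′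
    (ℕ.≤-pred (ℕ.≤-trans (splits-smaller p q t∈) N≥)) (ℕ.≤-pred (ℕ.≤-trans (splits-smaller p q t∈) M≥)))

ψ-zero : ∀ n q → ψ n 0 q ≋ []
ψ-zero n q = ψ-fuel-zero q n q

ψ-rec : ∀ n p q → ψ n p q ≋ ψ₀ n p q +ₚ 𝐮-sum ψ n p q
ψ-rec n p q = ≋-trans
  -- One extra unit of fuel exposes a single unfolding.
  (ψ-fuel-irrelevant (p + q) (suc (p + q)) n p q ℕ.≤-refl (ℕ.n≤1+n _))
  (+ₚ-congˡ (ψ₀ n p q) (𝐮-sum-cong (ψ-fuel (p + q)) ψ n p q λ {j} {p′} {q′} t∈ →
    ψ-fuel-irrelevant (p + q) (p′ + q′) (n ∸ suc j) p′ q′ (ℕ.<⇒≤ (splits-smaller p q t∈)) ℕ.≤-refl))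

-- φ n i (k - i) will be Φ̌(n,k,i).
φ : ℕ → ℕ → ℕ → Poly
φ n p q = ψ n (suc p) q -ₚ ψ n p (suc q)

φ₀ : ℕ → ℕ → ℕ → Poly
φ₀ n p q = ψ₀ n (suc p) q -ₚ ψ₀ n p (suc q)

-- The link of a face containing the distinguished vertex is the same in both
-- complexes, so only faces avoiding that vertex survive in the difference.
φ-rec : ∀ n p q → φ n p q ≋ φ₀ n p q +ₚ 𝐮-sum φ n p q
φ-rec n p q = begin
  ψ n (suc p) q -ₚ ψ n p (suc q)
    ≈⟨ -ₚ-cong (≋-trans (ψ-rec n (suc p) q) (+ₚ-congˡ (ψ₀ n (suc p) q) (≋-reflexive (∑-splits-sucˡ p q _))))
               (≋-trans (ψ-rec n p (suc q)) (+ₚ-congˡ (ψ₀ n p (suc q)) (∑-splits-sucʳ p q _))) ⟩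
  (ψ₀ n (suc p) q +ₚ (S₁ +ₚ S₃)) -ₚ (ψ₀ n p (suc q) +ₚ (S₂ +ₚ S₃))
    ≈⟨ cancel (ψ₀ n (suc p) q) (ψ₀ n p (suc q)) S₁ S₂ S₃ ⟩
  φ₀ n p q +ₚ (S₁ -ₚ S₂)
    ≈⟨ +ₚ-congˡ (φ₀ n p q) (∑-distrib-sub (splits p q) _ _) ⟨
  φ₀ n p q +ₚ ∑ (splits p q) (λ (j , p′ , q′) →
    𝐮 j *ₚ ψ (n ∸ j) (suc p′) q′ -ₚ 𝐮 j *ₚ ψ (n ∸ j) p′ (suc q′))
    ≈⟨ +ₚ-congˡ (φ₀ n p q) (∑-cong (splits p q) λ (j , p′ , q′) →
         *ₚ-distribˡ-sub (𝐮 j) (ψ (n ∸ j) (suc p′) q′) (ψ (n ∸ j) p′ (suc q′))) ⟨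
  φ₀ n p q +ₚ 𝐮-sum φ n p q ∎
  where
  open ≋-Reasoning
  S₁ = ∑ (splits p q) λ (j , p′ , q′) → 𝐮 j *ₚ ψ (n ∸ j) (suc p′) q′
  S₂ = ∑ (splits p q) λ (j , p′ , q′) → 𝐮 j *ₚ ψ (n ∸ j) p′ (suc q′)
  S₃ = ∑ (splits p q) λ (j , p′ , q′) → 𝐮 (suc j) *ₚ ψ (n ∸ suc j) p′ q′
  cancel : ∀ p q s t r → (p +ₚ (s +ₚ r)) -ₚ (q +ₚ (t +ₚ r)) ≋ (p -ₚ q) +ₚ (s -ₚ t)
  cancel p q s t r = ≋-intro λ f →
    trans (lin-sub (p +ₚ (s +ₚ r)) (q +ₚ (t +ₚ r)) f)
    (trans (cong₂ ℤ._-_ (expand p s r f) (expand q t r f))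
    (trans (eq (lin p f) (lin q f) (lin s f) (lin t f) (lin r f))
    (sym (trans (lin-+ₚ (p -ₚ q) (s -ₚ t) f) (cong₂ ℤ._+_ (lin-sub p q f) (lin-sub s t f))))))
    where
    expand : ∀ p s r f → lin (p +ₚ (s +ₚ r)) f ≡ lin p f ℤ.+ (lin s f ℤ.+ lin r f)
    expand p s r f = trans (lin-+ₚ p (s +ₚ r) f) (cong (ℤ._+_ (lin p f)) (lin-+ₚ s r f))
    eq : ∀ i j k l m → (i ℤ.+ (k ℤ.+ m)) ℤ.- (j ℤ.+ (l ℤ.+ m)) ≡ (i ℤ.- j) ℤ.+ (k ℤ.- l)
    eq = solve-∀

-- The derivation applied to the recursion

G-sub : ∀ p q → G (p -ₚ q) ≋ G p -ₚ G q
G-sub p q = ≋-trans (G-+ₚ p (-1ℤ ·ₚ q)) (+ₚ-congˡ (G p) (G-·ₚ -1ℤ q))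

-- For p = 0 the subtracted complex is void, but one more vertex turns it into a full simplex: this
-- is the `𝐭 1ℤ (suc n)` of `G-𝐭`. For p > 0 both complexes produce that summand and it cancels.
G-φ₀ : ∀ n p q → p + q ≤ n → G (φ₀ n p q) ≋ 𝐮 1 *ₚ φ₀ n p q +ₚ φ₀ (suc n) (suc p) q
G-φ₀ n zero q q≤n rewrite ζ*-suc n 0 q | ζ*-one (suc n) q = begin
  G (𝐭 k n -ₚ [])
    ≈⟨ G-cong (-ₚ-identityʳ (𝐭 k n)) ⟩
  G (𝐭 k n)
    ≈⟨ G-𝐭 k n (ζ*≡0 q≤n) ⟩
  𝐮 1 *ₚ 𝐭 k n +ₚ (𝐭 k (suc n) -ₚ 𝐭 1ℤ (suc n))
    ≈⟨ +ₚ-congʳ _ (*ₚ-congˡ (𝐮 1) (-ₚ-identityʳ (𝐭 k n))) ⟨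
  𝐮 1 *ₚ (𝐭 k n -ₚ []) +ₚ (𝐭 k (suc n) -ₚ 𝐭 1ℤ (suc n)) ∎
  where
  open ≋-Reasoning
  k = ζ* n 1 q
  -ₚ-identityʳ : ∀ p → p -ₚ [] ≋ p
  -ₚ-identityʳ = +ₚ-identityʳ
  ζ*≡0 : ∀ {n q} → q ≤ n → n ≡ 0 → ζ* n 1 q ≡ 0ℤ
  ζ*≡0 z≤n refl = refl
G-φ₀ (suc n) (suc p) q p+q≤n
  rewrite ζ*-suc (suc n) (suc p) q | ζ*-suc (suc n) p (suc q) = begin
  G (𝐭 k (suc n) -ₚ 𝐭 l (suc n))
    ≈⟨ G-sub (𝐭 k (suc n)) (𝐭 l (suc n)) ⟩
  G (𝐭 k (suc n)) -ₚ G (𝐭 l (suc n))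
    ≈⟨ -ₚ-cong (G-𝐭 k (suc n) λ ()) (G-𝐭 l (suc n) λ ()) ⟩
  (𝐮 1 *ₚ 𝐭 k (suc n) +ₚ (𝐭 k (2 + n) -ₚ 𝐭 1ℤ (2 + n))) -ₚ
  (𝐮 1 *ₚ 𝐭 l (suc n) +ₚ (𝐭 l (2 + n) -ₚ 𝐭 1ℤ (2 + n)))
    ≈⟨ cancel (𝐮 1 *ₚ 𝐭 k (suc n)) (𝐮 1 *ₚ 𝐭 l (suc n)) (𝐭 k (2 + n)) (𝐭 l (2 + n)) (𝐭 1ℤ (2 + n)) ⟩
  (𝐮 1 *ₚ 𝐭 k (suc n) -ₚ 𝐮 1 *ₚ 𝐭 l (suc n)) +ₚ (𝐭 k (2 + n) -ₚ 𝐭 l (2 + n))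
    ≈⟨ +ₚ-congʳ _ (*ₚ-distribˡ-sub (𝐮 1) (𝐭 k (suc n)) (𝐭 l (suc n))) ⟨
  𝐮 1 *ₚ (𝐭 k (suc n) -ₚ 𝐭 l (suc n)) +ₚ (𝐭 k (2 + n) -ₚ 𝐭 l (2 + n)) ∎
  where
  open ≋-Reasoning
  k = ζ* (suc n) (2 + p) q
  l = ζ* (suc n) (suc p) (suc q)
  cancel : ∀ p q s t r → (p +ₚ (s -ₚ r)) -ₚ (q +ₚ (t -ₚ r)) ≋ (p -ₚ q) +ₚ (s -ₚ t)
  cancel p q s t r = ≋-intro λ f →
    trans (lin-sub (p +ₚ (s -ₚ r)) (q +ₚ (t -ₚ r)) f)
    (trans (cong₂ ℤ._-_ (expand p s r f) (expand q t r f))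
    (trans (eq (lin p f) (lin q f) (lin s f) (lin t f) (lin r f))
    (sym (trans (lin-+ₚ (p -ₚ q) (s -ₚ t) f) (cong₂ ℤ._+_ (lin-sub p q f) (lin-sub s t f))))))
    where
    expand : ∀ p s r f → lin (p +ₚ (s -ₚ r)) f ≡ lin p f ℤ.+ (lin s f ℤ.- lin r f)
    expand p s r f = trans (lin-+ₚ p (s -ₚ r) f) (cong (ℤ._+_ (lin p f)) (lin-sub s r f))
    eq : ∀ i j k l m → (i ℤ.+ (k ℤ.- m)) ℤ.- (j ℤ.+ (l ℤ.- m)) ≡ (i ℤ.- j) ℤ.+ (k ℤ.- l)
    eq = solve-∀

-- This is `G-𝐮′` summed over all sets; the correction at j = 0 survives only for the empty set.
∑-G𝐮 : ∀ n p q → (F : ℕ → ℕ → ℕ → Poly) →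
  ∑ (splits p q) (λ (j , p′ , q′) → G (𝐮 j) *ₚ F (n ∸ j) p′ q′) +ₚ 𝐮 1 *ₚ F n p q ≋
  𝐮 1 *ₚ 𝐮-sum F n p q +ₚ ∑ (splits p q) (λ (j , p′ , q′) → 𝐮 (suc j) *ₚ F (n ∸ j) p′ q′)
∑-G𝐮 n p q F = begin
  ∑ T (λ (j , p′ , q′) → G (𝐮 j) *ₚ F (n ∸ j) p′ q′) +ₚ 𝐮 1 *ₚ F n p q
    ≈⟨ +ₚ-congˡ (∑ T λ (j , p′ , q′) → G (𝐮 j) *ₚ F (n ∸ j) p′ q′)
         (∑-splits-∅ p q {λ (j , p′ , q′) → 𝐮₁-at-0 j *ₚ F (n ∸ j) p′ q′} λ _ _ _ → ≋-refl) ⟨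
  ∑ T (λ (j , p′ , q′) → G (𝐮 j) *ₚ F (n ∸ j) p′ q′) +ₚ
  ∑ T (λ (j , p′ , q′) → 𝐮₁-at-0 j *ₚ F (n ∸ j) p′ q′)
    ≈⟨ ∑-distrib-+ₚ T _ _ ⟨
  ∑ T (λ (j , p′ , q′) → G (𝐮 j) *ₚ F (n ∸ j) p′ q′ +ₚ 𝐮₁-at-0 j *ₚ F (n ∸ j) p′ q′)
    ≈⟨ ∑-cong T step ⟩
  ∑ T (λ (j , p′ , q′) → 𝐮 1 *ₚ (𝐮 j *ₚ F (n ∸ j) p′ q′) +ₚ 𝐮 (suc j) *ₚ F (n ∸ j) p′ q′)
    ≈⟨ ∑-distrib-+ₚ T _ _ ⟩
  ∑ T (λ (j , p′ , q′) → 𝐮 1 *ₚ (𝐮 j *ₚ F (n ∸ j) p′ q′)) +ₚ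
  ∑ T (λ (j , p′ , q′) → 𝐮 (suc j) *ₚ F (n ∸ j) p′ q′)
    ≈⟨ +ₚ-congʳ _ (∑-distribˡ-*ₚ T (𝐮 1) _) ⟨
  𝐮 1 *ₚ 𝐮-sum F n p q +ₚ ∑ T (λ (j , p′ , q′) → 𝐮 (suc j) *ₚ F (n ∸ j) p′ q′) ∎
  where
  open ≋-Reasoning
  T = splits p q
  step : ∀ ((j , p′ , q′) : ℕ × ℕ × ℕ) →
    G (𝐮 j) *ₚ F (n ∸ j) p′ q′ +ₚ 𝐮₁-at-0 j *ₚ F (n ∸ j) p′ q′ ≋
    𝐮 1 *ₚ (𝐮 j *ₚ F (n ∸ j) p′ q′) +ₚ 𝐮 (suc j) *ₚ F (n ∸ j) p′ q′
  step (j , p′ , q′) = begin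
    G (𝐮 j) *ₚ X +ₚ 𝐮₁-at-0 j *ₚ X             ≈⟨ *ₚ-distribʳ-+ₚ X (G (𝐮 j)) (𝐮₁-at-0 j) ⟨
    (G (𝐮 j) +ₚ 𝐮₁-at-0 j) *ₚ X                ≈⟨ *ₚ-congʳ X (G-𝐮′ j) ⟩
    (𝐮 1 *ₚ 𝐮 j +ₚ 𝐮 (suc j)) *ₚ X             ≈⟨ *ₚ-distribʳ-+ₚ X (𝐮 1 *ₚ 𝐮 j) (𝐮 (suc j)) ⟩
    𝐮 1 *ₚ 𝐮 j *ₚ X +ₚ 𝐮 (suc j) *ₚ X          ≈⟨ +ₚ-congʳ _ (*ₚ-assoc (𝐮 1) (𝐮 j) X) ⟩
    𝐮 1 *ₚ (𝐮 j *ₚ X) +ₚ 𝐮 (suc j) *ₚ X        ∎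
    where X = F (n ∸ j) p′ q′

G-φ-fuel : ∀ N n p q → p + q < N → p + q ≤ n → G (φ n p q) ≋ φ (suc n) (suc p) q
G-φ-fuel (suc N) n p q (s≤s p+q≤N) p+q≤n = begin
  G (φ n p q)
    ≈⟨ G-cong (φ-rec n p q) ⟩
  G (φ₀ n p q +ₚ 𝐮-sum φ n p q)
    ≈⟨ G-+ₚ (φ₀ n p q) (𝐮-sum φ n p q) ⟩
  G (φ₀ n p q) +ₚ G (𝐮-sum φ n p q)
    ≈⟨ +ₚ-cong (G-φ₀ n p q p+q≤n) G-sum ⟩
  (𝐮 1 *ₚ φ₀ n p q +ₚ φ₀ (suc n) (suc p) q) +ₚ (M +ₚ K)
    ≈⟨ combine (𝐮 1 *ₚ φ₀ n p q) (φ₀ (suc n) (suc p) q) M K (𝐮 1 *ₚ 𝐮-sum φ n p q) L M-eq ⟩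
  φ₀ (suc n) (suc p) q +ₚ (K +ₚ L)
    ≡⟨ cong (φ₀ (suc n) (suc p) q +ₚ_) (∑-splits-sucˡ p q (λ (j , p′ , q′) → 𝐮 j *ₚ φ (suc n ∸ j) p′ q′)) ⟨
  φ₀ (suc n) (suc p) q +ₚ 𝐮-sum φ (suc n) (suc p) q
    ≈⟨ φ-rec (suc n) (suc p) q ⟨
  φ (suc n) (suc p) q ∎
  where
  open ≋-Reasoning
  T = splits p q
  M = ∑ T λ (j , p′ , q′) → G (𝐮 j) *ₚ φ (n ∸ j) p′ q′
  K = ∑ T λ (j , p′ , q′) → 𝐮 j *ₚ φ (suc n ∸ j) (suc p′) q′
  L = ∑ T λ (j , p′ , q′) → 𝐮 (suc j) *ₚ φ (n ∸ j) p′ q′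

  G-term : ∀ {j p′ q′} → (j , p′ , q′) ∈ T →
           𝐮 j *ₚ G (φ (n ∸ j) p′ q′) ≋ 𝐮 j *ₚ φ (suc n ∸ j) (suc p′) q′
  -- For the empty set this would be the claim under proof; the factor `𝐮 0` removes it.
  G-term {zero}            _  = ≋-refl
  G-term {suc j} {p′} {q′} t∈ = *ₚ-congˡ (𝐮 (suc j)) (begin
    G (φ (n ∸ suc j) p′ q′)               ≈⟨ G-φ-fuel N (n ∸ suc j) p′ q′ smaller bounded ⟩
    φ (suc (n ∸ suc j)) (suc p′) q′       ≡⟨ cong (λ m → φ m (suc p′) q′) (ℕ.+-∸-assoc 1 j<n) ⟨
    φ (n ∸ j) (suc p′) q′                 ∎)
    where
    size = splits-size p q t∈
    smaller : p′ + q′ < N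
    smaller = ℕ.≤-trans (splits-smaller p q t∈) p+q≤N
    j<n : suc j ≤ n
    j<n = ℕ.≤-trans (ℕ.m≤m+n (suc j) (p′ + q′)) (ℕ.≤-trans (ℕ.≤-reflexive size) p+q≤n)
    bounded : p′ + q′ ≤ n ∸ suc j
    bounded = ℕ.m+n≤o⇒m≤o∸n (p′ + q′)
      (ℕ.≤-trans (ℕ.≤-reflexive (trans (ℕ.+-comm (p′ + q′) (suc j)) size)) p+q≤n)

  G-sum : G (𝐮-sum φ n p q) ≋ M +ₚ K
  G-sum = begin
    G (𝐮-sum φ n p q)
      ≈⟨ G-∑ T _ ⟩
    ∑ T (λ (j , p′ , q′) → G (𝐮 j *ₚ φ (n ∸ j) p′ q′))
      ≈⟨ ∑-cong T (λ (j , p′ , q′) → G-*ₚ (𝐮 j) (φ (n ∸ j) p′ q′)) ⟩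
    ∑ T (λ (j , p′ , q′) → G (𝐮 j) *ₚ φ (n ∸ j) p′ q′ +ₚ 𝐮 j *ₚ G (φ (n ∸ j) p′ q′))
      ≈⟨ ∑-distrib-+ₚ T _ _ ⟩
    M +ₚ ∑ T (λ (j , p′ , q′) → 𝐮 j *ₚ G (φ (n ∸ j) p′ q′))
      ≈⟨ +ₚ-congˡ M (∑-cong-∈ T G-term) ⟩
    M +ₚ K ∎

  -- After cancelling the common sum, the terms from `G (𝐮 j)` and the surplus `𝐮 1 *ₚ φ₀ n p q`
  -- together give precisely the sets containing the new vertex.
  M-eq : M +ₚ (𝐮 1 *ₚ φ₀ n p q +ₚ 𝐮 1 *ₚ 𝐮-sum φ n p q) ≋ 𝐮 1 *ₚ 𝐮-sum φ n p q +ₚ L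
  M-eq = begin
    M +ₚ (𝐮 1 *ₚ φ₀ n p q +ₚ 𝐮 1 *ₚ 𝐮-sum φ n p q)
      ≈⟨ +ₚ-congˡ M (*ₚ-distribˡ-+ₚ (𝐮 1) (φ₀ n p q) (𝐮-sum φ n p q)) ⟨
    M +ₚ 𝐮 1 *ₚ (φ₀ n p q +ₚ 𝐮-sum φ n p q)
      ≈⟨ +ₚ-congˡ M (*ₚ-congˡ (𝐮 1) (φ-rec n p q)) ⟨
    M +ₚ 𝐮 1 *ₚ φ n p q
      ≈⟨ ∑-G𝐮 n p q φ ⟩
    𝐮 1 *ₚ 𝐮-sum φ n p q +ₚ L ∎

  combine : ∀ x y m k s l → m +ₚ (x +ₚ s) ≋ s +ₚ l → (x +ₚ y) +ₚ (m +ₚ k) ≋ y +ₚ (k +ₚ l)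
  combine x y m k s l h = ≋-intro λ f → trans (lin-+ₚ (x +ₚ y) (m +ₚ k) f)
    (trans (cong₂ ℤ._+_ (lin-+ₚ x y f) (lin-+ₚ m k f))
    (trans (eq₁ (lin x f) (lin y f) (lin m f) (lin k f) (lin s f))
    (trans (cong (λ z → lin y f ℤ.+ (lin k f ℤ.+ (z ℤ.- lin s f)))
      (trans (sym (trans (lin-+ₚ m (x +ₚ s) f) (cong (ℤ._+_ (lin m f)) (lin-+ₚ x s f))))
      (trans (lin-≡ h f) (lin-+ₚ s l f))))
    (trans (eq₂ (lin y f) (lin k f) (lin s f) (lin l f))
    (sym (trans (lin-+ₚ y (k +ₚ l) f) (cong (ℤ._+_ (lin y f)) (lin-+ₚ k l f))))))))
    where
    eq₁ : ∀ x y m k s → (x ℤ.+ y) ℤ.+ (m ℤ.+ k) ≡ y ℤ.+ (k ℤ.+ ((m ℤ.+ (x ℤ.+ s)) ℤ.- s))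
    eq₁ = solve-∀
    eq₂ : ∀ y k s l → y ℤ.+ (k ℤ.+ ((s ℤ.+ l) ℤ.- s)) ≡ y ℤ.+ (k ℤ.+ l)
    eq₂ = solve-∀

G-φ : ∀ n p q → p + q ≤ n → G (φ n p q) ≋ φ (suc n) (suc p) q
G-φ n p q = G-φ-fuel (suc (p + q)) n p q ℕ.≤-refl

-- The complex is {∅} and the one subtracted is void, so no nonempty face contributes.
φ-point : ∀ n → φ n 0 0 ≋ 𝐭 (1ℤ ℤ.- -1ℤ ℤ.^ n) n
φ-point n = begin
  φ n 0 0                      ≈⟨ φ-rec n 0 0 ⟩
  φ₀ n 0 0 +ₚ []               ≈⟨ +ₚ-identityʳ (φ₀ n 0 0) ⟩
  𝐭 (ζ* n 1 0) n +ₚ []         ≈⟨ +ₚ-identityʳ (𝐭 (ζ* n 1 0) n) ⟩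
  𝐭 (ζ* n 1 0) n               ≡⟨ cong (λ k → 𝐭 k n) (ζ*-point n) ⟩
  𝐭 (1ℤ ℤ.- -1ℤ ℤ.^ n) n       ∎
  where open ≋-Reasoning

φ₀-initial : ∀ n q → φ₀ n 0 (suc q) ≋ 𝐭 1ℤ n
φ₀-initial n q = ≋-trans (+ₚ-identityʳ _) (≋-reflexive (cong (λ k → 𝐭 k n) (ζ*-one n q)))

-- Filtered sums

∑ℤ-filter : ∀ {Q : Pred A 0ℓ} (Q? : Decidable Q) xs {f g : A → ℤ} →
  (∀ x → Q x → f x ≡ g x) → (∀ x → ¬ Q x → g x ≡ 0ℤ) → ∑ℤ (filter Q? xs) f ≡ ∑ℤ xs g
∑ℤ-filter Q? []       on off = refl
∑ℤ-filter Q? (x ∷ xs) {f} {g} on off with Q? x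
... | yes q = cong₂ ℤ._+_ (on x q) (∑ℤ-filter Q? xs on off)
... | no ¬q = trans (∑ℤ-filter Q? xs on off)
  (sym (trans (cong (ℤ._+ ∑ℤ xs g) (off x ¬q)) (ℤ.+-identityˡ (∑ℤ xs g))))

∑-filter : ∀ {Q : Pred A 0ℓ} (Q? : Decidable Q) xs {f g : A → Poly} →
  (∀ x → Q x → f x ≋ g x) → (∀ x → ¬ Q x → g x ≋ []) → ∑ (filter Q? xs) f ≋ ∑ xs g
∑-filter Q? []       on off = ≋-refl
∑-filter Q? (x ∷ xs) {f} {g} on off with Q? x
... | yes q = +ₚ-cong (on x q) (∑-filter Q? xs on off)
... | no ¬q = ≋-trans (∑-filter Q? xs on off) (+ₚ-congʳ (∑ xs g) (≋-sym (off x ¬q)))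

-- `χ̃-link` selects the faces before the supersets; counting by `splits` needs the opposite order.
filter-comm : ∀ {Q R : Pred A 0ℓ} (Q? : Decidable Q) (R? : Decidable R) xs →
  filter Q? (filter R? xs) ≡ filter R? (filter Q? xs)
filter-comm Q? R? []       = refl
filter-comm Q? R? (x ∷ xs) with does (R? x) in r | does (Q? x) in q
... | true  | true  rewrite q | r = cong (x ∷_) (filter-comm Q? R? xs)
... | true  | false rewrite q     = filter-comm Q? R? xs
... | false | true  rewrite r     = filter-comm Q? R? xs
... | false | false               = filter-comm Q? R? xs

-- Sums over chains

module ChainSum (P : BoundedQuasiGradedPoset) where
  open BoundedQuasiGradedPoset P

  -- `Ψ` is by definition the case of `0̂` with N = ρ⟨ 0̂ , 1̂ ⟩. The lower end varies so that
  -- chains can be sorted by their first interior element.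
  chainSum : ℕ → Carrier → Poly
  chainSum N x = ∑ (concatMap (λ k → chains k x) (upTo N)) (weight x)

  ∑-chains-suc : ∀ k x → ∑ (chains (suc k) x) (weight x) ≋
    ∑ (filter (x ⊏?_) elements) λ y → step x y *ₚ 𝐛 *ₚ ∑ (chains k y) (weight y)
  ∑-chains-suc k x = begin
    ∑ (concatMap (λ y → map (y ∷_) (chains k y)) above) (weight x)
      ≡⟨ ∑-concatMap (λ y → map (y ∷_) (chains k y)) above (weight x) ⟩
    ∑ above (λ y → ∑ (map (y ∷_) (chains k y)) (weight x))
      ≈⟨ ∑-cong above (λ y → ≋-reflexive (∑-map (y ∷_) (chains k y) (weight x))) ⟩
    ∑ above (λ y → ∑ (chains k y) λ ys → step x y *ₚ 𝐛 *ₚ weight y ys)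
      ≈⟨ ∑-cong above (λ y → ∑-distribˡ-*ₚ (chains k y) (step x y *ₚ 𝐛) (weight y)) ⟨
    ∑ above (λ y → step x y *ₚ 𝐛 *ₚ ∑ (chains k y) (weight y)) ∎
    where
    open ≋-Reasoning
    above = filter (x ⊏?_) elements

  chainSum-suc : ∀ N x → chainSum (suc N) x ≋ ∑ (chains 0 x) (weight x) +ₚ
    ∑ (filter (x ⊏?_) elements) λ y → step x y *ₚ 𝐛 *ₚ chainSum N y
  chainSum-suc N x = begin
    ∑ (chains 0 x ++ concatMap (λ k → chains k x) (applyUpTo suc N)) (weight x)
      ≡⟨ ∑-++ (chains 0 x) _ (weight x) ⟩
    C₀ +ₚ ∑ (concatMap (λ k → chains k x) (applyUpTo suc N)) (weight x)
      ≡⟨ cong (C₀ +ₚ_) (∑-concatMap (λ k → chains k x) (applyUpTo suc N) (weight x)) ⟩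
    C₀ +ₚ ∑ (applyUpTo suc N) (λ k → ∑ (chains k x) (weight x))
      ≡⟨ cong (λ ks → C₀ +ₚ ∑ ks (λ k → ∑ (chains k x) (weight x))) (List.map-applyUpTo id suc N) ⟨
    C₀ +ₚ ∑ (map suc (upTo N)) (λ k → ∑ (chains k x) (weight x))
      ≡⟨ cong (C₀ +ₚ_) (∑-map suc (upTo N) (λ k → ∑ (chains k x) (weight x))) ⟩
    C₀ +ₚ ∑ (upTo N) (λ k → ∑ (chains (suc k) x) (weight x))
      ≈⟨ +ₚ-congˡ C₀ (∑-cong (upTo N) λ k → ∑-chains-suc k x) ⟩
    C₀ +ₚ ∑ (upTo N) (λ k → ∑ above λ y → step x y *ₚ 𝐛 *ₚ ∑ (chains k y) (weight y))
      ≈⟨ +ₚ-congˡ C₀ (∑-swap (upTo N) above λ k y → step x y *ₚ 𝐛 *ₚ ∑ (chains k y) (weight y)) ⟩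
    C₀ +ₚ ∑ above (λ y → ∑ (upTo N) λ k → step x y *ₚ 𝐛 *ₚ ∑ (chains k y) (weight y))
      ≈⟨ +ₚ-congˡ C₀ (∑-cong above λ y → ≋-trans
           (*ₚ-congˡ (step x y *ₚ 𝐛) (≋-reflexive (∑-concatMap (λ k → chains k y) (upTo N) (weight y))))
           (∑-distribˡ-*ₚ (upTo N) (step x y *ₚ 𝐛) λ k → ∑ (chains k y) (weight y))) ⟨
    C₀ +ₚ ∑ above (λ y → step x y *ₚ 𝐛 *ₚ chainSum N y) ∎
    where
    open ≋-Reasoning
    above = filter (x ⊏?_) elements
    C₀ = ∑ (chains 0 x) (weight x)

  ∑-chains-0 : ∀ {x} → x ⊏ 1̂ → ∑ (chains 0 x) (weight x) ≋ step x 1̂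
  ∑-chains-0 {x} x⊏1̂ with x ⊏? 1̂
  ... | yes _   = +ₚ-identityʳ (step x 1̂)
  ... | no x⊏̸1̂ = ⊥-elim (x⊏̸1̂ x⊏1̂)

  1̂⊏̸ : ∀ {y} → ¬ 1̂ ⊏ y
  1̂⊏̸ {y} (1̂⊑y , 1̂≢y) = 1̂≢y (IsPartialOrder.antisym isPartialOrder 1̂⊑y (maximum y))

  -- `chains` also tries `1̂` as an interior element; nothing lies above it, so such attempts
  -- contribute nothing.
  chainSum-1̂ : ∀ N → chainSum N 1̂ ≋ []
  chainSum-1̂ zero    = ≋-refl
  chainSum-1̂ (suc N) = ≋-trans (chainSum-suc N 1̂) (+ₚ-cong none₀
    (≋-trans (∑-filter (1̂ ⊏?_) elements {g = λ _ → []} (λ y 1̂⊏y → ⊥-elim (1̂⊏̸ 1̂⊏y)) λ _ _ → ≋-refl)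
             (∑-zero elements λ _ → ≋-refl)))
    where
    none₀ : ∑ (chains 0 1̂) (weight 1̂) ≋ []
    none₀ with 1̂ ⊏? 1̂
    ... | yes 1̂⊏1̂ = ⊥-elim (1̂⊏̸ 1̂⊏1̂)
    ... | no _     = ≋-refl

  *ₚ-chainSum-1̂ : ∀ p N → p *ₚ chainSum N 1̂ ≋ []
  *ₚ-chainSum-1̂ p N = ≋-trans (*ₚ-congˡ p (chainSum-1̂ N)) (*ₚ-zeroʳ p)

  -- Strict growth of the rank makes the truncated exponent in `step` a true predecessor, as in `𝐮`.
  step-*ₚ-𝐛 : ∀ {x y} → x ⊏ y → step x y *ₚ 𝐛 ≋ ζ̄ x y ·ₚ 𝐮 ρ⟨ x , y ⟩
  step-*ₚ-𝐛 {x} {y} x⊏y with ρ⟨ x , y ⟩ | ℕ.m<n⇒0<n∸m (ρ-mono x⊏y)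
  ... | suc r | _ = ·ₚ-*ₚ-assoc (ζ̄ x y) (𝐞 ^ₚ r) 𝐛

·ₚ-identityˡ : ∀ p → 1ℤ ·ₚ p ≋ p
·ₚ-identityˡ p = ≋-intro λ f → trans (lin-·ₚ 1ℤ p f) (ℤ.*-identityˡ (lin p f))

-- Supersets of a given set

missˡ missʳ : ∀ {v} → ℕ → Subset v → ℕ
missˡ zero    F             = 0
missˡ (suc m) []            = 0
missˡ (suc m) (outside ∷ F) = suc (missˡ m F)
missˡ (suc m) (inside  ∷ F) = missˡ m F

missʳ m       []            = 0
missʳ zero    (outside ∷ F) = suc (missʳ zero F)
missʳ zero    (inside  ∷ F) = missʳ zero F
missʳ (suc m) (_ ∷ F)       = missʳ m F

split : ∀ {v} → ℕ → Subset v → Subset v → ℕ × ℕ × ℕ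
split m F H = ∣ H ∣ ∸ ∣ F ∣ , missˡ m H , missʳ m H

filter-outside⊆ : ∀ {v} (F : Subset v) y Hs →
  filter ((outside ∷ F) ⊆?_) (map (y ∷_) Hs) ≡ map (y ∷_) (filter (F ⊆?_) Hs)
filter-outside⊆ F y []       = refl
filter-outside⊆ F y (H ∷ Hs) with does (F ⊆? H)
... | true  = cong ((y ∷ H) ∷_) (filter-outside⊆ F y Hs)
... | false = filter-outside⊆ F y Hs

filter-inside⊆inside : ∀ {v} (F : Subset v) Hs →
  filter ((inside ∷ F) ⊆?_) (map (inside ∷_) Hs) ≡ map (inside ∷_) (filter (F ⊆?_) Hs)
filter-inside⊆inside F []       = refl
filter-inside⊆inside F (H ∷ Hs) with does (F ⊆? H)
... | true  = cong ((inside ∷ H) ∷_) (filter-inside⊆inside F Hs)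
... | false = filter-inside⊆inside F Hs

filter-inside⊆outside : ∀ {v} (F : Subset v) Hs →
  filter ((inside ∷ F) ⊆?_) (map (outside ∷_) Hs) ≡ []
filter-inside⊆outside F []       = refl
filter-inside⊆outside F (H ∷ Hs) = filter-inside⊆outside F Hs

supersets : ∀ {v} → Subset v → List (Subset v)
supersets {v} F = filter (F ⊆?_) (subsets v)

supersets-outside : ∀ {v} (F : Subset v) →
  supersets (outside ∷ F) ≡ map (outside ∷_) (supersets F) ++ map (inside ∷_) (supersets F)
supersets-outside {v} F = trans
  (List.filter-++ ((outside ∷ F) ⊆?_) (map (outside ∷_) (subsets v)) (map (inside ∷_) (subsets v)))
  (cong₂ _++_ (filter-outside⊆ F outside (subsets v)) (filter-outside⊆ F inside (subsets v)))

supersets-inside : ∀ {v} (F : Subset v) → supersets (inside ∷ F) ≡ map (inside ∷_) (supersets F)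
supersets-inside {v} F = trans
  (List.filter-++ ((inside ∷ F) ⊆?_) (map (outside ∷_) (subsets v)) (map (inside ∷_) (subsets v)))
  (cong₂ _++_ (filter-inside⊆outside F (subsets v)) (filter-inside⊆inside F (subsets v)))

-- The lists agree even in order, because `splits` is built like `subsets`: first the sets omitting
-- a vertex, then those containing it. Vertices of `F` offer no choice and are skipped.
split-supersets : ∀ {v} m (F : Subset v) →
  map (split m F) (supersets F) ≡ splits (missˡ m F) (missʳ m F)
split-supersets-outside : ∀ {v} m m′ (F : Subset v) (keep : ℕ × ℕ × ℕ → ℕ × ℕ × ℕ) →
  (∀ H → split m′ (outside ∷ F) (outside ∷ H) ≡ keep (split m F H)) →
  (∀ H → missˡ m′ (inside ∷ H) ≡ missˡ m H) → (∀ H → missʳ m′ (inside ∷ H) ≡ missʳ m H) →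
  map (split m′ (outside ∷ F)) (supersets (outside ∷ F)) ≡
  map keep (splits (missˡ m F) (missʳ m F)) ++ map drop (splits (missˡ m F) (missʳ m F))

split-supersets zero    []            = refl
split-supersets (suc m) []            = refl
split-supersets zero    (outside ∷ F) =
  split-supersets-outside zero zero F keepʳ (λ _ → refl) (λ _ → refl) (λ _ → refl)
split-supersets (suc m) (outside ∷ F) =
  split-supersets-outside m (suc m) F keepˡ (λ _ → refl) (λ _ → refl) (λ _ → refl)
split-supersets zero    (inside ∷ F)  =
  trans (cong (map _) (supersets-inside F))
  (trans (sym (List.map-∘ (supersets F))) (split-supersets zero F))
split-supersets (suc m) (inside ∷ F)  =
  trans (cong (map _) (supersets-inside F))
  (trans (sym (List.map-∘ (supersets F))) (split-supersets m F))

split-supersets-outside m m′ F keep keep≡ missˡ≡ missʳ≡ = begin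
  map (split m′ (outside ∷ F)) (supersets (outside ∷ F))
    ≡⟨ cong (map _) (supersets-outside F) ⟩
  map (split m′ (outside ∷ F)) (map (outside ∷_) (supersets F) ++ map (inside ∷_) (supersets F))
    ≡⟨ List.map-++ _ (map (outside ∷_) (supersets F)) _ ⟩
  map (split m′ (outside ∷ F)) (map (outside ∷_) (supersets F)) ++
  map (split m′ (outside ∷ F)) (map (inside ∷_) (supersets F))
    ≡⟨ cong₂ _++_
         (trans (sym (List.map-∘ (supersets F)))
         (trans (List.map-cong keep≡ (supersets F))
                (List.map-∘ (supersets F))))
         (trans (sym (List.map-∘ (supersets F)))
         (trans (List.map-cong-local (All.map drop≡ (All.all-filter (F ⊆?_) (subsets _))))
                (List.map-∘ (supersets F)))) ⟩
  map keep (map (split m F) (supersets F)) ++ map drop (map (split m F) (supersets F))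
    ≡⟨ cong (λ S → map keep S ++ map drop S) (split-supersets m F) ⟩
  map keep (splits (missˡ m F) (missʳ m F)) ++ map drop (splits (missˡ m F) (missʳ m F)) ∎
  where
  open ≡-Reasoning
  -- The successor leaves the truncated difference only if `F` is no larger than `H`, hence the
  -- restriction to supersets.
  drop≡ : ∀ {H} → F ⊆ H → split m′ (outside ∷ F) (inside ∷ H) ≡ drop (split m F H)
  drop≡ {H} F⊆H = cong₂ _,_ (ℕ.+-∸-assoc 1 (p⊆q⇒∣p∣≤∣q∣ F⊆H)) (cong₂ _,_ (missˡ≡ H) (missʳ≡ H))

∑-supersets : ∀ {v} m (F : Subset v) f →
  ∑ (supersets F) (f ∘ split m F) ≡ ∑ (splits (missˡ m F) (missʳ m F)) f
∑-supersets m F f = trans (sym (∑-map (split m F) (supersets F) f))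
  (cong (λ S → ∑ S f) (split-supersets m F))

∑ℤ-supersets : ∀ {v} m (F : Subset v) f →
  ∑ℤ (supersets F) (f ∘ split m F) ≡ ∑ℤ (splits (missˡ m F) (missʳ m F)) f
∑ℤ-supersets m F f = trans (sym (∑ℤ-map (split m F) (supersets F) f))
  (cong (λ S → ∑ℤ S f) (split-supersets m F))

when : Dec A → Poly → Poly
when d p = if does d then p else []

∑-when : ∀ {Q : Pred A 0ℓ} (Q? : Decidable Q) xs f → ∑ xs (λ x → when (Q? x) (f x)) ≡ ∑ (filter Q? xs) f
∑-when Q? []       f = refl
∑-when Q? (x ∷ xs) f with does (Q? x)
... | true  = cong (f x ++_) (∑-when Q? xs f)
... | false = ∑-when Q? xs f

when-yes : ∀ (d : Dec A) p → A → when d p ≋ p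
when-yes (yes _) p _ = ≋-refl
when-yes (no ¬x) p x = ⊥-elim (¬x x)

when-no : ∀ (d : Dec A) p → ¬ A → when d p ≋ []
when-no (yes x) p ¬x = ⊥-elim (¬x x)
when-no (no _)  p _  = ≋-refl

-- The ab-index of a semisuspension

ψ₀-pos : ∀ n {p} q → 0 < p → ψ₀ n p q ≡ 𝐭 (ζ* n p q) n
ψ₀-pos n {suc p} q _ = refl

module _ {v} (Δ : SimplicialComplex v) (n m : ℕ)
  (dimΔ : SimplicialComplex.dim<_ Δ n)
  (face⇒miss : ∀ {F} → SimplicialComplex.Face Δ F → 0 < missˡ m F)
  (miss⇒face : ∀ {F} → 0 < missˡ m F → SimplicialComplex.Face Δ F) where

  open SimplicialComplex Δ
  open Semisuspension Δ n
  private
    module P = BoundedQuasiGradedPoset (𝓕Semi Δ n dimΔ)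
  open ChainSum (𝓕Semi Δ n dimΔ)

  nonface-miss : ∀ {F} → ¬ Face F → missˡ m F ≡ 0
  nonface-miss {F} ¬f = ℕ.n≤0⇒n≡0 (ℕ.≮⇒≥ (¬f ∘ miss⇒face))

  χ̃-link≡χ : ∀ F → χ̃-link F ≡ χ (missˡ m F) (missʳ m F)
  χ̃-link≡χ F = begin
    ∑ℤ (filter (F ⊆?_) (filter face? (subsets v))) sign
      ≡⟨ cong (λ Hs → ∑ℤ Hs sign) (filter-comm (F ⊆?_) face? (subsets v)) ⟩
    ∑ℤ (filter face? (supersets F)) sign
      ≡⟨ ∑ℤ-filter face? (supersets F) {g = χ-term ∘ split m F} on off ⟩
    ∑ℤ (supersets F) (χ-term ∘ split m F)
      ≡⟨ ∑ℤ-supersets m F χ-term ⟩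
    χ (missˡ m F) (missʳ m F) ∎
    where
    open ≡-Reasoning
    sign : Subset v → ℤ
    sign H = -1ℤ ℤ.^ suc (∣ H ∣ ∸ ∣ F ∣)
    on : ∀ H → Face H → sign H ≡ χ-term (split m F H)
    on H h with missˡ m H | face⇒miss h
    ... | suc _ | _ = refl
    off : ∀ H → ¬ Face H → χ-term (split m F H) ≡ 0ℤ
    off H ¬h rewrite nonface-miss ¬h = refl

  chainSum-star : ∀ N .(n≢0 : NonZero n) → chainSum (suc N) (star n≢0) ≋ 1ₚ
  chainSum-star N n≢0 = begin
    chainSum (suc N) (star n≢0)
      ≈⟨ chainSum-suc N (star n≢0) ⟩
    ∑ (P.chains 0 (star n≢0)) (P.weight (star n≢0)) +ₚ
    ∑ (filter (star n≢0 P.⊏?_) semiElements) (λ y → P.step (star n≢0) y *ₚ 𝐛 *ₚ chainSum N y)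
      ≈⟨ +ₚ-cong (∑-chains-0 {star n≢0} (≤top , λ ()))
           (≋-trans (∑-filter (star n≢0 P.⊏?_) semiElements {g = λ _ → []} above (λ _ _ → ≋-refl))
                    (∑-zero semiElements λ _ → ≋-refl)) ⟩
    P.step (star n≢0) top +ₚ []
      ≈⟨ +ₚ-identityʳ (P.step (star n≢0) top) ⟩
    1ℤ ·ₚ 𝐞 ^ₚ (suc n ∸ n ∸ 1)
      ≈⟨ ·ₚ-identityˡ _ ⟩
    𝐞 ^ₚ (suc n ∸ n ∸ 1)
      ≡⟨ cong (λ r → 𝐞 ^ₚ (r ∸ 1)) (ℕ.m+n∸n≡m 1 n) ⟩
    1ₚ ∎
    where
    open ≋-Reasoning
    above : ∀ y → star n≢0 P.⊏ y → P.step (star n≢0) y *ₚ 𝐛 *ₚ chainSum N y ≋ []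
    above (star _) (_ , ≢) = ⊥-elim (≢ refl)
    above top      _       = *ₚ-chainSum-1̂ (P.step (star n≢0) top *ₚ 𝐛) N

  -- The bound says that N is at least the rank of the interval above `F`, so no chain is cut off. A
  -- chain without interior gives `𝐞 ^ₚ r`, one starting with `*` the other summand of `𝐭`, and one
  -- starting with a face the recursion on links.
  chainSum-face : ∀ N {F} .(f : Face F) → suc n ≤ N + ∣ F ∣ →
    chainSum N (face F f) ≋ ψ (n ∸ ∣ F ∣) (missˡ m F) (missʳ m F)
  chainSum-face zero    {F} f n<∣F∣ = ⊥-elim (ℕ.<⇒≱ n<∣F∣ (dimΔ (recompute (face? F) f)))
  chainSum-face (suc N) {F} f n<N+∣F∣ = begin
    chainSum (suc N) x
      ≈⟨ chainSum-suc N x ⟩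
    ∑ (P.chains 0 x) (P.weight x) +ₚ
    ∑ (filter (x P.⊏?_) semiElements) (λ y → P.step x y *ₚ 𝐛 *ₚ chainSum N y)
      ≈⟨ +ₚ-cong (≋-trans (∑-chains-0 {x} (≤top , λ ())) step-top)
                 (∑-filter (x P.⊏?_) semiElements {g = term} above not-above) ⟩
    𝐞 ^ₚ r +ₚ ∑ semiElements term
      ≈⟨ +ₚ-congˡ (𝐞 ^ₚ r) ∑-term ⟩
    𝐞 ^ₚ r +ₚ (𝐮-sum ψ r p q +ₚ ζ* r p q ·ₚ 𝐮 r)
      ≈⟨ +ₚ-congˡ (𝐞 ^ₚ r) (+ₚ-comm (𝐮-sum ψ r p q) (ζ* r p q ·ₚ 𝐮 r)) ⟩
    𝐞 ^ₚ r +ₚ (ζ* r p q ·ₚ 𝐮 r +ₚ 𝐮-sum ψ r p q)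
      ≡⟨ List.++-assoc (𝐞 ^ₚ r) _ _ ⟨
    𝐭 (ζ* r p q) r +ₚ 𝐮-sum ψ r p q
      ≡⟨ cong (_+ₚ 𝐮-sum ψ r p q) (ψ₀-pos r q (face⇒miss (recompute (face? F) f))) ⟨
    ψ₀ r p q +ₚ 𝐮-sum ψ r p q
      ≈⟨ ψ-rec r p q ⟨
    ψ r p q ∎
    where
    open ≋-Reasoning
    x = face F f
    r = n ∸ ∣ F ∣
    p = missˡ m F
    q = missʳ m F

    step-top : P.step x top ≋ 𝐞 ^ₚ r
    step-top = ≋-trans (·ₚ-identityˡ _) (≋-reflexive (cong (𝐞 ^ₚ_)
      (trans (ℕ.∸-+-assoc (suc n) ∣ F ∣ 1) (cong (suc n ∸_) (ℕ.+-comm ∣ F ∣ 1)))))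

    split-term : ℕ × ℕ × ℕ → Poly
    split-term (j , p′ , q′) = 𝐮 j *ₚ ψ (r ∸ j) p′ q′

    term : SemiElement → Poly
    term (face H _) = when (F ⊆? H) (split-term (split m F H))
    term (star _)   = ζ* r p q ·ₚ 𝐮 r
    term top        = []

    ζ≡ζ* : 1ℤ ℤ.+ -1ℤ ℤ.^ r ℤ.* χ̃-link F ≡ ζ* r p q
    ζ≡ζ* = cong (λ i → 1ℤ ℤ.+ -1ℤ ℤ.^ r ℤ.* i) (χ̃-link≡χ F)

    above : ∀ y → x P.⊏ y → P.step x y *ₚ 𝐛 *ₚ chainSum N y ≋ term y
    above (face H h) x⊏y@(face≤face F⊆H , _) = begin
      P.step x (face H h) *ₚ 𝐛 *ₚ chainSum N (face H h)
        ≈⟨ *ₚ-cong (≋-trans (step-*ₚ-𝐛 x⊏y) (·ₚ-identityˡ _)) (chainSum-face N h bound) ⟩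
      𝐮 (∣ H ∣ ∸ ∣ F ∣) *ₚ ψ (n ∸ ∣ H ∣) (missˡ m H) (missʳ m H)
        ≡⟨ cong (λ s → 𝐮 (∣ H ∣ ∸ ∣ F ∣) *ₚ ψ s (missˡ m H) (missʳ m H)) corank ⟩
      split-term (split m F H)
        ≈⟨ when-yes (F ⊆? H) (split-term (split m F H)) F⊆H ⟨
      when (F ⊆? H) (split-term (split m F H)) ∎
      where
      corank : n ∸ ∣ H ∣ ≡ r ∸ (∣ H ∣ ∸ ∣ F ∣)
      corank = sym (trans (ℕ.∸-+-assoc n ∣ F ∣ _) (cong (n ∸_) (ℕ.m+[n∸m]≡n (p⊆q⇒∣p∣≤∣q∣ F⊆H))))
      bound : suc n ≤ N + ∣ H ∣
      bound = ℕ.≤-trans n<N+∣F∣ (ℕ.≤-trans (ℕ.≤-reflexive (sym (ℕ.+-suc N ∣ F ∣)))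
        (ℕ.+-monoʳ-≤ N (P.ρ-mono x⊏y)))
    above (star n≢0) x⊏y@(face≤star ∣F∣<n , _) = begin
      P.step x (star n≢0) *ₚ 𝐛 *ₚ chainSum N (star n≢0)
        ≈⟨ *ₚ-cong (step-*ₚ-𝐛 x⊏y) (star-1 N N+∣F∣≥n) ⟩
      (P.ζ̄ x (star n≢0) ·ₚ 𝐮 r) *ₚ 1ₚ
        ≈⟨ *ₚ-identityʳ _ ⟩
      P.ζ̄ x (star n≢0) ·ₚ 𝐮 r
        ≡⟨ cong (_·ₚ 𝐮 r) ζ≡ζ* ⟩
      ζ* r p q ·ₚ 𝐮 r ∎
      where
      N+∣F∣≥n : n ≤ N + ∣ F ∣
      N+∣F∣≥n = ℕ.≤-pred n<N+∣F∣
      star-1 : ∀ N → n ≤ N + ∣ F ∣ → chainSum N (star n≢0) ≋ 1ₚ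
      star-1 zero    n≤∣F∣ = ⊥-elim (ℕ.<⇒≱ ∣F∣<n n≤∣F∣)
      star-1 (suc N) _     = chainSum-star N n≢0
    above top _ = *ₚ-chainSum-1̂ (P.step x top *ₚ 𝐛) N

    not-above : ∀ y → ¬ x P.⊏ y → term y ≋ []
    not-above (face H h) x⊏̸y with F ≟ˢ H
    ... | yes refl = vanish
      where
      vanish : when (F ⊆? F) (split-term (split m F F)) ≋ []
      vanish with does (F ⊆? F)
      ... | false = ≋-refl
      ... | true rewrite ℕ.n∸n≡0 ∣ F ∣ = ≋-refl
    ... | no F≢H = when-no (F ⊆? H) _ λ F⊆H → x⊏̸y (face≤face F⊆H , F≢H ∘ face-injective)
    -- Here ∣F∣ ≥ n, so r = 0 and the star's term carries the factor `𝐮 0`.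
    not-above (star n≢0) x⊏̸y
      rewrite ℕ.m≤n⇒m∸n≡0 (ℕ.≮⇒≥ {∣ F ∣} {n} λ ∣F∣<n → x⊏̸y (face≤star ∣F∣<n , λ ())) = ≋-refl
    not-above top _ = ≋-refl

    -- Non-faces can be added freely, their `ψ` being that of a void complex.
    ∑-faces : ∀ Hs → ∑ (faceElements Hs) term ≋ ∑ Hs (λ H → when (F ⊆? H) (split-term (split m F H)))
    ∑-faces []       = ≋-refl
    ∑-faces (H ∷ Hs) with face? H
    ... | yes _ = +ₚ-congˡ (when (F ⊆? H) (split-term (split m F H))) (∑-faces Hs)
    ... | no ¬h = ≋-trans (∑-faces Hs) (+ₚ-congʳ _ (≋-sym vanish))
      where
      vanish : when (F ⊆? H) (split-term (split m F H)) ≋ []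
      vanish with does (F ⊆? H)
      ... | false = ≋-refl
      ... | true rewrite nonface-miss ¬h =
        ≋-trans (*ₚ-congˡ (𝐮 (∣ H ∣ ∸ ∣ F ∣)) (ψ-zero _ (missʳ m H))) (*ₚ-zeroʳ (𝐮 (∣ H ∣ ∸ ∣ F ∣)))

    ∑-stars : ∑ starElements term ≋ ζ* r p q ·ₚ 𝐮 r
    ∑-stars with ℕ.nonZero? n
    ... | yes _  = +ₚ-identityʳ (ζ* r p q ·ₚ 𝐮 r)
    ... | no n≡0 rewrite ℕ.m≤n⇒m∸n≡0 {n} {∣ F ∣} (ℕ.≤-trans (ℕ.≮⇒≥ (n≡0 ∘ >-nonZero)) z≤n) = ≋-refl

    ∑-term : ∑ semiElements term ≋ 𝐮-sum ψ r p q +ₚ ζ* r p q ·ₚ 𝐮 r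
    ∑-term = begin
      ∑ (faceElements (subsets v) ++ starElements ++ [ top ]) term
        ≡⟨ trans (∑-++ (faceElements (subsets v)) _ term)
                 (cong (∑ (faceElements (subsets v)) term +ₚ_) (∑-++ starElements [ top ] term)) ⟩
      ∑ (faceElements (subsets v)) term +ₚ (∑ starElements term +ₚ [])
        ≈⟨ +ₚ-cong (∑-faces (subsets v)) (≋-trans (+ₚ-identityʳ _) ∑-stars) ⟩
      ∑ (subsets v) (λ H → when (F ⊆? H) (split-term (split m F H))) +ₚ ζ* r p q ·ₚ 𝐮 r
        ≡⟨ cong (_+ₚ ζ* r p q ·ₚ 𝐮 r) (trans (∑-when (F ⊆?_) (subsets v) (split-term ∘ split m F))
                                              (∑-supersets m F split-term)) ⟩
      𝐮-sum ψ r p q +ₚ ζ* r p q ·ₚ 𝐮 r ∎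

-- The simplicial shelling components

missˡ-∅ : ∀ {m v} → m ≤ v → missˡ m (⊥ {v}) ≡ m
missˡ-∅ z≤n       = refl
missˡ-∅ (s≤s m≤v) = cong suc (missˡ-∅ m≤v)

missʳ-∅ : ∀ m v → missʳ m (⊥ {v}) ≡ v ∸ m
missʳ-∅ zero    zero    = refl
missʳ-∅ (suc m) zero    = refl
missʳ-∅ zero    (suc v) = cong suc (missʳ-∅ zero v)
missʳ-∅ (suc m) (suc v) = missʳ-∅ m v

∉⇒missˡ : ∀ {v m} (F : Subset v) {x} → toℕ x < m → x Subset.∉ F → 0 < missˡ m F
∉⇒missˡ {m = suc m} (outside ∷ F)         _         _   = z<s
∉⇒missˡ {m = suc m} (inside ∷ F) {zero}  _         x∉F = ⊥-elim (x∉F here)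
∉⇒missˡ {m = suc m} (inside ∷ F) {suc x} (s≤s x<m) x∉F = ∉⇒missˡ F x<m (x∉F ∘ there)

missˡ⇒∉ : ∀ {v m} (F : Subset v) → 0 < missˡ m F → ∃ λ x → toℕ x < m × x Subset.∉ F
missˡ⇒∉ {m = suc m} (outside ∷ F) _  = zero , z<s , λ ()
missˡ⇒∉ {m = suc m} (inside ∷ F) 0< with missˡ⇒∉ F 0<
... | x , x<m , x∉F = suc x , s≤s x<m , x∉F ∘ drop-there

module _ {k i} (i≤k : i ≤ k) where
  open SimplicialComplex (Δ⟨ k , i ⟩ i≤k)

  face⇒missˡ : ∀ {F} → Face F → 0 < missˡ (suc i) F
  face⇒missˡ {F} (j , F⊆) = ∉⇒missˡ F {inject≤ j (s≤s i≤k)}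
    (subst (_< suc i) (sym (toℕ-inject≤ j (s≤s i≤k))) (toℕ<n j))
    (λ x∈F → x∈∁p⇒x∉p (F⊆ x∈F) (x∈⁅x⁆ _))

  missˡ⇒face : ∀ {F} → 0 < missˡ (suc i) F → Face F
  missˡ⇒face {F} 0< with missˡ⇒∉ F 0<
  ... | x , x≤i , x∉F = fromℕ< x≤i , λ {y} y∈F → x∉p⇒x∈∁p λ y∈⁅⁆ →
    x∉F (subst (Subset._∈ F) (trans (x∈⁅y⁆⇒x≡y _ y∈⁅⁆) (toℕ-injective
      (trans (toℕ-inject≤ (fromℕ< x≤i) (s≤s i≤k)) (toℕ-fromℕ< x≤i)))) y∈F)

Ψ-P : ∀ n k i (i≤k : i ≤ k) (k≤n : k ≤ n) → Ψ (P n k i i≤k k≤n) ≋ ψ n (suc i) (k ∸ i)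
Ψ-P n k i i≤k k≤n = begin
  Ψ (P n k i i≤k k≤n)
    -- The number of steps is the rank of the whole poset, which meets the bound with equality; ∣∅∣
    -- does not compute to 0 for a variable k.
    ≈⟨ chainSum-face (Δ⟨ k , i ⟩ i≤k) n (suc i) (Δ-dim i≤k k≤n)
         (face⇒missˡ i≤k) (missˡ⇒face i≤k) (suc n ∸ ∣ ∅ ∣) ∅-face
         (ℕ.≤-reflexive (sym (ℕ.m∸n+n≡m (subst (_≤ suc n) (sym ∣∅∣≡0) z≤n)))) ⟩
  ψ (n ∸ ∣ ∅ ∣) (missˡ (suc i) ∅) (missʳ (suc i) ∅)
    ≡⟨ cong (λ l → ψ (n ∸ l) (missˡ (suc i) ∅) (missʳ (suc i) ∅)) ∣∅∣≡0 ⟩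
  ψ n (missˡ (suc i) ∅) (missʳ (suc i) ∅)
    ≡⟨ cong₂ (ψ n) (missˡ-∅ (s≤s i≤k)) (missʳ-∅ (suc i) (suc k)) ⟩
  ψ n (suc i) (k ∸ i) ∎
  where
  open ≋-Reasoning
  open SimplicialComplex (Δ⟨ k , i ⟩ i≤k) using (∅-face)
  ∅ : Subset (suc k)
  ∅ = ⊥
  ∣∅∣≡0 : ∣ ∅ ∣ ≡ 0
  ∣∅∣≡0 = ∣⊥∣≡0 (suc k)

-- For i = 0 the term subtracted in `φ` belongs to the void complex, so both cases of `Φ̌` take one
-- form.
Φ̌≋φ : ∀ n k i (i≤k : i ≤ k) (k≤n : k ≤ n) → Φ̌ n k i i≤k k≤n ≋ φ n i (k ∸ i)
Φ̌≋φ n k zero    i≤k k≤n = begin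
  Ψ (P n k 0 i≤k k≤n)        ≈⟨ Ψ-P n k 0 i≤k k≤n ⟩
  ψ n 1 k                    ≈⟨ +ₚ-identityʳ (ψ n 1 k) ⟨
  ψ n 1 k -ₚ []              ≈⟨ -ₚ-cong (≋-refl {ψ n 1 k}) (ψ-zero n (suc k)) ⟨
  φ n 0 k                    ∎
  where open ≋-Reasoning
Φ̌≋φ n k (suc i) i<k k≤n = -ₚ-cong (Ψ-P n k (suc i) i<k k≤n)
  (≋-trans (Ψ-P n k i (ℕ.<⇒≤ i<k) k≤n) (≋-reflexive (cong (ψ n (suc i)) (ℕ.+-∸-assoc 1 i<k))))

-- The posets Ω

module _ (r : ℕ) where
  open Omega (suc r)
  private
    module P = BoundedQuasiGradedPoset (Ω (suc r))
  open ChainSum (Ω (suc r))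

  chainSum-c : ∀ N → chainSum (suc N) c ≋ 1ₚ
  chainSum-c N = begin
    chainSum (suc N) c
      ≈⟨ chainSum-suc N c ⟩
    (P.step c top +ₚ []) +ₚ (P.step c top *ₚ 𝐛 *ₚ chainSum N top +ₚ [])
      ≈⟨ +ₚ-cong (+ₚ-identityʳ (P.step c top))
           (≋-trans (+ₚ-identityʳ _) (*ₚ-chainSum-1̂ (P.step c top *ₚ 𝐛) N)) ⟩
    P.step c top +ₚ []
      ≈⟨ ≋-trans (+ₚ-identityʳ (P.step c top)) (·ₚ-identityˡ _) ⟩
    𝐞 ^ₚ (suc (suc r) ∸ suc r ∸ 1)
      ≡⟨ cong (λ l → 𝐞 ^ₚ (l ∸ 1)) (ℕ.m+n∸n≡m 1 (suc r)) ⟩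
    1ₚ ∎
    where open ≋-Reasoning

-- Above p only c and the top remain, with `ζ̄` value 1 - (-1)^r at c: the semisuspension of {∅}
-- with n = r. For r = 0 both p < c and the star are absent.
chainSum-p : ∀ r → ChainSum.chainSum (Ω (suc r)) (suc r) Omega.p ≋ 𝐭 (1ℤ ℤ.- -1ℤ ℤ.^ r) r
chainSum-p zero    = ≋-intro λ f → refl
chainSum-p (suc r) = begin
  chainSum (2 + r) p
    ≈⟨ chainSum-suc (suc r) p ⟩
  (P.step p top +ₚ []) +ₚ
  (P.step p c *ₚ 𝐛 *ₚ chainSum (suc r) c +ₚ (P.step p top *ₚ 𝐛 *ₚ chainSum (suc r) top +ₚ []))
    ≈⟨ +ₚ-cong (+ₚ-identityʳ (P.step p top)) (+ₚ-cong
         (≋-trans (*ₚ-cong (step-*ₚ-𝐛 {p} {c} (p≤c (s≤s (s≤s z≤n)) , λ ())) (chainSum-c (suc r) r)) (*ₚ-identityʳ _))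
         (≋-trans (+ₚ-identityʳ _) (*ₚ-chainSum-1̂ (P.step p top *ₚ 𝐛) (suc r)))) ⟩
  P.step p top +ₚ ((1ℤ ℤ.+ -1ℤ ℤ.^ (2 + r)) ·ₚ 𝐮 (suc r) +ₚ [])
    ≈⟨ +ₚ-cong (·ₚ-identityˡ (𝐞 ^ₚ suc r)) (+ₚ-identityʳ ((1ℤ ℤ.+ -1ℤ ℤ.^ (2 + r)) ·ₚ 𝐮 (suc r))) ⟩
  𝐞 ^ₚ suc r +ₚ (1ℤ ℤ.+ -1ℤ ℤ.^ (2 + r)) ·ₚ 𝐮 (suc r)
    ≡⟨ cong (λ i → 𝐞 ^ₚ suc r +ₚ (1ℤ ℤ.+ i) ·ₚ 𝐮 (suc r)) (ℤ.-1*i≡-i (-1ℤ ℤ.^ suc r)) ⟩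
  𝐭 (1ℤ ℤ.- -1ℤ ℤ.^ suc r) (suc r) ∎
  where
  open ≋-Reasoning
  open Omega (2 + r)
  module P = BoundedQuasiGradedPoset (Ω (2 + r))
  open ChainSum (Ω (2 + r))

-- Chains avoiding p, through c or not, give `𝐭 1ℤ (suc r)`; a chain through p begins with the
-- factor `𝐛`.
Ψ-Ω : ∀ r → Ψ (Ω (suc r)) ≋ 𝐭 1ℤ (suc r) +ₚ 𝐛 *ₚ 𝐭 (1ℤ ℤ.- -1ℤ ℤ.^ r) r
Ψ-Ω r = begin
  chainSum (2 + r) bot
    ≈⟨ chainSum-suc (suc r) bot ⟩
  (P.step bot top +ₚ []) +ₚ
  (P.step bot p *ₚ 𝐛 *ₚ chainSum (suc r) p +ₚ
   (P.step bot c *ₚ 𝐛 *ₚ chainSum (suc r) c +ₚ (P.step bot top *ₚ 𝐛 *ₚ chainSum (suc r) top +ₚ [])))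
    ≈⟨ +ₚ-cong (≋-trans (+ₚ-identityʳ (P.step bot top)) (·ₚ-identityˡ _))
         (+ₚ-cong (*ₚ-cong (≋-trans (step-*ₚ-𝐛 {bot} {p} (bot≤ , λ ())) (≋-trans (·ₚ-identityˡ _) 𝐮₁≋𝐛)) (chainSum-p r))
         (+ₚ-cong (≋-trans (*ₚ-cong (step-*ₚ-𝐛 {bot} {c} (bot≤ , λ ())) (chainSum-c r r)) (*ₚ-identityʳ _))
           (≋-trans (+ₚ-identityʳ _) (*ₚ-chainSum-1̂ (P.step bot top *ₚ 𝐛) (suc r))))) ⟩
  𝐞 ^ₚ suc r +ₚ (𝐛 *ₚ T +ₚ (1ℤ ·ₚ 𝐮 (suc r) +ₚ []))
    ≈⟨ rearrange (𝐞 ^ₚ suc r) (𝐛 *ₚ T) (1ℤ ·ₚ 𝐮 (suc r)) ⟩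
  𝐭 1ℤ (suc r) +ₚ 𝐛 *ₚ T ∎
  where
  open ≋-Reasoning
  open Omega (suc r)
  module P = BoundedQuasiGradedPoset (Ω (suc r))
  open ChainSum (Ω (suc r))
  T = 𝐭 (1ℤ ℤ.- -1ℤ ℤ.^ r) r
  rearrange : ∀ s t u → s +ₚ (t +ₚ (u +ₚ [])) ≋ (s +ₚ u) +ₚ t
  rearrange s t u = ≋-intro λ f →
    trans (lin-+ₚ s (t +ₚ (u +ₚ [])) f)
    (trans (cong (ℤ._+_ (lin s f)) (trans (lin-+ₚ t (u +ₚ []) f) (cong (ℤ._+_ (lin t f)) (lin-+ₚ u [] f))))
    (trans (eq (lin s f) (lin t f) (lin u f))
    (sym (trans (lin-+ₚ (s +ₚ u) t f) (cong (ℤ._+ lin t f) (lin-+ₚ s u f))))))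
    where
    eq : ∀ i j k → i ℤ.+ (j ℤ.+ (k ℤ.+ 0ℤ)) ≡ (i ℤ.+ k) ℤ.+ j
    eq = solve-∀

-- The power of `𝐞` is the last step of a Boolean chain, with q + 1 vertices still to be added. It
-- lengthens the chains avoiding p to those of the initial term for a simplex, and turns the `𝐛`
-- before p into the weight of the full set.
𝐞^-*ₚ-Ψ-Ω : ∀ q r → 𝐞 ^ₚ q *ₚ Ψ (Ω (suc r)) ≋ φ₀ (r + suc q) 0 (suc q) +ₚ 𝐮 (suc q) *ₚ φ r 0 0
𝐞^-*ₚ-Ψ-Ω q r = begin
  E *ₚ Ψ (Ω (suc r))
    ≈⟨ *ₚ-congˡ E (Ψ-Ω r) ⟩
  E *ₚ (𝐭 1ℤ (suc r) +ₚ 𝐛 *ₚ T)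
    ≈⟨ *ₚ-distribˡ-+ₚ E (𝐭 1ℤ (suc r)) (𝐛 *ₚ T) ⟩
  E *ₚ 𝐭 1ℤ (suc r) +ₚ E *ₚ (𝐛 *ₚ T)
    ≈⟨ +ₚ-cong E*𝐭 (≋-sym (*ₚ-assoc E 𝐛 T)) ⟩
  φ₀ (r + suc q) 0 (suc q) +ₚ 𝐮 (suc q) *ₚ T
    ≈⟨ +ₚ-congˡ (φ₀ (r + suc q) 0 (suc q)) (*ₚ-congˡ (𝐮 (suc q)) (φ-point r)) ⟨
  φ₀ (r + suc q) 0 (suc q) +ₚ 𝐮 (suc q) *ₚ φ r 0 0 ∎
  where
  open ≋-Reasoning
  E = 𝐞 ^ₚ q
  T = 𝐭 (1ℤ ℤ.- -1ℤ ℤ.^ r) r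
  E*𝐭 : E *ₚ 𝐭 1ℤ (suc r) ≋ φ₀ (r + suc q) 0 (suc q)
  E*𝐭 = begin
    E *ₚ (𝐞 ^ₚ suc r +ₚ 1ℤ ·ₚ 𝐮 (suc r))
      ≈⟨ *ₚ-distribˡ-+ₚ E (𝐞 ^ₚ suc r) (1ℤ ·ₚ 𝐮 (suc r)) ⟩
    E *ₚ 𝐞 ^ₚ suc r +ₚ E *ₚ (1ℤ ·ₚ 𝐮 (suc r))
      ≈⟨ +ₚ-cong (≋-sym (^ₚ-+ 𝐞 q (suc r)))
                 (≋-trans (*ₚ-·ₚ-comm 1ℤ E (𝐮 (suc r))) (·ₚ-congˡ 1ℤ (𝐞^-*ₚ-𝐮 q r))) ⟩
    𝐞 ^ₚ (q + suc r) +ₚ 1ℤ ·ₚ 𝐮 (suc (q + r))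
      ≡⟨ cong (λ l → 𝐞 ^ₚ l +ₚ 1ℤ ·ₚ 𝐮 (suc (q + r))) (ℕ.+-suc q r) ⟩
    𝐭 1ℤ (suc (q + r))
      ≡⟨ cong (𝐭 1ℤ) (trans (cong suc (ℕ.+-comm q r)) (sym (ℕ.+-suc r q))) ⟩
    𝐭 1ℤ (r + suc q)
      ≈⟨ φ₀-initial (r + suc q) q ⟨
    φ₀ (r + suc q) 0 (suc q) ∎

-- Boolean algebras

∣F∣+missʳ : ∀ {v} (F : Subset v) → ∣ F ∣ + missʳ 0 F ≡ v
∣F∣+missʳ []            = refl
∣F∣+missʳ (outside ∷ F) = trans (ℕ.+-suc ∣ F ∣ (missʳ 0 F)) (cong suc (∣F∣+missʳ F))
∣F∣+missʳ (inside ∷ F)  = cong suc (∣F∣+missʳ F)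

missʳ≡0⇒full : ∀ {v} (F : Subset v) → missʳ 0 F ≡ 0 → F ≡ ⊤
missʳ≡0⇒full []           _  = refl
missʳ≡0⇒full (inside ∷ F) eq = cong (inside ∷_) (missʳ≡0⇒full F eq)

missʳ-full : ∀ v → missʳ 0 (⊤ {v}) ≡ 0
missʳ-full zero    = refl
missʳ-full (suc v) = missʳ-full v

module _ (k : ℕ) .{{_ : NonZero k}} (r : ℕ) where
  private
    module P = BoundedQuasiGradedPoset (Boolean k)
  open ChainSum (Boolean k)

  private
    W = Ψ (Ω (suc r))

    -- No chain leads from the full set to itself, but the recursion of `φ` has a term for the full
    -- set. Adding it makes the induction hypothesis uniform.
    φ-at-full : ℕ → Poly
    φ-at-full zero    = φ r 0 0
    φ-at-full (suc _) = []

  missʳ-⊆ : ∀ {F H : Subset k} → F ⊆ H → missʳ 0 F ≡ (∣ H ∣ ∸ ∣ F ∣) + missʳ 0 H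
  missʳ-⊆ {F} {H} F⊆H = ℕ.+-cancelˡ-≡ ∣ F ∣ _ _ (begin
    ∣ F ∣ + missʳ 0 F                          ≡⟨ trans (∣F∣+missʳ F) (sym (∣F∣+missʳ H)) ⟩
    ∣ H ∣ + missʳ 0 H                          ≡⟨ cong (_+ missʳ 0 H) (ℕ.m+[n∸m]≡n (p⊆q⇒∣p∣≤∣q∣ F⊆H)) ⟨
    ∣ F ∣ + (∣ H ∣ ∸ ∣ F ∣) + missʳ 0 H        ≡⟨ ℕ.+-assoc ∣ F ∣ _ _ ⟩
    ∣ F ∣ + ((∣ H ∣ ∸ ∣ F ∣) + missʳ 0 H)      ∎)
    where open ≡-Reasoning

  -- Both sides obey one recursion over the supersets of `F`. All vertices outside `F` lie in the
  -- second group, since `φ` with p = 0 sums over sets avoiding the distinguished vertex.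
  chainSum-*ₚ-Ψ-Ω : ∀ N F → missʳ 0 F ≤ N →
    chainSum N F *ₚ W +ₚ φ-at-full (missʳ 0 F) ≋ φ (r + missʳ 0 F) 0 (missʳ 0 F)
  chainSum-*ₚ-Ψ-Ω N F q≤N with missʳ 0 F in q≡
  chainSum-*ₚ-Ψ-Ω N F q≤N | zero rewrite missʳ≡0⇒full F q≡ | ℕ.+-identityʳ r =
    +ₚ-congʳ (φ r 0 0) (*ₚ-congʳ W (chainSum-1̂ N))
  chainSum-*ₚ-Ψ-Ω (suc N) F (s≤s q≤N) | suc q = begin
    chainSum (suc N) F *ₚ W +ₚ []
      ≈⟨ ≋-trans (+ₚ-identityʳ _) (*ₚ-congʳ W (chainSum-suc N F)) ⟩
    (∑ (P.chains 0 F) (P.weight F) +ₚ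
     ∑ (filter (F P.⊏?_) (subsets k)) λ H → P.step F H *ₚ 𝐛 *ₚ chainSum N H) *ₚ W
      ≈⟨ *ₚ-congʳ W (+ₚ-cong (≋-trans (∑-chains-0 F⊏⊤) step-⊤)
           (∑-filter (F P.⊏?_) (subsets k) {g = λ H → when (F ⊆? H) (term H)} above not-above)) ⟩
    (𝐞 ^ₚ q +ₚ ∑ (subsets k) (λ H → when (F ⊆? H) (term H))) *ₚ W
      ≡⟨ cong (λ s → (𝐞 ^ₚ q +ₚ s) *ₚ W) (∑-when (F ⊆?_) (subsets k) term) ⟩
    (𝐞 ^ₚ q +ₚ ∑ (supersets F) term) *ₚ W
      ≈⟨ *ₚ-distribʳ-+ₚ W (𝐞 ^ₚ q) (∑ (supersets F) term) ⟩
    𝐞 ^ₚ q *ₚ W +ₚ ∑ (supersets F) term *ₚ W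
      ≈⟨ +ₚ-cong (𝐞^-*ₚ-Ψ-Ω q r) (∑-distribʳ-*ₚ (supersets F) W term) ⟩
    φ₀ (r + suc q) 0 (suc q) +ₚ 𝐮 (suc q) *ₚ φ r 0 0 +ₚ ∑ (supersets F) (λ H → term H *ₚ W)
      ≡⟨ List.++-assoc (φ₀ (r + suc q) 0 (suc q)) (𝐮 (suc q) *ₚ φ r 0 0) _ ⟩
    φ₀ (r + suc q) 0 (suc q) +ₚ (𝐮 (suc q) *ₚ φ r 0 0 +ₚ ∑ (supersets F) (λ H → term H *ₚ W))
      ≈⟨ +ₚ-congˡ (φ₀ (r + suc q) 0 (suc q)) sum-eq ⟩
    φ₀ (r + suc q) 0 (suc q) +ₚ 𝐮-sum φ (r + suc q) 0 (suc q)
      ≈⟨ φ-rec (r + suc q) 0 (suc q) ⟨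
    φ (r + suc q) 0 (suc q) ∎
    where
    open ≋-Reasoning

    term : Subset k → Poly
    term H = 𝐮 (∣ H ∣ ∸ ∣ F ∣) *ₚ chainSum N H

    F≢⊤ : F ≢ ⊤
    F≢⊤ F≡⊤ with trans (sym q≡) (trans (cong (missʳ 0) F≡⊤) (missʳ-full k))
    ... | ()

    F⊏⊤ : F P.⊏ ⊤
    F⊏⊤ = ⊆-max F , F≢⊤

    step-⊤ : P.step F ⊤ ≋ 𝐞 ^ₚ q
    step-⊤ = ≋-trans (·ₚ-identityˡ _) (≋-reflexive (cong (λ l → 𝐞 ^ₚ (l ∸ 1)) (≡.begin
      ∣ ⊤ {k} ∣ ∸ ∣ F ∣             ≡.≡⟨ cong (_∸ ∣ F ∣) (trans (∣⊤∣≡n k) (sym (∣F∣+missʳ F))) ⟩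
      ∣ F ∣ + missʳ 0 F ∸ ∣ F ∣     ≡.≡⟨ ℕ.m+n∸m≡n ∣ F ∣ (missʳ 0 F) ⟩
      missʳ 0 F                     ≡.≡⟨ q≡ ⟩
      suc q                         ≡.∎)))
      where module ≡ = ≡-Reasoning

    above : ∀ H → F P.⊏ H → P.step F H *ₚ 𝐛 *ₚ chainSum N H ≋ when (F ⊆? H) (term H)
    above H F⊏H@(F⊆H , _) = ≋-trans
      (*ₚ-congʳ (chainSum N H) (≋-trans (step-*ₚ-𝐛 F⊏H) (·ₚ-identityˡ _)))
      (≋-sym (when-yes (F ⊆? H) (term H) F⊆H))

    not-above : ∀ H → ¬ F P.⊏ H → when (F ⊆? H) (term H) ≋ []
    not-above H F⊏̸H with F ≟ˢ H
    ... | no F≢H   = when-no (F ⊆? H) (term H) λ F⊆H → F⊏̸H (F⊆H , F≢H)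
    ... | yes refl = vanish
      where
      vanish : when (F ⊆? F) (term F) ≋ []
      vanish with does (F ⊆? F)
      ... | false = ≋-refl
      ... | true rewrite ℕ.n∸n≡0 ∣ F ∣ = ≋-refl

    splits-term : ℕ × ℕ × ℕ → Poly
    splits-term (j , p′ , q′) = 𝐮 j *ₚ φ (r + suc q ∸ j) p′ q′

    full-term : ℕ × ℕ × ℕ → Poly
    full-term (j , _ , q′) = 𝐮 j *ₚ φ-at-full q′

    on-superset : ∀ H → F ⊆ H → full-term (split 0 F H) +ₚ term H *ₚ W ≋ splits-term (split 0 F H)
    on-superset H F⊆H with ∣ H ∣ ∸ ∣ F ∣ in j≡
    ... | zero  = ≋-refl
    ... | suc j = begin
      U *ₚ φ-at-full (missʳ 0 H) +ₚ U *ₚ chainSum N H *ₚ W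
        ≈⟨ +ₚ-congˡ (U *ₚ φ-at-full (missʳ 0 H)) (*ₚ-assoc U (chainSum N H) W) ⟩
      U *ₚ φ-at-full (missʳ 0 H) +ₚ U *ₚ (chainSum N H *ₚ W)
        ≈⟨ *ₚ-distribˡ-+ₚ U (φ-at-full (missʳ 0 H)) (chainSum N H *ₚ W) ⟨
      U *ₚ (φ-at-full (missʳ 0 H) +ₚ chainSum N H *ₚ W)
        ≈⟨ *ₚ-congˡ U (≋-trans (+ₚ-comm (φ-at-full (missʳ 0 H)) (chainSum N H *ₚ W))
                               (chainSum-*ₚ-Ψ-Ω N H bound)) ⟩
      U *ₚ φ (r + missʳ 0 H) 0 (missʳ 0 H)
        ≡⟨ cong (λ l → U *ₚ φ l 0 (missʳ 0 H)) corank ⟩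
      U *ₚ φ (r + suc q ∸ suc j) 0 (missʳ 0 H) ∎
      where
      U = 𝐮 (suc j)
      q-eq : q ≡ j + missʳ 0 H
      q-eq = ℕ.suc-injective (trans (sym q≡) (trans (missʳ-⊆ F⊆H) (cong (_+ missʳ 0 H) j≡)))
      bound : missʳ 0 H ≤ N
      bound = ℕ.≤-trans (ℕ.≤-trans (ℕ.m≤n+m _ j) (ℕ.≤-reflexive (sym q-eq))) q≤N
      corank : r + missʳ 0 H ≡ r + suc q ∸ suc j
      corank = sym (trans (ℕ.+-∸-assoc r {suc q} {suc j} (s≤s (subst (j ≤_) (sym q-eq) (ℕ.m≤m+n j _))))
        (cong (_+_ r) (trans (cong (_∸ j) q-eq) (ℕ.m+n∸m≡n j _))))

    sum-eq : 𝐮 (suc q) *ₚ φ r 0 0 +ₚ ∑ (supersets F) (λ H → term H *ₚ W) ≋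
             𝐮-sum φ (r + suc q) 0 (suc q)
    sum-eq = begin
      𝐮 (suc q) *ₚ φ r 0 0 +ₚ ∑ (supersets F) (λ H → term H *ₚ W)
        -- The summand coming from Ω is the term of the full set, the only one with empty
        -- complement.
        ≈⟨ +ₚ-congʳ _ (∑-splits-full (suc q) {full-term} λ j _ _ → *ₚ-zeroʳ (𝐮 j)) ⟨
      ∑ (splits 0 (suc q)) full-term +ₚ ∑ (supersets F) (λ H → term H *ₚ W)
        ≡⟨ cong (_+ₚ ∑ (supersets F) (λ H → term H *ₚ W)) (to-supersets full-term) ⟩
      ∑ (supersets F) (full-term ∘ split 0 F) +ₚ ∑ (supersets F) (λ H → term H *ₚ W)
        ≈⟨ ∑-distrib-+ₚ (supersets F) _ _ ⟨
      ∑ (supersets F) (λ H → full-term (split 0 F H) +ₚ term H *ₚ W)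
        ≈⟨ ∑-cong-∈ (supersets F) (λ {H} H∈ → on-superset H (proj₂ (∈-filter⁻ (F ⊆?_) {xs = subsets k} H∈))) ⟩
      ∑ (supersets F) (splits-term ∘ split 0 F)
        ≡⟨ to-supersets splits-term ⟨
      𝐮-sum φ (r + suc q) 0 (suc q) ∎
      where
      to-supersets : ∀ f → ∑ (splits 0 (suc q)) f ≡ ∑ (supersets F) (f ∘ split 0 F)
      to-supersets f = trans (cong (λ l → ∑ (splits 0 l) f) (sym q≡)) (sym (∑-supersets 0 F f))

Ψ-Boolean-*ₚ-Ψ-Ω : ∀ k .{{_ : NonZero k}} r → Ψ (Boolean k) *ₚ Ψ (Ω (suc r)) ≋ φ (r + k) 0 k
Ψ-Boolean-*ₚ-Ψ-Ω (suc k) r = begin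
  𝐁 *ₚ Ψ (Ω (suc r))
    ≈⟨ +ₚ-identityʳ _ ⟨
  𝐁 *ₚ Ψ (Ω (suc r)) +ₚ []
    ≈⟨ at-∅ (chainSum-*ₚ-Ψ-Ω (suc k) r (∣ ⊤ {suc k} ∣ ∸ ∣ ⊥ {suc k} ∣) ⊥
         (ℕ.≤-reflexive (trans miss (sym (cong₂ _∸_ (∣⊤∣≡n (suc k)) (∣⊥∣≡0 (suc k))))))) ⟩
  φ (r + suc k) 0 (suc k) ∎
  where
  open ≋-Reasoning
  𝐁 = Ψ (Boolean (suc k))
  miss : missʳ 0 (⊥ {suc k}) ≡ suc k
  miss = missʳ-∅ 0 (suc k)
  at-∅ : ∀ {s} → s ≋ φ (r + missʳ 0 (⊥ {suc k})) 0 (missʳ 0 (⊥ {suc k})) → s ≋ φ (r + suc k) 0 (suc k)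
  at-∅ {s} = subst (λ l → s ≋ φ (r + l) 0 l) miss

-- The boundary case k = 0

𝐜²-2𝐝≋𝐞² : 𝐜 ^ₚ 2 -ₚ (+ 2) ·ₚ 𝐝 ≋ 𝐞 ^ₚ 2
𝐜²-2𝐝≋𝐞² = ≋-intro λ f →
  eq (f (a ∷ a ∷ [])) (f (a ∷ b ∷ [])) (f (b ∷ a ∷ [])) (f (b ∷ b ∷ []))
  where
  eq : ∀ w x y z →
    1ℤ ℤ.* w ℤ.+ (1ℤ ℤ.* x ℤ.+ (1ℤ ℤ.* y ℤ.+ (1ℤ ℤ.* z ℤ.+
      (ℤ.- (+ 2) ℤ.* x ℤ.+ (ℤ.- (+ 2) ℤ.* y ℤ.+ 0ℤ))))) ≡
    1ℤ ℤ.* w ℤ.+ (-1ℤ ℤ.* x ℤ.+ (-1ℤ ℤ.* y ℤ.+ (1ℤ ℤ.* z ℤ.+ 0ℤ)))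
  eq = solve-∀

𝐜≋𝐞+2𝐛 : 𝐜 ≋ 𝐞 +ₚ (+ 2) ·ₚ 𝐛
𝐜≋𝐞+2𝐛 = ≋-intro λ f → eq (f [ a ]) (f [ b ])
  where
  eq : ∀ x y → 1ℤ ℤ.* x ℤ.+ (1ℤ ℤ.* y ℤ.+ 0ℤ) ≡ 1ℤ ℤ.* x ℤ.+ (-1ℤ ℤ.* y ℤ.+ ((+ 2) ℤ.* y ℤ.+ 0ℤ))
  eq = solve-∀

^ₚ-cong : ∀ {p q} m → p ≋ q → p ^ₚ m ≋ q ^ₚ m
^ₚ-cong zero    p≋q = ≋-refl
^ₚ-cong (suc m) p≋q = *ₚ-cong p≋q (^ₚ-cong m p≋q)

𝐞^[m*2] : ∀ m → (𝐜 ^ₚ 2 -ₚ (+ 2) ·ₚ 𝐝) ^ₚ m ≋ 𝐞 ^ₚ (m * 2)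
𝐞^[m*2] m = ≋-trans (^ₚ-cong m 𝐜²-2𝐝≋𝐞²) (squares m)
  where
  squares : ∀ m → (𝐞 ^ₚ 2) ^ₚ m ≋ 𝐞 ^ₚ (m * 2)
  squares zero    = ≋-refl
  squares (suc m) = ≋-trans (*ₚ-congˡ (𝐞 ^ₚ 2) (squares m)) (≋-sym (^ₚ-+ 𝐞 2 (m * 2)))

-1^[m*2] : ∀ m → -1ℤ ℤ.^ (m * 2) ≡ 1ℤ
-1^[m*2] zero    = refl
-1^[m*2] (suc m) rewrite -1^[m*2] m = refl

-- For even n the coefficient 1 - (-1)^n is 0 and only the chain ∅ < 1̂ counts.
φ-point-even : ∀ m → φ (m * 2) 0 0 ≋ (𝐜 ^ₚ 2 -ₚ (+ 2) ·ₚ 𝐝) ^ₚ m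
φ-point-even m = begin
  φ (m * 2) 0 0                               ≈⟨ φ-point (m * 2) ⟩
  𝐭 (1ℤ ℤ.- -1ℤ ℤ.^ (m * 2)) (m * 2)          ≡⟨ cong (λ i → 𝐭 (1ℤ ℤ.- i) (m * 2)) (-1^[m*2] m) ⟩
  𝐭 0ℤ (m * 2)                                ≈⟨ (≋-intro λ f → trans (lin-𝐭 0ℤ (m * 2) f) (ℤ.+-identityʳ _)) ⟩
  𝐞 ^ₚ (m * 2)                                ≈⟨ 𝐞^[m*2] m ⟨
  (𝐜 ^ₚ 2 -ₚ (+ 2) ·ₚ 𝐝) ^ₚ m                 ∎
  where open ≋-Reasoning

-- For odd n the coefficient is 2, and 𝐞^n + 2 𝐞^(n-1) 𝐛 factors as 𝐞^(n-1) (𝐞 + 2𝐛), whose last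
-- factor is `𝐜`.
φ-point-odd : ∀ m → φ (suc (m * 2)) 0 0 ≋ (𝐜 ^ₚ 2 -ₚ (+ 2) ·ₚ 𝐝) ^ₚ m *ₚ 𝐜
φ-point-odd m = begin
  φ (suc (m * 2)) 0 0
    ≈⟨ φ-point (suc (m * 2)) ⟩
  𝐭 (1ℤ ℤ.- -1ℤ ℤ.* -1ℤ ℤ.^ (m * 2)) (suc (m * 2))
    ≡⟨ cong (λ i → 𝐭 (1ℤ ℤ.- -1ℤ ℤ.* i) (suc (m * 2))) (-1^[m*2] m) ⟩
  𝐞 *ₚ E +ₚ (+ 2) ·ₚ (E *ₚ 𝐛)
    ≈⟨ +ₚ-cong (^ₚ-suc-comm 𝐞 (m * 2)) (*ₚ-·ₚ-comm (+ 2) E 𝐛) ⟨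
  E *ₚ 𝐞 +ₚ E *ₚ ((+ 2) ·ₚ 𝐛)
    ≈⟨ *ₚ-distribˡ-+ₚ E 𝐞 ((+ 2) ·ₚ 𝐛) ⟨
  E *ₚ (𝐞 +ₚ (+ 2) ·ₚ 𝐛)
    ≈⟨ *ₚ-cong (𝐞^[m*2] m) 𝐜≋𝐞+2𝐛 ⟨
  (𝐜 ^ₚ 2 -ₚ (+ 2) ·ₚ 𝐝) ^ₚ m *ₚ 𝐜 ∎
  where
  open ≋-Reasoning
  E = 𝐞 ^ₚ (m * 2)

¬2∣⇒odd : ∀ n → ¬ (2 ∣ n) → n ≡ suc (n / 2 * 2)
¬2∣⇒odd n ¬2∣n with n % 2 in eq | m%n<n n 2 | m≡m%n+[m/n]*n n 2
... | 0           | _                | n≡ = ⊥-elim (¬2∣n (divides (n / 2) n≡))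
... | 1           | _                | n≡ = n≡
... | suc (suc _) | s≤s (s≤s ()) | _

theorem14p2 :
    (∀ n k i (i≤k : i ≤ k) (k≤n : k ≤ n) →
       G (Φ̌ n k i i≤k k≤n) ≈ₚ Φ̌ (suc n) (suc k) (suc i) (s≤s i≤k) (s≤s k≤n))
    × (∀ n k .{{_ : NonZero k}} (k≤n : k ≤ n) →
       Φ̌ n k 0 z≤n k≤n ≈ₚ Ψ (Boolean k) *ₚ Ψ (Ω (suc (n ∸ k))))
    × (∀ n → 2 ∣ n → Φ̌ n 0 0 z≤n z≤n ≈ₚ (𝐜 ^ₚ 2 -ₚ (+ 2) ·ₚ 𝐝) ^ₚ (n / 2))
    × (∀ n → ¬ (2 ∣ n) →
       Φ̌ n 0 0 z≤n z≤n ≈ₚ (𝐜 ^ₚ 2 -ₚ (+ 2) ·ₚ 𝐝) ^ₚ ((n ∸ 1) / 2) *ₚ 𝐜)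
theorem14p2 =
    (λ n k i i≤k k≤n → ≋⇒≈ₚ (recursion n k i i≤k k≤n))
  , (λ n k k≤n → ≋⇒≈ₚ (initial n k k≤n))
  , (λ n 2∣n → ≋⇒≈ₚ (even n 2∣n))
  , (λ n ¬2∣n → ≋⇒≈ₚ (odd n ¬2∣n))
  where
  open ≋-Reasoning

  recursion : ∀ n k i (i≤k : i ≤ k) (k≤n : k ≤ n) →
    G (Φ̌ n k i i≤k k≤n) ≋ Φ̌ (suc n) (suc k) (suc i) (s≤s i≤k) (s≤s k≤n)
  recursion n k i i≤k k≤n = begin
    G (Φ̌ n k i i≤k k≤n)          ≈⟨ G-cong (Φ̌≋φ n k i i≤k k≤n) ⟩
    G (φ n i (k ∸ i))            ≈⟨ G-φ n i (k ∸ i) (subst (_≤ n) (sym (ℕ.m+[n∸m]≡n i≤k)) k≤n) ⟩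
    φ (suc n) (suc i) (k ∸ i)    ≈⟨ Φ̌≋φ (suc n) (suc k) (suc i) (s≤s i≤k) (s≤s k≤n) ⟨
    Φ̌ (suc n) (suc k) (suc i) (s≤s i≤k) (s≤s k≤n) ∎

  initial : ∀ n k .{{_ : NonZero k}} (k≤n : k ≤ n) →
    Φ̌ n k 0 z≤n k≤n ≋ Ψ (Boolean k) *ₚ Ψ (Ω (suc (n ∸ k)))
  initial n k k≤n = begin
    Φ̌ n k 0 z≤n k≤n                      ≈⟨ Φ̌≋φ n k 0 z≤n k≤n ⟩
    φ n 0 k                              ≡⟨ cong (λ l → φ l 0 k) (ℕ.m∸n+n≡m k≤n) ⟨
    φ (n ∸ k + k) 0 k                    ≈⟨ Ψ-Boolean-*ₚ-Ψ-Ω k (n ∸ k) ⟨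
    Ψ (Boolean k) *ₚ Ψ (Ω (suc (n ∸ k))) ∎

  even : ∀ n → 2 ∣ n → Φ̌ n 0 0 z≤n z≤n ≋ (𝐜 ^ₚ 2 -ₚ (+ 2) ·ₚ 𝐝) ^ₚ (n / 2)
  even n (divides m refl) = begin
    Φ̌ (m * 2) 0 0 z≤n z≤n                    ≈⟨ Φ̌≋φ (m * 2) 0 0 z≤n z≤n ⟩
    φ (m * 2) 0 0                            ≈⟨ φ-point-even m ⟩
    (𝐜 ^ₚ 2 -ₚ (+ 2) ·ₚ 𝐝) ^ₚ m              ≡⟨ cong ((𝐜 ^ₚ 2 -ₚ (+ 2) ·ₚ 𝐝) ^ₚ_) (m*n/n≡m m 2) ⟨
    (𝐜 ^ₚ 2 -ₚ (+ 2) ·ₚ 𝐝) ^ₚ (m * 2 / 2)    ∎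

  odd : ∀ n → ¬ (2 ∣ n) → Φ̌ n 0 0 z≤n z≤n ≋ (𝐜 ^ₚ 2 -ₚ (+ 2) ·ₚ 𝐝) ^ₚ ((n ∸ 1) / 2) *ₚ 𝐜
  odd n ¬2∣n = begin
    Φ̌ n 0 0 z≤n z≤n
      ≈⟨ Φ̌≋φ n 0 0 z≤n z≤n ⟩
    φ n 0 0
      ≡⟨ cong (λ l → φ l 0 0) n≡ ⟩
    φ (suc (n / 2 * 2)) 0 0
      ≈⟨ φ-point-odd (n / 2) ⟩
    (𝐜 ^ₚ 2 -ₚ (+ 2) ·ₚ 𝐝) ^ₚ (n / 2) *ₚ 𝐜
      ≡⟨ cong (λ l → (𝐜 ^ₚ 2 -ₚ (+ 2) ·ₚ 𝐝) ^ₚ l *ₚ 𝐜)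
           (trans (cong (λ l → (l ∸ 1) / 2) n≡) (m*n/n≡m (n / 2) 2)) ⟨
    (𝐜 ^ₚ 2 -ₚ (+ 2) ·ₚ 𝐝) ^ₚ ((n ∸ 1) / 2) *ₚ 𝐜 ∎
    where n≡ = ¬2∣⇒odd n ¬2∣n
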